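{- For every positive integer $n$, in the polynomial ring in $u,v,x_1,\ldots,x_n$ we have \[ \mathcal{A}_n(u,v;\mathbf{x}) = \sum_{T \in \mathrm{TSPP}_{n-1}} \omega_{T}(u,v)\, s_{\pi(T)}(x_1,\ldots,x_n), \] where, if $\mathrm{diag}(T)$ has Frobenius notation $(a_1,\ldots,a_l\,|\,b_1,\ldots,b_l)$ (so that $\pi(T)=(a_1,\ldots,a_l\,|\,b_1+1,\ldots,b_l+1)$), \[ \omega_T(u,v)=u^{\sum_{i=1}^l (a_i+1)}\,(1-u-v)^{\sum_{i=1}^l(b_i-a_i)}\,v^{\binom{n}{2}-\sum_{i=1}^l(b_i+1)} . \] (For $l=0$ this is $v^{\binom n2}$ and $s_{\emptyset}=1$.)
   Context: Let $\mathbf{x}=(x_1,\ldots,x_n)$. The antisymmetrizer is $\mathrm{ASym}_{x_1,\ldots,x_n} f(\mathbf{x})=\sum_{\sigma\in S_n}\mathrm{sgn}(\sigma) f(x_{\sigma(1)},\ldots,x_{\sigma(n)})$, and \[ \mathcal{A}_n(u,v;\mathbf{x}) := \frac{\mathrm{ASym}_{x_1,\ldots,x_n}\left[\prod_{i=1}^n x_i^{i-1}\prod_{1\le i<j\le n}\bigl(v+(1-u-v)x_i+u x_i x_j\bigr)\right]}{\prod_{1\le i<j\le n}(x_j-x_i)}. \] $s_\lambda(x_1,\ldots,x_n)$ denotes the Schur polynomial in $n$ variables for a partition $\lambda$ with at most $n$ nonzero parts. For a partition $\lambda$ let $l=\max\{i:\lambda_i\ge i\}$ (side of the Durfee square, $l=0$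 for the empty partition) and $\lambda'$ the conjugate partition; the Frobenius notation of $\lambda$ is $(\lambda_1-1,\ldots,\lambda_l-l\,|\,\lambda'_1-1,\ldots,\lambda'_l-l)$, and a partition is determined by its Frobenius notation. A plane partition inside an $(m,m,m)$-box is a subset $\pi\subseteq\{1,\ldots,m\}^3$ such that $(i,j,k)\in\pi$ and $i'\le i,j'\le j,k'\le k$ (positive integers) imply $(i',j',k')\in\pi$; equivalently an array $(\pi_{i,j})_{1\le i,j\le m}$ of integers in $\{0,\ldots,m\}$, weakly decreasing along rows and columns, with $\pi_{i,j}=\#\{k:(i,j,k)\in\pi\}$. It is totally symmetric if it is invariant under all permutations of coordinates; $\mathrm{TSPP}_m$ is the set of totally symmetric plane partitions inside an $(m,m,m)$-box (for $m=0$ it consists only of the empty one). For $T=(T_{i,j})\in\mathrm{TSPP}_{n-1}$, $\mathrm{diag}(T)$ is the conjugate of the partition $(T_{1,1},\ldots,T_{n-1,n-1})$; if $\mathrm{diag}(T)=(a_1,\ldots,a_l|b_1,\ldots,b_l)$ in Frobenius notation, $\pi(T)$ is the partition with Frobenius notation $(a_1,\ldots,a_l|b_1+1,\ldots,b_l+1)$. -}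

module Defs where

open import Level using (Level)
open import Data.Bool using (Bool; true; false; _∧_; not; if_then_else_)
open import Data.Nat using (ℕ; zero; suc; _∸_; _≤ᵇ_; _<ᵇ_; _≡ᵇ_; pred)
open import Data.Nat.Combinatorics using (_C_)
open import Data.Nat renaming (_+_ to _+ℕ_) using ()
open import Data.Nat.ListAction using (sum)
open import Data.Fin using (Fin; toℕ)
open import Data.List using (List; []; _∷_; [_]; map; concatMap; filterᵇ; length; foldr; upTo; allFin; zipWith; _++_)
open import Data.Bool.ListAction using (all; any)
open import Data.Vec using (Vec; lookup)
open import Relation.Nullary.Decidable using (does)
open import Algebra.Bundles using (CommutativeRing; Semiring)

allLists : ∀ {a} {A : Set a} → List A → ℕ → List (List A)
allLists xs zero    = [ [] ]
allLists xs (suc k) = concatMap (λ a → map (a ∷_) (allLists xs k)) xs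

count : ∀ {a} {A : Set a} → (A → Bool) → List A → ℕ
count p xs = length (filterᵇ p xs)

nth : ∀ {a} {A : Set a} → A → List A → ℕ → A
nth d []       _       = d
nth d (x ∷ xs) zero    = x
nth d (x ∷ xs) (suc i) = nth d xs i

oneTo : ℕ → List ℕ
oneTo k = map suc (upTo k)

maxL : List ℕ → ℕ
maxL = foldr Data.Nat._⊔_ 0

finEq : ∀ {n} → Fin n → Fin n → Bool
finEq i j = toℕ i ≡ᵇ toℕ j

noDup : ∀ {n} → List (Fin n) → Bool
noDup []       = true
noDup (a ∷ as) = not (any (finEq a) as) ∧ noDup as

perms : (n : ℕ) → List (List (Fin n))
perms n = filterᵇ noDup (allLists (allFin n) n)

inversions : ∀ {n} → List (Fin n) → ℕ
inversions []       = 0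
inversions (a ∷ as) = count (λ b → toℕ b <ᵇ toℕ a) as +ℕ inversions as

isEven : ℕ → Bool
isEven zero    = true
isEven (suc k) = not (isEven k)

signPositive : ∀ {n} → List (Fin n) → Bool
signPositive σ = isEven (inversions σ)

-- Partitions (lists of positive parts, weakly decreasing),
-- conjugation and Frobenius notation

conj : List ℕ → List ℕ
conj lam = map (λ j → count (λ p → j ≤ᵇ p) lam) (oneTo (maxL lam))

durfee : List ℕ → ℕ
durfee lam = count (λ i → i ≤ᵇ nth 0 lam (pred i)) (oneTo (length lam))

frobA : List ℕ → List ℕ
frobA lam = map (λ i → nth 0 lam (pred i) ∸ i) (oneTo (durfee lam))

frobB : List ℕ → List ℕ
frobB lam = map (λ i → nth 0 (conj lam) (pred i) ∸ i) (oneTo (durfee lam))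

-- the partition with Frobenius notation (as | bs):
--   rows i ≤ l have length a_i + i; for i > l,
--   row i has length #{ j ≤ l : b_j + j ≥ i } (the column lengths are b_j + j).
fromFrob : List ℕ → List ℕ → List ℕ
fromFrob as bs =
  map (λ i → nth 0 as (pred i) +ℕ i) (oneTo l)
  ++ filterᵇ (λ p → 1 ≤ᵇ p)
       (map (λ i → count (λ j → i ≤ᵇ nth 0 bs (pred j) +ℕ j) (oneTo l))
            (map (λ k → l +ℕ k) (oneTo (sum bs))))
  where l = length as

-- Totally symmetric plane partitions in an (m,m,m)-box,
-- as m×m arrays (list of rows) with entries in {0,..,m}

Array : Set
Array = List (List ℕ)

ent : Array → ℕ → ℕ → ℕ
ent T i j = nth 0 (nth [] T i) j

-- (i+1, j+1, k+1) ∈ π  iff  k+1 ≤ π_{i+1,j+1}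
mem : Array → ℕ → ℕ → ℕ → Bool
mem T i j k = k <ᵇ ent T i j

beq : Bool → Bool → Bool
beq b c = does (b Data.Bool.≟ c)

allIdx : ℕ → (ℕ → Bool) → Bool
allIdx m p = all p (upTo m)

isPlanePartition : ℕ → Array → Bool
isPlanePartition m T =
  allIdx m (λ i → allIdx m (λ j →
    (if suc i <ᵇ m then ent T (suc i) j ≤ᵇ ent T i j else true) ∧
    (if suc j <ᵇ m then ent T i (suc j) ≤ᵇ ent T i j else true)))

isTotallySymmetric : ℕ → Array → Bool
isTotallySymmetric m T =
  allIdx m (λ i → allIdx m (λ j → allIdx m (λ k →
    beq (mem T i j k) (mem T i k j) ∧
    beq (mem T i j k) (mem T j i k) ∧
    beq (mem T i j k) (mem T j k i) ∧
    beq (mem T i j k) (mem T k i j) ∧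
    beq (mem T i j k) (mem T k j i))))

TSPP : ℕ → List Array
TSPP m = filterᵇ (λ T → isPlanePartition m T ∧ isTotallySymmetric m T)
                (allLists (allLists (upTo (suc m)) m) m)

diag : ℕ → Array → List ℕ
diag m T = conj (map (λ i → ent T i i) (upTo m))

piT : ℕ → Array → List ℕ
piT m T = fromFrob (frobA (diag m T)) (map suc (frobB (diag m T)))

tableaux : (n : ℕ) → List ℕ → List (List (List (Fin n)))
tableaux n []        = [ [] ]
tableaux n (r ∷ lam) = concatMap (λ row → map (row ∷_) (tableaux n lam)) (allLists (allFin n) r)

rowWeak : ∀ {n} → List (Fin n) → Bool
rowWeak []            = true
rowWeak (a ∷ [])      = true
rowWeak (a ∷ b ∷ as)  = (toℕ a ≤ᵇ toℕ b) ∧ rowWeak (b ∷ as)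

colStrict : ∀ {n} → List (List (Fin n)) → Bool
colStrict []             = true
colStrict (r ∷ [])       = true
colStrict (r ∷ s ∷ rs)   = all (λ b → b) (zipWith (λ a b → toℕ a <ᵇ toℕ b) r s) ∧ colStrict (s ∷ rs)

isSSYT : ∀ {n} → List (List (Fin n)) → Bool
isSSYT t = all rowWeak t ∧ colStrict t

SSYT : (n : ℕ) → List ℕ → List (List (List (Fin n)))
SSYT n lam = filterᵇ isSSYT (tableaux n lam)

module WithRing {c ℓ : Level} (R : CommutativeRing c ℓ) where
  open CommutativeRing R
  open import Algebra.Definitions.RawSemiring (Semiring.rawSemiring semiring) using (_^_)

  Σ : List Carrier → Carrier
  Σ = foldr _+_ 0#

  Π : List Carrier → Carrier
  Π = foldr _*_ 1#

  Πpairs : (Carrier → Carrier → Carrier) → List Carrier → Carrier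
  Πpairs g []       = 1#
  Πpairs g (a ∷ as) = Π (map (g a) as) * Πpairs g as

  staircase : List Carrier → Carrier
  staircase ys = Π (zipWith _^_ ys (upTo (length ys)))

  summand : Carrier → Carrier → List Carrier → Carrier
  summand u v ys =
    staircase ys * Πpairs (λ a b → v + (1# - u - v) * a + u * a * b) ys

  ASymSummand : (n : ℕ) → Carrier → Carrier → Vec Carrier n → Carrier
  ASymSummand n u v x =
    Σ (map (λ σ → (if signPositive σ then 1# else - 1#) * summand u v (map (lookup x) σ)) (perms n))

  vandermonde : ∀ {n} → Vec Carrier n → Carrier
  vandermonde x = Πpairs (λ a b → b - a) (Data.Vec.toList x)

  schur : (n : ℕ) → List ℕ → Vec Carrier n → Carrier
  schur n lam x = Σ (map (λ t → Π (map (λ row → Π (map (lookup x) row)) t)) (SSYT n lam))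

  omega : ℕ → Array → Carrier → Carrier → Carrier
  omega n T u v =
    u ^ sum (map suc as)
    * (1# - u - v) ^ (sum bs ∸ sum as)
    * v ^ ((n C 2) ∸ sum (map suc bs))
    where
      as = frobA (diag (pred n) T)
      bs = frobB (diag (pred n) T)

  RHS : (n : ℕ) → Carrier → Carrier → Vec Carrier n → Carrier
  RHS n u v x = Σ (map (λ T → omega n T u v * schur n (piT (pred n) T) x) (TSPP (pred n)))

{-# OPTIONS --safe #-}

-- Put w = 1 - u - v, q = - (w + u x) and, formally, p = v / x, so that v + w x_i + u x_i x_j = x_i (p_i - q_j).
-- Dividing ∏_j (Z - q_j) by Z - q_k shows that ∏_{j ≠ k} (p_k - q_j) is a combination of the complete
-- homogeneous polynomials h_b(p_k, q_k) whose coefficients do not depend on k.  Expanding the antisymmetrizer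
-- along its first variable therefore turns it, by induction, into the determinant with the columns
-- x^(n-1) h_b(p, q), 0 ≤ b < n.  Since p (q + w) = - u v, column operations replace these columns by x^(n-1)
-- and v^b x^(n-1-b) - u x^n q^(b-1), 1 ≤ b < n.
--
-- A linear map on monomials sends the columns for n - 1 to those for n other than x^(n-1).  Iterating it expands
-- the determinant into alternants indexed by chains of strict partitions, because all other terms contain two
-- equal columns.  Reading a totally symmetric plane partition along its diagonals gives such a chain, and the
-- Frobenius notation of diag(T) consists of the parts of the last strict partition and of the times at which
-- they were born.  The alternants are Schur polynomials times the Vandermonde product by the bialternant
-- formula, which is proved by branching on the last variable.

module Submission where

open import Defs
open import Level using (Level)
open import Function using (_∘_; id; _⇔_; mk⇔)
open import Function.Bundles using (Equivalence)
open Equivalence using (to; from)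
import Function.Properties.Equivalence as ⇔
open import Data.Bool using (Bool; true; false; if_then_else_; not; _∧_; _∨_; T)
open import Data.Bool.ListAction using (any; all)
open import Data.Bool.Properties using (T-∧; ∧-zeroʳ; ∧-assoc; ∧-comm)
open import Data.Empty using (⊥; ⊥-elim)
open import Data.Fin using (Fin; toℕ; fromℕ; inject₁) renaming (zero to fzero; suc to fsuc)
open import Data.Fin.Properties using (toℕ-fromℕ; toℕ-inject₁; toℕ<n)
open import Data.Integer as ℤ using (ℤ; -[1+_])
import Data.Integer.Properties as ℤ
open import Data.Maybe using (Maybe; just; nothing)
open import Data.Nat as ℕ using (ℕ; zero; suc; pred; _∸_; _⊓_; _⊔_; _≤_; _<_; _≥_; _≤ᵇ_; _<ᵇ_; _≡ᵇ_; z≤n; s≤s; z<s)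
import Data.Nat.Properties as ℕ
open import Data.Nat.Combinatorics using (_C_; nCk+nC[k+1]≡[n+1]C[k+1]; nC1≡n)
open import Data.Nat.ListAction using (sum)
open import Data.Nat.ListAction.Properties using (sum-++)
open import Data.Nat.Solver using (module +-*-Solver)
open import Data.Product using (∃; ∃₂; _,_; _×_; proj₁; proj₂; map₁)
open import Data.Sum using (_⊎_; inj₁; inj₂)
open import Data.List using
  (List; []; _∷_; [_]; map; concatMap; filterᵇ; length; reverse; _++_; replicate; zipWith; upTo; downFrom;
  applyUpTo; allFin; tabulate)
open import Data.List.Properties using
  (map-++; map-∘; map-cong; map-cong-local; map-upTo; map-tabulate; ++-assoc; ++-identityʳ; unfold-reverse;
  reverse-map; reverse-downFrom; length-++; length-map; length-reverse; length-upTo; length-downFrom;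
  length-applyUpTo; length-tabulate; length-filter; filter-++; filter-all; ∷-injectiveˡ; ∷-injectiveʳ)
open import Data.List.Membership.Propositional using (_∈_; find; lose)
open import Data.List.Membership.Propositional.Properties using
  (∈-concatMap⁻; ∈-concatMap⁺; ∈-map⁻; ∈-map⁺; ∈-filter⁻; ∈-filter⁺; ∈-upTo⁺; ∈-upTo⁻)
open import Data.List.Membership.Propositional.Properties.WithK using (unique∧set⇒bag)
open import Data.List.Relation.Binary.BagAndSetEquality using (∼bag⇒↭)
open import Data.List.Relation.Binary.Permutation.Propositional as Perm using (_↭_)
open import Data.List.Relation.Binary.Permutation.Propositional.Properties using (↭-length)
open import Data.List.Relation.Binary.Pointwise as Pointwise using (Pointwise; []; _∷_)
open import Data.List.Relation.Unary.All as All using (All; []; _∷_)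
import Data.List.Relation.Unary.All.Properties as All
open import Data.List.Relation.Unary.AllPairs using (AllPairs; []; _∷_)
import Data.List.Relation.Unary.AllPairs.Properties as AllPairs
open import Data.List.Relation.Unary.Any using (here; there)
open import Data.List.Relation.Unary.Linked as Linked using (Linked; []; [-]; _∷_)
open import Data.List.Relation.Unary.Unique.Propositional using (Unique)
import Data.List.Relation.Unary.Unique.Propositional.Properties as Unique
open import Data.Vec as Vec using (Vec; lookup; toList)
open import Relation.Nullary using (¬_; yes; no)
open import Relation.Binary.PropositionalEquality as ≡ using (_≡_)
import Relation.Binary.Reasoning.Setoid
open import Algebra.Bundles using (CommutativeRing; RawRing; Semiring)
import Algebra.Definitions.RawSemiring
import Algebra.Properties.AbelianGroup
import Algebra.Properties.Ring
import Algebra.Properties.Semiring.Exp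
import Algebra.Properties.Semiring.Mult.TCOptimised
import Algebra.Solver.Ring
open import Algebra.Solver.Ring.AlmostCommutativeRing using (fromCommutativeRing; _-Raw-AlmostCommutative⟶_)

-- The ring is arbitrary, so neither the variables nor their differences can be divided by. The
-- identity is therefore proved multiplied by the Vandermonde product, and p = v / x occurs only
-- inside x^(n-1) p^b = v^b x^(n-1-b).
--
-- Why a single linear map links the columns for successive numbers of variables: with m = n - 1,
-- the column of index b is v^b x^(m-b) - u x^(m+1) q^(b-1). When m and b both grow by one, the
-- first term is multiplied by v and the second by x q = - w x - u x^2. The exponents of the first
-- term lie below m and those of the second above m, so the exponent alone decides what to do; x^m
-- itself must go to v x^m - u x^(m+2). Measured from the central exponent, a part therefore stays
-- (w) or grows by one (u), while the central column either sinks below the centre (v) or becomes a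
-- new part 1 (u).
--
-- The sign of the reversal of n columns enters twice: once in ordering the columns for this
-- expansion, once in comparing an alternant with decreasing exponents to the product of the x_j -
-- x_i. The two signs cancel.

-- Integer coefficients in an arbitrary commutative ring

module IntegerSolver {c ℓ : Level} (R : CommutativeRing c ℓ) where
  open CommutativeRing R
  open Algebra.Properties.Semiring.Mult.TCOptimised semiring renaming (_×_ to _·_)
  open Algebra.Properties.Ring ring
  open Relation.Binary.Reasoning.Setoid setoid

  fromℤ : ℤ → Carrier
  fromℤ (ℤ.+ n)   = n · 1#
  fromℤ -[1+ n ] = - (suc n · 1#)

  fromℤ-neg : ∀ i → fromℤ (ℤ.- i) ≈ - fromℤ i
  fromℤ-neg (ℤ.+ zero)    = sym -0#≈0#
  fromℤ-neg (ℤ.+ (suc n)) = refl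
  fromℤ-neg -[1+ n ]    = sym (-‿involutive _)

  fromℤ-⊖ : ∀ m n → fromℤ (m ℤ.⊖ n) ≈ m · 1# - n · 1#
  fromℤ-⊖ zero    zero    = sym (-‿inverseʳ 0#)
  fromℤ-⊖ zero    (suc n) = sym (+-identityˡ _)
  fromℤ-⊖ (suc m) zero    = trans (sym (+-identityʳ _)) (+-congˡ (sym -0#≈0#))
  fromℤ-⊖ (suc m) (suc n) = begin
    fromℤ (suc m ℤ.⊖ suc n)                  ≡⟨ ≡.cong fromℤ (ℤ.[1+m]⊖[1+n]≡m⊖n m n) ⟩
    fromℤ (m ℤ.⊖ n)                          ≈⟨ fromℤ-⊖ m n ⟩
    m · 1# - n · 1#                          ≈⟨ +-congʳ (sym (+-identityˡ _)) ⟩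
    0# + m · 1# - n · 1#                     ≈⟨ +-congʳ (+-congʳ (sym (-‿inverseʳ 1#))) ⟩
    1# - 1# + m · 1# - n · 1#                ≈⟨ +-congʳ (+-assoc _ _ _) ⟩
    1# + (- 1# + m · 1#) - n · 1#            ≈⟨ +-congʳ (+-congˡ (+-comm _ _)) ⟩
    1# + (m · 1# - 1#) - n · 1#              ≈⟨ +-congʳ (sym (+-assoc _ _ _)) ⟩
    1# + m · 1# - 1# - n · 1#                ≈⟨ +-assoc _ _ _ ⟩
    1# + m · 1# + (- 1# - n · 1#)            ≈⟨ +-congˡ (-‿+-comm 1# (n · 1#)) ⟩
    1# + m · 1# - (1# + n · 1#)              ≈⟨ +-cong (sym (1+× m 1#)) (-‿cong (sym (1+× n 1#))) ⟩
    suc m · 1# - suc n · 1#                  ∎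

  fromℤ-+ : ∀ i j → fromℤ (i ℤ.+ j) ≈ fromℤ i + fromℤ j
  fromℤ-+ (ℤ.+ m)   (ℤ.+ n)   = ×-homo-+ 1# m n
  fromℤ-+ (ℤ.+ m)   -[1+ n ] = fromℤ-⊖ m (suc n)
  fromℤ-+ -[1+ m ] (ℤ.+ n)   = trans (fromℤ-⊖ n (suc m)) (+-comm _ _)
  fromℤ-+ -[1+ m ] -[1+ n ] = begin
    - (suc (suc (m ℕ.+ n)) · 1#)      ≡⟨ ≡.cong (λ k → - (suc k · 1#)) (≡.sym (ℕ.+-suc m n)) ⟩
    - ((suc m ℕ.+ suc n) · 1#)        ≈⟨ -‿cong (×-homo-+ 1# (suc m) (suc n)) ⟩
    - (suc m · 1# + suc n · 1#)       ≈⟨ sym (-‿+-comm _ _) ⟩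
    - (suc m · 1#) - suc n · 1#       ∎

  fromℤ-*⁺ : ∀ m j → fromℤ ((ℤ.+ m) ℤ.* j) ≈ fromℤ (ℤ.+ m) * fromℤ j
  fromℤ-*⁺ m (ℤ.+ n)   = begin
    fromℤ ((ℤ.+ m) ℤ.* (ℤ.+ n))  ≡⟨ ≡.cong fromℤ (≡.sym (ℤ.pos-* m n)) ⟩
    (m ℕ.* n) · 1#               ≈⟨ ×1-homo-* m n ⟩
    m · 1# * (n · 1#)            ∎
  fromℤ-*⁺ m -[1+ n ] = begin
    fromℤ ((ℤ.+ m) ℤ.* (ℤ.- (ℤ.+ suc n)))    ≡⟨ ≡.cong fromℤ (≡.sym (ℤ.neg-distribʳ-* (ℤ.+ m) (ℤ.+ suc n))) ⟩
    fromℤ (ℤ.- ((ℤ.+ m) ℤ.* (ℤ.+ suc n)))    ≈⟨ fromℤ-neg ((ℤ.+ m) ℤ.* (ℤ.+ suc n)) ⟩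
    - fromℤ ((ℤ.+ m) ℤ.* (ℤ.+ suc n))        ≈⟨ -‿cong (fromℤ-*⁺ m (ℤ.+ suc n)) ⟩
    - (m · 1# * (suc n · 1#))                ≈⟨ -‿distribʳ-* _ _ ⟩
    m · 1# * - (suc n · 1#)                  ∎

  fromℤ-* : ∀ i j → fromℤ (i ℤ.* j) ≈ fromℤ i * fromℤ j
  fromℤ-* (ℤ.+ m)   j = fromℤ-*⁺ m j
  fromℤ-* -[1+ m ] j = begin
    fromℤ ((ℤ.- (ℤ.+ suc m)) ℤ.* j)          ≡⟨ ≡.cong fromℤ (≡.sym (ℤ.neg-distribˡ-* (ℤ.+ suc m) j)) ⟩
    fromℤ (ℤ.- ((ℤ.+ suc m) ℤ.* j))          ≈⟨ fromℤ-neg ((ℤ.+ suc m) ℤ.* j) ⟩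
    - fromℤ ((ℤ.+ suc m) ℤ.* j)              ≈⟨ -‿cong (fromℤ-*⁺ (suc m) j) ⟩
    - (suc m · 1# * fromℤ j)                 ≈⟨ -‿distribˡ-* _ _ ⟩
    - (suc m · 1#) * fromℤ j                 ∎

  ℤ-coefficients : RawRing _ _
  ℤ-coefficients = CommutativeRing.rawRing ℤ.+-*-commutativeRing

  fromℤ-morphism : ℤ-coefficients -Raw-AlmostCommutative⟶ fromCommutativeRing R
  fromℤ-morphism = record
    { ⟦_⟧    = fromℤ
    ; +-homo = fromℤ-+
    ; *-homo = fromℤ-*
    ; -‿homo = fromℤ-neg
    ; 0-homo = refl
    ; 1-homo = refl
    }

  -- Distinct integers may have the same image in `R`, so in that case no answer is given.
  fromℤ-≟ : ∀ i j → Maybe (fromℤ i ≈ fromℤ j)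
  fromℤ-≟ i j with i ℤ.≟ j
  ... | yes ≡.refl = just refl
  ... | no  _      = nothing

  open Algebra.Solver.Ring ℤ-coefficients (fromCommutativeRing R) fromℤ-morphism fromℤ-≟ public
    using (Polynomial; solve; _:=_; _:+_; _:*_; _:-_; :-_; con)

  :0 :1 : ∀ {n} → Polynomial n
  :0 = con (ℤ.+ 0)
  :1 = con (ℤ.+ 1)

-- Finite sums over lists

module Sums {c ℓ : Level} (R : CommutativeRing c ℓ) where
  open CommutativeRing R
  open WithRing R using (Σ)
  open IntegerSolver R
  open Algebra.Properties.Ring ring

  ∑ : ∀ {a} {A : Set a} → List A → (A → Carrier) → Carrier
  ∑ xs f = Σ (map f xs)

  when : Bool → Carrier → Carrier
  when b a = if b then a else 0#

  module _ {a} {A : Set a} where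

    ∑-cong∈ : ∀ xs {f g : A → Carrier} → (∀ {x} → x ∈ xs → f x ≈ g x) → ∑ xs f ≈ ∑ xs g
    ∑-cong∈ []       e = refl
    ∑-cong∈ (x ∷ xs) e = +-cong (e (here ≡.refl)) (∑-cong∈ xs (e ∘ there))

    ∑-cong : ∀ xs {f g : A → Carrier} → (∀ x → f x ≈ g x) → ∑ xs f ≈ ∑ xs g
    ∑-cong xs e = ∑-cong∈ xs (λ {x} _ → e x)

    ∑-zero∈ : ∀ xs {f : A → Carrier} → (∀ {x} → x ∈ xs → f x ≈ 0#) → ∑ xs f ≈ 0#
    ∑-zero∈ []       e = refl
    ∑-zero∈ (x ∷ xs) e = trans (+-cong (e (here ≡.refl)) (∑-zero∈ xs (e ∘ there))) (+-identityˡ 0#)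

    ∑-zero : ∀ xs {f : A → Carrier} → (∀ x → f x ≈ 0#) → ∑ xs f ≈ 0#
    ∑-zero xs e = ∑-zero∈ xs (λ {x} _ → e x)

    ∑-++ : ∀ xs ys (f : A → Carrier) → ∑ (xs ++ ys) f ≈ ∑ xs f + ∑ ys f
    ∑-++ []       ys f = sym (+-identityˡ _)
    ∑-++ (x ∷ xs) ys f = trans (+-congˡ (∑-++ xs ys f)) (sym (+-assoc _ _ _))

    ∑-+ : ∀ xs (f g : A → Carrier) → ∑ xs (λ x → f x + g x) ≈ ∑ xs f + ∑ xs g
    ∑-+ []       f g = sym (+-identityˡ _)
    ∑-+ (x ∷ xs) f g = trans (+-congˡ (∑-+ xs f g))
      (solve 4 (λ a b c d → (a :+ b) :+ (c :+ d) := (a :+ c) :+ (b :+ d)) refl _ _ _ _)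

    ∑-*ˡ : ∀ k xs (f : A → Carrier) → ∑ xs (λ x → k * f x) ≈ k * ∑ xs f
    ∑-*ˡ k []       f = sym (zeroʳ k)
    ∑-*ˡ k (x ∷ xs) f = trans (+-congˡ (∑-*ˡ k xs f)) (sym (distribˡ _ _ _))

    ∑-neg : ∀ xs (f : A → Carrier) → ∑ xs (λ x → - f x) ≈ - ∑ xs f
    ∑-neg []       f = sym -0#≈0#
    ∑-neg (x ∷ xs) f = trans (+-congˡ (∑-neg xs f)) (-‿+-comm _ _)

    ∑-filterᵇ : ∀ (p : A → Bool) xs (f : A → Carrier) → ∑ (filterᵇ p xs) f ≈ ∑ xs (λ x → when (p x) (f x))
    ∑-filterᵇ p []       f = refl
    ∑-filterᵇ p (x ∷ xs) f with p x
    ... | true  = +-congˡ (∑-filterᵇ p xs f)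
    ... | false = trans (∑-filterᵇ p xs f) (sym (+-identityˡ _))

    ∑-↭ : ∀ {xs ys} → xs ↭ ys → (f : A → Carrier) → ∑ xs f ≈ ∑ ys f
    ∑-↭ Perm.refl         f = refl
    ∑-↭ (Perm.prep x p)   f = +-congˡ (∑-↭ p f)
    ∑-↭ (Perm.swap x y p) f = trans (+-congˡ (+-congˡ (∑-↭ p f)))
      (solve 3 (λ a b c → a :+ (b :+ c) := b :+ (a :+ c)) refl _ _ _)
    ∑-↭ (Perm.trans p q)  f = trans (∑-↭ p f) (∑-↭ q f)

  ∑-map : ∀ {a b} {A : Set a} {B : Set b} (h : A → B) xs (f : B → Carrier) → ∑ (map h xs) f ≈ ∑ xs (f ∘ h)
  ∑-map h xs f = reflexive (≡.cong Σ (≡.sym (map-∘ xs)))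

  ∑-concatMap : ∀ {a b} {A : Set a} {B : Set b} (k : A → List B) xs (f : B → Carrier) →
                ∑ (concatMap k xs) f ≈ ∑ xs (λ x → ∑ (k x) f)
  ∑-concatMap k []       f = refl
  ∑-concatMap k (x ∷ xs) f = trans (∑-++ (k x) _ f) (+-congˡ (∑-concatMap k xs f))

  ∑-swap : ∀ {a b} {A : Set a} {B : Set b} (xs : List A) (ys : List B) (f : A → B → Carrier) →
           ∑ xs (λ x → ∑ ys (f x)) ≈ ∑ ys (λ y → ∑ xs (λ x → f x y))
  ∑-swap []       ys f = sym (∑-zero ys (λ _ → refl))
  ∑-swap (x ∷ xs) ys f = trans (+-congˡ (∑-swap xs ys f)) (sym (∑-+ ys _ _))

  when-∧ : ∀ b b′ a → when (b ∧ b′) a ≡ when b (when b′ a)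
  when-∧ true  b′ a = ≡.refl
  when-∧ false b′ a = ≡.refl

  ∑-when : ∀ {a} {A : Set a} b (xs : List A) (f : A → Carrier) → ∑ xs (when b ∘ f) ≈ when b (∑ xs f)
  ∑-when true  xs f = refl
  ∑-when false xs f = ∑-zero xs (λ _ → refl)

  when-cong : ∀ b {a a′} → a ≈ a′ → when b a ≈ when b a′
  when-cong true  e = e
  when-cong false e = refl

-- Determinants and alternating functions

module Determinants {c ℓ : Level} (R : CommutativeRing c ℓ) where
  open CommutativeRing R
  open WithRing R using (Π)
  open IntegerSolver R
  open Algebra.Properties.Ring ring
  open Relation.Binary.Reasoning.Setoid setoid

  -- The pattern of Laplace expansion: the sign alternates with the position of the chosen entry,
  -- and the others keep their order. Determinants and antisymmetrizers are both iterated picks,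
  -- which is what allows one to be turned into the other.
  pick : ∀ {a} {A : Set a} → List A → (A → List A → Carrier) → Carrier
  pick []       φ = 0#
  pick (x ∷ xs) φ = φ x xs - pick xs (λ y ys → φ y (x ∷ ys))

  module _ {a} {A : Set a} where

    -- The premise supplies xs ↭ y ∷ ys, which gives access to the length of the rest and to
    -- symmetric functions of it under a pick.
    pick-cong : ∀ xs {φ ψ : A → List A → Carrier} →
                (∀ y ys → xs ↭ y ∷ ys → φ y ys ≈ ψ y ys) → pick xs φ ≈ pick xs ψ
    pick-cong []       e = refl
    pick-cong (x ∷ xs) e = +-cong (e x xs Perm.refl) (-‿cong (pick-cong xs
      (λ y ys p → e y (x ∷ ys) (Perm.trans (Perm.prep x p) (Perm.swap x y Perm.refl)))))

    pick-+ : ∀ xs (φ ψ : A → List A → Carrier) →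
             pick xs (λ y ys → φ y ys + ψ y ys) ≈ pick xs φ + pick xs ψ
    pick-+ []       φ ψ = sym (+-identityˡ 0#)
    pick-+ (x ∷ xs) φ ψ = trans (+-congˡ (-‿cong (pick-+ xs _ _)))
      (solve 4 (λ a b c d → a :+ b :- (c :+ d) := a :- c :+ (b :- d)) refl _ _ _ _)

    pick-*ˡ : ∀ k xs (φ : A → List A → Carrier) → pick xs (λ y ys → k * φ y ys) ≈ k * pick xs φ
    pick-*ˡ k []       φ = sym (zeroʳ k)
    pick-*ˡ k (x ∷ xs) φ = trans (+-congˡ (-‿cong (pick-*ˡ k xs _)))
      (solve 3 (λ k a b → k :* a :- k :* b := k :* (a :- b)) refl _ _ _)

    pick-zero : ∀ xs {φ : A → List A → Carrier} → (∀ y ys → xs ↭ y ∷ ys → φ y ys ≈ 0#) → pick xs φ ≈ 0#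
    pick-zero []       e = refl
    pick-zero (x ∷ xs) e = trans (+-cong (e x xs Perm.refl) (-‿cong (pick-zero xs
      (λ y ys p → e y (x ∷ ys) (Perm.trans (Perm.prep x p) (Perm.swap x y Perm.refl))))))
      (-‿inverseʳ 0#)

    -- The pairs (y, z) and (z, y) are picked with opposite signs.
    pick-pick-sym : ∀ xs (φ : A → A → List A → Carrier) → (∀ y z zs → φ y z zs ≈ φ z y zs) →
                    pick xs (λ y ys → pick ys (φ y)) ≈ 0#
    pick-pick-sym []       φ s = refl
    pick-pick-sym (x ∷ xs) φ s = begin
      pick xs (φ x) - pick xs (λ y ys → φ y x ys - pick ys (λ z zs → φ y z (x ∷ zs)))
        ≈⟨ +-congˡ (-‿cong (pick-cong xs (λ y ys _ → +-cong (s y x ys) (sym (-1*x≈-x _))))) ⟩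
      pick xs (φ x) - pick xs (λ y ys → φ x y ys + - 1# * pick ys (λ z zs → φ y z (x ∷ zs)))
        ≈⟨ +-congˡ (-‿cong (trans (pick-+ xs _ _) (+-congˡ (trans (pick-*ˡ (- 1#) xs _)
             (*-congˡ (pick-pick-sym xs _ (λ y z zs → s y z (x ∷ zs)))))))) ⟩
      pick xs (φ x) - (pick xs (φ x) + - 1# * 0#)
        ≈⟨ solve 1 (λ a → a :- (a :+ (:- :1) :* :0) := :0) refl _ ⟩
      0# ∎

  -- Vanishing on equal neighbours is a separate field: from `swap` alone only twice the value
  -- vanishes, and 2 may be a zero divisor.
  record Alternating {a} {A : Set a} (L : List A → Carrier) : Set (a Level.⊔ ℓ) where
    field
      zero-dup : ∀ ps f fs → L (ps ++ f ∷ f ∷ fs) ≈ 0#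
      swap     : ∀ ps f g fs → L (ps ++ f ∷ g ∷ fs) ≈ - L (ps ++ g ∷ f ∷ fs)

  open Alternating

  sgn : ℕ → Carrier
  sgn zero    = 1#
  sgn (suc n) = - sgn n

  -- The sign (-1)^(n(n-1)/2) of the permutation that reverses n entries.
  ε : ℕ → Carrier
  ε zero    = 1#
  ε (suc n) = sgn n * ε n

  sgn² : ∀ n → sgn n * sgn n ≈ 1#
  sgn² zero    = *-identityˡ 1#
  sgn² (suc n) = trans (solve 1 (λ a → (:- a) :* (:- a) := a :* a) refl _) (sgn² n)

  ε² : ∀ n → ε n * ε n ≈ 1#
  ε² zero    = *-identityˡ 1#
  ε² (suc n) = trans (solve 2 (λ a b → (a :* b) :* (a :* b) := (a :* a) :* (b :* b)) refl _ _)
    (trans (*-cong (sgn² n) (ε² n)) (*-identityˡ 1#))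

  module _ {a} {A : Set a} where

    alternating-∷ : ∀ {L : List A → Carrier} → Alternating L → ∀ p → Alternating (L ∘ (p ∷_))
    alternating-∷ alt p = record { zero-dup = λ ps → zero-dup alt (p ∷ ps) ; swap = λ ps → swap alt (p ∷ ps) }

    alternating-dup : ∀ {L : List A → Carrier} → Alternating L → ∀ f ps fs → L (f ∷ ps ++ f ∷ fs) ≈ 0#
    alternating-dup alt f []       fs = zero-dup alt [] f fs
    alternating-dup alt f (p ∷ ps) fs = trans (swap alt [] f p _)
      (trans (-‿cong (alternating-dup (alternating-∷ alt p) f ps fs)) -0#≈0#)

    alternating-rotate : ∀ {L : List A → Carrier} → Alternating L → ∀ f fs →
                         L (f ∷ fs) ≈ sgn (length fs) * L (fs ++ [ f ])
    alternating-rotate alt f []       = sym (*-identityˡ _)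
    alternating-rotate alt f (g ∷ gs) = trans (swap alt [] f g gs)
      (trans (-‿cong (alternating-rotate (alternating-∷ alt g) f gs)) (-‿distribˡ-* _ _))

    alternating-reverse : ∀ {L : List A → Carrier} → Alternating L → ∀ fs →
                          L fs ≈ ε (length fs) * L (reverse fs)
    alternating-reverse alt []       = sym (*-identityˡ _)
    alternating-reverse {L} alt (f ∷ fs) = begin
      L (f ∷ fs)
        ≈⟨ alternating-reverse (alternating-∷ alt f) fs ⟩
      ε (length fs) * L (f ∷ reverse fs)
        ≈⟨ *-congˡ (alternating-rotate alt f (reverse fs)) ⟩
      ε (length fs) * (sgn (length (reverse fs)) * L (reverse fs ++ [ f ]))
        ≡⟨ ≡.cong₂ (λ k gs → ε (length fs) * (sgn k * L gs)) (length-reverse fs) (≡.sym (unfold-reverse f fs)) ⟩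
      ε (length fs) * (sgn (length fs) * L (reverse (f ∷ fs)))
        ≈⟨ solve 3 (λ a b c → a :* (b :* c) := (b :* a) :* c) refl _ _ _ ⟩
      sgn (length fs) * ε (length fs) * L (reverse (f ∷ fs)) ∎

  alternating-map : ∀ {a b} {A : Set a} {B : Set b} {L : List B → Carrier} (h : A → B) →
                    Alternating L → Alternating (L ∘ map h)
  alternating-map {L = L} h alt = record
    { zero-dup = λ ps f fs → trans (reflexive (≡.cong L (map-++ h ps _))) (zero-dup alt (map h ps) (h f) (map h fs))
    ; swap = λ ps f g fs → trans (reflexive (≡.cong L (map-++ h ps _)))
        (trans (swap alt (map h ps) (h f) (h g) (map h fs))
               (-‿cong (reflexive (≡.cong L (≡.sym (map-++ h ps _))))))
    }

  -- The rows of a matrix are labelled by the variables, and a column is a function of the label.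
  -- Deleting a row is then deleting a variable, and a column operation is an identity between
  -- functions.
  Column : Set c
  Column = Carrier → Carrier

  det : List Carrier → List Column → Carrier
  det xs []       = 1#
  det xs (f ∷ fs) = pick xs (λ y ys → f y * det ys fs)

  det-cong : ∀ xs {fs gs : List Column} → Pointwise (λ f g → ∀ y → f y ≈ g y) fs gs → det xs fs ≈ det xs gs
  det-cong xs []       = refl
  det-cong xs (e ∷ es) = pick-cong xs (λ y ys _ → *-cong (e y) (det-cong ys es))

  det-+ : ∀ xs ps (f g : Column) fs →
          det xs (ps ++ (λ y → f y + g y) ∷ fs) ≈ det xs (ps ++ f ∷ fs) + det xs (ps ++ g ∷ fs)
  det-+ xs []       f g fs = trans (pick-cong xs (λ y ys _ → distribʳ _ _ _)) (pick-+ xs _ _)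
  det-+ xs (p ∷ ps) f g fs = trans
    (pick-cong xs (λ y ys _ → trans (*-congˡ (det-+ ys ps f g fs)) (distribˡ _ _ _))) (pick-+ xs _ _)

  det-*ˡ : ∀ xs ps k (f : Column) fs → det xs (ps ++ (λ y → k * f y) ∷ fs) ≈ k * det xs (ps ++ f ∷ fs)
  det-*ˡ xs []       k f fs = trans (pick-cong xs (λ y ys _ → *-assoc _ _ _)) (pick-*ˡ k xs _)
  det-*ˡ xs (p ∷ ps) k f fs = trans
    (pick-cong xs (λ y ys _ → trans (*-congˡ (det-*ˡ ys ps k f fs))
      (solve 3 (λ a b c → a :* (b :* c) := b :* (a :* c)) refl _ _ _))) (pick-*ˡ k xs _)

  det-dup : ∀ xs ps (f : Column) fs → det xs (ps ++ f ∷ f ∷ fs) ≈ 0#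
  det-dup xs []       f fs = trans
    (pick-cong xs (λ y ys _ → sym (pick-*ˡ (f y) ys _)))
    (pick-pick-sym xs (λ y z zs → f y * (f z * det zs fs))
      (λ y z zs → solve 3 (λ a b c → a :* (b :* c) := b :* (a :* c)) refl _ _ _))
  det-dup xs (p ∷ ps) f fs = pick-zero xs (λ y ys _ → trans (*-congˡ (det-dup ys ps f fs)) (zeroʳ _))

  -- The sum of the two determinants is a double pick of a function symmetric in the two chosen
  -- rows, so it vanishes by `pick-pick-sym`.
  det-swap : ∀ xs ps (f g : Column) fs → det xs (ps ++ f ∷ g ∷ fs) ≈ - det xs (ps ++ g ∷ f ∷ fs)
  det-swap xs []       f g fs = inverseˡ-unique _ _ (trans (sym (pick-+ xs _ _)) (trans
    (pick-cong xs (λ y ys _ → trans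
      (+-cong (sym (pick-*ˡ (f y) ys _)) (sym (pick-*ˡ (g y) ys _))) (sym (pick-+ ys _ _))))
    (pick-pick-sym xs (λ y z zs → f y * (g z * det zs fs) + g y * (f z * det zs fs))
      (λ y z zs → solve 5 (λ a b c d e → a :* (b :* c) :+ d :* (e :* c) := e :* (d :* c) :+ b :* (a :* c)) refl _ _ _ _ _))))
    where open import Algebra.Properties.AbelianGroup +-abelianGroup using (inverseˡ-unique)
  det-swap xs (p ∷ ps) f g fs = trans
    (pick-cong xs (λ y ys _ → trans (*-congˡ (det-swap ys ps f g fs))
      (solve 2 (λ a b → a :* (:- b) := (:- :1) :* (a :* b)) refl _ _)))
    (trans (pick-*ˡ (- 1#) xs _) (-1*x≈-x _))

  det-alternating : ∀ xs → Alternating (det xs)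
  det-alternating xs = record { zero-dup = det-dup xs ; swap = det-swap xs }

  Π-map-↭ : ∀ {xs ys} (f : Carrier → Carrier) → xs ↭ ys → Π (map f xs) ≈ Π (map f ys)
  Π-map-↭ f Perm.refl         = refl
  Π-map-↭ f (Perm.prep x p)   = *-congˡ (Π-map-↭ f p)
  Π-map-↭ f (Perm.swap x y p) = trans (*-congˡ (*-congˡ (Π-map-↭ f p)))
    (solve 3 (λ a b c → a :* (b :* c) := b :* (a :* c)) refl _ _ _)
  Π-map-↭ f (Perm.trans p q)  = trans (Π-map-↭ f p) (Π-map-↭ f q)

  -- Since there are as many columns as rows, every row is chosen exactly once and contributes its
  -- factor once.
  det-scale-rows : ∀ (ρ : Carrier → Carrier) xs fs → length xs ≡ length fs →
                   det xs (map (λ f y → ρ y * f y) fs) ≈ Π (map ρ xs) * det xs fs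
  det-scale-rows ρ []       []       _ = sym (*-identityˡ _)
  det-scale-rows ρ xs       (f ∷ fs) e = trans (pick-cong xs (λ y ys p → begin
      ρ y * f y * det ys (map (λ f y → ρ y * f y) fs)
        ≈⟨ *-congˡ (det-scale-rows ρ ys fs (ℕ.suc-injective (≡.trans (≡.sym (↭-length p)) e))) ⟩
      ρ y * f y * (Π (map ρ ys) * det ys fs)
        ≈⟨ solve 4 (λ a b c d → a :* b :* (c :* d) := a :* c :* (b :* d)) refl _ _ _ _ ⟩
      ρ y * Π (map ρ ys) * (f y * det ys fs)
        ≈⟨ *-congʳ (Π-map-↭ ρ (Perm.↭-sym p)) ⟩
      Π (map ρ xs) * (f y * det ys fs) ∎))
    (pick-*ˡ _ xs _)

-- Counting, and removing a letter from an increasing list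

count-∷ : ∀ {a} {A : Set a} (p : A → Bool) x xs → count p (x ∷ xs) ≡ (if p x then 1 else 0) ℕ.+ count p xs
count-∷ p x xs with p x
... | true  = ≡.refl
... | false = ≡.refl

count-↭ : ∀ {a} {A : Set a} (p : A → Bool) {xs ys : List A} → xs ↭ ys → count p xs ≡ count p ys
count-↭ p Perm.refl = ≡.refl
count-↭ p (Perm.prep {xs} {ys} x r) =
  ≡.trans (count-∷ p x xs) (≡.trans (≡.cong ((if p x then 1 else 0) ℕ.+_) (count-↭ p r)) (≡.sym (count-∷ p x ys)))
count-↭ p (Perm.swap {xs} {ys} x y r) with p x in px | p y in py
... | true  | true  rewrite px | py = ≡.cong (2 ℕ.+_) (count-↭ p r)
... | true  | false rewrite px | py = ≡.cong suc (count-↭ p r)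
... | false | true  rewrite px | py = ≡.cong suc (count-↭ p r)
... | false | false rewrite px | py = count-↭ p r
count-↭ p (Perm.trans r s) = ≡.trans (count-↭ p r) (count-↭ p s)

<⇒<ᵇ≡true : ∀ {m n} → m < n → (m <ᵇ n) ≡ true
<⇒<ᵇ≡true {zero}  {suc n} (s≤s p) = ≡.refl
<⇒<ᵇ≡true {suc m} {suc n} (s≤s p) = <⇒<ᵇ≡true p

≤⇒<ᵇ≡false : ∀ {m n} → n ℕ.≤ m → (m <ᵇ n) ≡ false
≤⇒<ᵇ≡false {m}     {zero}  p       = ≡.refl
≤⇒<ᵇ≡false {suc m} {suc n} (s≤s p) = ≤⇒<ᵇ≡false p

<⇒≡ᵇ≡false : ∀ {m n} → m < n → (m ≡ᵇ n) ≡ false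
<⇒≡ᵇ≡false {zero}  {suc n} (s≤s p) = ≡.refl
<⇒≡ᵇ≡false {suc m} {suc n} (s≤s p) = <⇒≡ᵇ≡false p

>⇒≡ᵇ≡false : ∀ {m n} → n < m → (m ≡ᵇ n) ≡ false
>⇒≡ᵇ≡false {suc m} {zero}  (s≤s p) = ≡.refl
>⇒≡ᵇ≡false {suc m} {suc n} (s≤s p) = >⇒≡ᵇ≡false p

≡ᵇ-refl : ∀ m → (m ≡ᵇ m) ≡ true
≡ᵇ-refl zero    = ≡.refl
≡ᵇ-refl (suc m) = ≡ᵇ-refl m

module _ {n : ℕ} where

  -- In an increasing list, removing a letter by its value removes a single position, and that
  -- position is the number of smaller letters. This is how the sign by position in `pick` meets the
  -- sign by inversions.
  Increasing : List (Fin n) → Set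
  Increasing = AllPairs (λ a b → toℕ a < toℕ b)

  infixl 6 _∖_
  _∖_ : List (Fin n) → Fin n → List (Fin n)
  as ∖ a = filterᵇ (λ b → not (finEq a b)) as

  ∖-< : ∀ a {as} → All (λ (b : Fin n) → toℕ a < toℕ b) as → as ∖ a ≡ as
  ∖-< a []       = ≡.refl
  ∖-< a {b ∷ _} (p ∷ ps) rewrite <⇒≡ᵇ≡false p = ≡.cong (b ∷_) (∖-< a ps)

  ∖-head : ∀ {a as} → Increasing (a ∷ as) → (a ∷ as) ∖ a ≡ as
  ∖-head {a} (p ∷ _) rewrite ≡ᵇ-refl (toℕ a) = ∖-< a p

  ∖-tail : ∀ {a as b} → Increasing (a ∷ as) → b ∈ as → (a ∷ as) ∖ b ≡ a ∷ (as ∖ b)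
  ∖-tail (p ∷ _) b∈ rewrite >⇒≡ᵇ≡false (All.lookup p b∈) = ≡.refl

  ∖-increasing : ∀ {as} b → Increasing as → Increasing (as ∖ b)
  ∖-increasing b = AllPairs.filter⁺ _

  ∖-↭ : ∀ {as b} → Increasing as → b ∈ as → as ↭ b ∷ (as ∖ b)
  ∖-↭ {a ∷ as} inc (here ≡.refl) rewrite ∖-head inc = Perm.refl
  ∖-↭ {a ∷ as} {b} inc@(_ ∷ inc′) (there b∈) rewrite ∖-tail inc b∈ =
    Perm.trans (Perm.prep a (∖-↭ inc′ b∈)) (Perm.swap a b Perm.refl)

  ∖-length : ∀ {as b k} → Increasing as → b ∈ as → length as ≡ suc k → length (as ∖ b) ≡ k
  ∖-length inc b∈ e = ℕ.suc-injective (≡.trans (≡.sym (↭-length (∖-↭ inc b∈))) e)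

  count-< : ∀ (a : Fin n) {as} → All (λ (b : Fin n) → toℕ a < toℕ b) as → count (λ b → toℕ b <ᵇ toℕ a) as ≡ 0
  count-< a []       = ≡.refl
  count-< a (p ∷ ps) rewrite ≤⇒<ᵇ≡false (ℕ.<⇒≤ p) = count-< a ps

-- The antisymmetrizer as an iterated pick

module Antisymmetrizer {c ℓ : Level} (R : CommutativeRing c ℓ) where
  open CommutativeRing R
  open WithRing R
  open Sums R
  open Determinants R
  open Algebra.Properties.Ring ring
  open Relation.Binary.Reasoning.Setoid setoid

  -- For k equal to the length of xs this is the antisymmetrizer: the signs of the successive picks
  -- multiply to the sign of the permutation.
  asym : ∀ {a} {A : Set a} → ℕ → List A → (List A → Carrier) → Carrier
  asym zero    xs ψ = ψ []
  asym (suc k) xs ψ = pick xs (λ y ys → asym k ys (ψ ∘ (y ∷_)))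

  asym-cong : ∀ {a} {A : Set a} k (xs : List A) {φ ψ : List A → Carrier} → length xs ≡ k →
              (∀ ys → xs ↭ ys → φ ys ≈ ψ ys) → asym k xs φ ≈ asym k xs ψ
  asym-cong zero    []  _  e = e [] Perm.refl
  asym-cong (suc k) xs  ke e = pick-cong xs (λ y ys p →
    asym-cong k ys (ℕ.suc-injective (≡.trans (≡.sym (↭-length p)) ke))
      (λ zs q → e (y ∷ zs) (Perm.trans p (Perm.prep y q))))

  asym-*ˡ : ∀ {a} {A : Set a} k (xs : List A) r (ψ : List A → Carrier) →
            asym k xs (λ ys → r * ψ ys) ≈ r * asym k xs ψ
  asym-*ˡ zero    xs r ψ = refl
  asym-*ˡ (suc k) xs r ψ = trans (pick-cong xs (λ y ys _ → asym-*ˡ k ys r (ψ ∘ (y ∷_)))) (pick-*ˡ r xs _)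

  pick-map : ∀ {a b} {A : Set a} {B : Set b} (h : A → B) xs (φ : B → List B → Carrier) →
             pick (map h xs) φ ≈ pick xs (λ y ys → φ (h y) (map h ys))
  pick-map h []       φ = refl
  pick-map h (x ∷ xs) φ = +-congˡ (-‿cong (pick-map h xs _))

  asym-map : ∀ {a b} {A : Set a} {B : Set b} (h : A → B) k xs (ψ : List B → Carrier) →
             asym k (map h xs) ψ ≈ asym k xs (ψ ∘ map h)
  asym-map h zero    xs ψ = refl
  asym-map h (suc k) xs ψ = trans (pick-map h xs _) (pick-cong xs (λ y ys _ → asym-map h k ys _))

  module _ {n : ℕ} where

    ∑-allLists-∖ : ∀ (as : List (Fin n)) a k (f : List (Fin n) → Carrier) →
      ∑ (allLists as k) (λ σ → when (not (any (finEq a) σ)) (f σ)) ≈ ∑ (allLists (as ∖ a) k) f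
    ∑-allLists-∖ as a zero    f = refl
    ∑-allLists-∖ as a (suc k) f = begin
      ∑ (allLists as (suc k)) (λ σ → when (not (any (finEq a) σ)) (f σ))
        ≈⟨ ∑-concatMap _ as _ ⟩
      ∑ as (λ b → ∑ (map (b ∷_) (allLists as k)) (λ σ → when (not (any (finEq a) σ)) (f σ)))
        ≈⟨ ∑-cong as (λ b → trans (∑-map (b ∷_) (allLists as k) _) (step b)) ⟩
      ∑ as (λ b → when (not (finEq a b)) (∑ (allLists (as ∖ a) k) (f ∘ (b ∷_))))
        ≈⟨ sym (∑-filterᵇ _ as _) ⟩
      ∑ (as ∖ a) (λ b → ∑ (allLists (as ∖ a) k) (f ∘ (b ∷_)))
        ≈⟨ ∑-cong (as ∖ a) (λ b → sym (∑-map (b ∷_) (allLists (as ∖ a) k) f)) ⟩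
      ∑ (as ∖ a) (λ b → ∑ (map (b ∷_) (allLists (as ∖ a) k)) f)
        ≈⟨ sym (∑-concatMap _ (as ∖ a) f) ⟩
      ∑ (allLists (as ∖ a) (suc k)) f ∎
      where
      step : ∀ b → ∑ (allLists as k) (λ σ → when (not (finEq a b ∨ any (finEq a) σ)) (f (b ∷ σ)))
                   ≈ when (not (finEq a b)) (∑ (allLists (as ∖ a) k) (f ∘ (b ∷_)))
      step b with finEq a b
      ... | true  = ∑-zero (allLists as k) (λ _ → refl)
      ... | false = ∑-allLists-∖ as a k (f ∘ (b ∷_))

    -- Between the filter in `perms` and the recursion in `asym`: words without repetition, written
    -- letter by letter from the letters that are left, still without signs.
    ∑-noDup : ℕ → List (Fin n) → (List (Fin n) → Carrier) → Carrier
    ∑-noDup zero    as f = f []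
    ∑-noDup (suc k) as f = ∑ as (λ a → ∑-noDup k (as ∖ a) (f ∘ (a ∷_)))

    ∑-noDup-correct : ∀ k as (f : List (Fin n) → Carrier) →
      ∑ (allLists as k) (λ σ → when (noDup σ) (f σ)) ≈ ∑-noDup k as f
    ∑-noDup-correct zero    as f = +-identityʳ _
    ∑-noDup-correct (suc k) as f = trans (∑-concatMap _ as _) (∑-cong as (λ a → begin
      ∑ (map (a ∷_) (allLists as k)) (λ σ → when (noDup σ) (f σ))
        ≈⟨ ∑-map (a ∷_) (allLists as k) _ ⟩
      ∑ (allLists as k) (λ σ → when (not (any (finEq a) σ) ∧ noDup σ) (f (a ∷ σ)))
        ≈⟨ ∑-cong (allLists as k) (λ σ → reflexive (when-∧ (not (any (finEq a) σ)) (noDup σ) _)) ⟩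
      ∑ (allLists as k) (λ σ → when (not (any (finEq a) σ)) (when (noDup σ) (f (a ∷ σ))))
        ≈⟨ ∑-allLists-∖ as a k _ ⟩
      ∑ (allLists (as ∖ a) k) (λ σ → when (noDup σ) (f (a ∷ σ)))
        ≈⟨ ∑-noDup-correct k (as ∖ a) (f ∘ (a ∷_)) ⟩
      ∑-noDup k (as ∖ a) (f ∘ (a ∷_)) ∎))

    ∑-noDup-cong : ∀ k as {f g : List (Fin n) → Carrier} → Increasing as → length as ≡ k →
                   (∀ σ → as ↭ σ → f σ ≈ g σ) → ∑-noDup k as f ≈ ∑-noDup k as g
    ∑-noDup-cong zero    []  _   _  e = e [] Perm.refl
    ∑-noDup-cong (suc k) as inc ke e = ∑-cong∈ as (λ {a} a∈ →
      ∑-noDup-cong k (as ∖ a) (∖-increasing a inc) (∖-length inc a∈ ke)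
        (λ σ p → e (a ∷ σ) (Perm.trans (∖-↭ inc a∈) (Perm.prep a p))))

    ∑-noDup-*ˡ : ∀ k as r (f : List (Fin n) → Carrier) → ∑-noDup k as (λ σ → r * f σ) ≈ r * ∑-noDup k as f
    ∑-noDup-*ˡ zero    as r f = refl
    ∑-noDup-*ˡ (suc k) as r f = trans (∑-cong as (λ a → ∑-noDup-*ˡ k (as ∖ a) r _)) (∑-*ˡ r as _)

    below : Fin n → List (Fin n) → ℕ
    below a = count (λ b → toℕ b <ᵇ toℕ a)

    -- The position of a letter is the number of smaller letters, and this is also the number of
    -- inversions it creates when written in front of the others.
    pick-increasing : ∀ as → Increasing as → (φ : Fin n → List (Fin n) → Carrier) →
                      pick as φ ≈ ∑ as (λ a → sgn (below a (as ∖ a)) * φ a (as ∖ a))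
    pick-increasing []       inc φ = refl
    pick-increasing (a ∷ as) inc@(p ∷ inc′) φ = +-cong
      (sym (trans (*-cong (reflexive (≡.cong sgn (≡.trans (≡.cong (below a) (∖-head inc)) (count-< a p))))
                          (reflexive (≡.cong (φ a) (∖-head inc)))) (*-identityˡ _)))
      (trans (-‿cong (pick-increasing as inc′ _)) (trans (sym (∑-neg as _))
        (∑-cong∈ as (λ {b} b∈ → sym (trans
          (*-cong (reflexive (≡.cong sgn (below-∷ b b∈))) (reflexive (≡.cong (φ b) (∖-tail inc b∈))))
          (sym (-‿distribˡ-* _ _)))))))
      where
      below-∷ : ∀ b → b ∈ as → below b ((a ∷ as) ∖ b) ≡ suc (below b (as ∖ b))
      below-∷ b b∈ rewrite ∖-tail inc b∈ | <⇒<ᵇ≡true (All.lookup p b∈) = ≡.refl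

    sgn-+ : ∀ i j → sgn (i ℕ.+ j) ≈ sgn i * sgn j
    sgn-+ zero    j = sym (*-identityˡ _)
    sgn-+ (suc i) j = trans (-‿cong (sgn-+ i j)) (-‿distribˡ-* _ _)

    -- The inversions of the first letter depend only on which letters follow, not on their order
    -- (`count-↭`), so their sign comes out of the inner sum and becomes the sign of the pick.
    ∑-noDup-sgn : ∀ k as → Increasing as → length as ≡ k → (ψ : List (Fin n) → Carrier) →
                  ∑-noDup k as (λ σ → sgn (inversions σ) * ψ σ) ≈ asym k as ψ
    ∑-noDup-sgn zero    []  _  _  ψ = *-identityˡ _
    ∑-noDup-sgn (suc k) as inc ke ψ = begin
      ∑ as (λ a → ∑-noDup k (as ∖ a) (λ σ → sgn (below a σ ℕ.+ inversions σ) * ψ (a ∷ σ)))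
        ≈⟨ ∑-cong∈ as (λ {a} a∈ → trans
             (∑-noDup-cong k (as ∖ a) (∖-increasing a inc) (∖-length inc a∈ ke) (λ σ p → trans
               (*-congʳ (trans (sgn-+ (below a σ) _)
                 (*-congʳ (reflexive (≡.cong sgn (≡.sym (count-↭ (λ b → toℕ b <ᵇ toℕ a) p)))))))
               (*-assoc _ _ _)))
             (∑-noDup-*ˡ k (as ∖ a) _ _)) ⟩
      ∑ as (λ a → sgn (below a (as ∖ a)) * ∑-noDup k (as ∖ a) (λ σ → sgn (inversions σ) * ψ (a ∷ σ)))
        ≈⟨ ∑-cong∈ as (λ {a} a∈ → *-congˡ
             (∑-noDup-sgn k (as ∖ a) (∖-increasing a inc) (∖-length inc a∈ ke) (ψ ∘ (a ∷_)))) ⟩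
      ∑ as (λ a → sgn (below a (as ∖ a)) * asym k (as ∖ a) (ψ ∘ (a ∷_)))
        ≈⟨ sym (pick-increasing as inc _) ⟩
      pick as (λ a as′ → asym k as′ (ψ ∘ (a ∷_))) ∎

  sgn-isEven : ∀ k → (if isEven k then 1# else - 1#) ≈ sgn k
  sgn-isEven zero    = refl
  sgn-isEven (suc k) with isEven k | sgn-isEven k
  ... | true  | e = -‿cong e
  ... | false | e = trans (sym (-‿involutive 1#)) (-‿cong e)

  tabulate-lookup : ∀ {n} (x : Vec Carrier n) → tabulate (lookup x) ≡ toList x
  tabulate-lookup Vec.[]       = ≡.refl
  tabulate-lookup (a Vec.∷ x) = ≡.cong (a ∷_) (tabulate-lookup x)

  map-lookup-allFin : ∀ {n} (x : Vec Carrier n) → map (lookup x) (allFin n) ≡ toList x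
  map-lookup-allFin x = ≡.trans (map-tabulate id (lookup x)) (tabulate-lookup x)

  ASymSummand-asym : ∀ n u v (x : Vec Carrier n) → ASymSummand n u v x ≈ asym n (toList x) (summand u v)
  ASymSummand-asym n u v x = begin
    ∑ (perms n) (λ σ → (if signPositive σ then 1# else - 1#) * summand u v (map (lookup x) σ))
      ≈⟨ ∑-cong (perms n) (λ σ → *-congʳ (sgn-isEven (inversions σ))) ⟩
    ∑ (perms n) (λ σ → sgn (inversions σ) * summand u v (map (lookup x) σ))
      ≈⟨ ∑-filterᵇ noDup (allLists (allFin n) n) _ ⟩
    ∑ (allLists (allFin n) n) (λ σ → when (noDup σ) (sgn (inversions σ) * summand u v (map (lookup x) σ)))
      ≈⟨ ∑-noDup-correct n (allFin n) _ ⟩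
    ∑-noDup n (allFin n) (λ σ → sgn (inversions σ) * summand u v (map (lookup x) σ))
      ≈⟨ ∑-noDup-sgn n (allFin n) (AllPairs.tabulate⁺-< id) (length-tabulate id) _ ⟩
    asym n (allFin n) (summand u v ∘ map (lookup x))
      ≈⟨ sym (asym-map (lookup x) n (allFin n) _) ⟩
    asym n (map (lookup x) (allFin n)) (summand u v)
      ≡⟨ ≡.cong (λ xs → asym n xs (summand u v)) (map-lookup-allFin x) ⟩
    asym n (toList x) (summand u v) ∎

-- From the antisymmetrizer to a determinant of hook columns

module AntisymmetrizerToDeterminant {c ℓ : Level} (R : CommutativeRing c ℓ)
  (u v w : CommutativeRing.Carrier R) where
  open CommutativeRing R hiding (zero)
  open WithRing R
  open import Algebra.Definitions.RawSemiring (Semiring.rawSemiring semiring) using (_^_)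
  open IntegerSolver R
  open Determinants R
  open Antisymmetrizer R
  open Relation.Binary.Reasoning.Setoid setoid

  q : Carrier → Carrier
  q y = - (w + u * y)

  -- y^m p^b with p = v / y cleared of its denominator. Beyond b = m the truncated subtraction
  -- breaks this reading, whence the bounds on b in what follows.
  powers : ℕ → ℕ → Column
  powers m b y = v ^ b * y ^ (m ∸ b)

  -- y ^ m (p ^ b + q ^ b + w q ^ (b - 1)) with p = v / y, since q + w = - u y.
  hook : ℕ → ℕ → Column
  hook m zero    y = y ^ m
  hook m (suc b) y = powers m (suc b) y - u * y ^ suc m * q y ^ b

  -- The indices decrease so that the column added in each step of the induction is the first one,
  -- along which the determinant is expanded.
  hooks : ℕ → ℕ → List Column
  hooks m b = map (hook m) (downFrom (suc b))

  -- y ^ m times the complete homogeneous polynomial of degree b in p = v / y and q.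
  complete : ℕ → ℕ → Column
  complete m zero    y = y ^ m
  complete m (suc b) y = q y * complete m b y + powers m (suc b) y

  powers-zero : ∀ m y → powers m zero y ≈ y ^ m
  powers-zero m y = *-identityˡ _

  powers-suc : ∀ m b y → b < m → y * powers m (suc b) y ≈ v * powers m b y
  powers-suc (suc m) b y (s≤s b≤m) = begin
    y * (v * v ^ b * y ^ (m ∸ b))    ≈⟨ solve 4 (λ y v a b → y :* (v :* a :* b) := v :* (a :* (y :* b))) refl _ _ _ _ ⟩
    v * (v ^ b * y ^ suc (m ∸ b))    ≡⟨ ≡.cong (λ k → v * (v ^ b * y ^ k)) (≡.sym (ℕ.+-∸-assoc 1 b≤m)) ⟩
    v * (v ^ b * y ^ (suc m ∸ b))    ∎

  -- This is h_{b+1}(p, q) - p h_b(p, q) = q^(b+1), multiplied by y^(m+1), with y p = v.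
  complete-difference : ∀ m b y → b < m →
    y * complete m (suc b) y - v * complete m b y ≈ y ^ suc m * q y ^ suc b
  complete-difference m zero    y b<m = begin
    y * (q y * y ^ m + powers m 1 y) - v * y ^ m
      ≈⟨ +-congʳ (trans (distribˡ _ _ _) (+-congˡ (trans (powers-suc m 0 y b<m) (*-congˡ (powers-zero m y))))) ⟩
    y * (q y * y ^ m) + v * y ^ m - v * y ^ m
      ≈⟨ solve 4 (λ y q a v → y :* (q :* a) :+ v :* a :- v :* a := y :* a :* q) refl _ _ _ _ ⟩
    y * y ^ m * q y
      ≈⟨ *-congˡ (sym (*-identityʳ _)) ⟩
    y * y ^ m * (q y * 1#) ∎
  complete-difference m (suc b) y b<m = begin
    y * (q y * complete m (suc b) y + powers m (suc (suc b)) y) - v * (q y * complete m b y + powers m (suc b) y)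
      ≈⟨ +-congʳ (trans (distribˡ _ _ _) (+-congˡ (powers-suc m (suc b) y b<m))) ⟩
    y * (q y * complete m (suc b) y) + v * powers m (suc b) y - v * (q y * complete m b y + powers m (suc b) y)
      ≈⟨ solve 6 (λ y q k v k′ p → y :* (q :* k) :+ v :* p :- v :* (q :* k′ :+ p) := q :* (y :* k :- v :* k′)) refl _ _ _ _ _ _ ⟩
    q y * (y * complete m (suc b) y - v * complete m b y)
      ≈⟨ *-congˡ (complete-difference m b y (ℕ.<⇒≤ b<m)) ⟩
    q y * (y ^ suc m * q y ^ suc b)
      ≈⟨ solve 3 (λ q a b → q :* (a :* b) := a :* (q :* b)) refl _ _ _ ⟩
    y ^ suc m * q y ^ suc (suc b) ∎

  complete-1 : ∀ m y → complete m 1 y ≈ hook m 1 y + - w * hook m 0 y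
  complete-1 m y = solve 5 (λ w u y a p → (:- (w :+ u :* y)) :* a :+ p := p :- u :* (y :* a) :* :1 :+ (:- w) :* a)
    refl w u y (y ^ m) (powers m 1 y)

  -- y k_{b+1} - v k_b = y^{m+1} q^{b+1} turns the relation q + w = - u y into
  -- h_{b+2} = k_{b+2} + w k_{b+1} + u v k_b.
  complete-2+ : ∀ m b y → b < m →
    complete m (suc (suc b)) y ≈ hook m (suc (suc b)) y + (- w * complete m (suc b) y + - (u * v) * complete m b y)
  complete-2+ m b y b<m = begin
    - (w + u * y) * complete m (suc b) y + powers m (suc (suc b)) y
      ≈⟨ solve 7 (λ w u y k k′ v p → (:- (w :+ u :* y)) :* k :+ p
             := p :- u :* (y :* k :- v :* k′) :+ ((:- w) :* k :+ (:- (u :* v)) :* k′)) refl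
           w u y (complete m (suc b) y) (complete m b y) v (powers m (suc (suc b)) y) ⟩
    powers m (suc (suc b)) y - u * (y * complete m (suc b) y - v * complete m b y) + _
      ≈⟨ +-congʳ (+-congˡ (-‿cong (trans (*-congˡ (complete-difference m b y b<m)) (sym (*-assoc _ _ _))))) ⟩
    hook m (suc (suc b)) y + (- w * complete m (suc b) y + - (u * v) * complete m b y) ∎

  Coefficients : Set c
  Coefficients = ℕ → Carrier

  -- The effect on coefficients of multiplying a form in Z and Y by Z - a Y; index i belongs to the
  -- power Y^i.
  mulLinear : Carrier → Coefficients → Coefficients
  mulLinear a e zero    = e zero
  mulLinear a e (suc i) = e (suc i) - a * e i

  -- The coefficients of ∏ (Z - q Y), the product over xs, with respect to powers of Y.
  coefficients : List Carrier → Coefficients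
  coefficients []       zero    = 1#
  coefficients []       (suc i) = 0#
  coefficients (x ∷ xs) = mulLinear (q x) (coefficients xs)

  coefficients-0 : ∀ xs → coefficients xs 0 ≈ 1#
  coefficients-0 []       = refl
  coefficients-0 (x ∷ xs) = coefficients-0 xs

  coefficients-> : ∀ xs i → length xs < i → coefficients xs i ≈ 0#
  coefficients-> []       (suc i) _       = refl
  coefficients-> (x ∷ xs) (suc i) (s≤s p) = trans
    (+-cong (coefficients-> xs (suc i) (ℕ.m<n⇒m<1+n p)) (-‿cong (*-congˡ (coefficients-> xs i p))))
    (solve 1 (λ a → :0 :- a :* :0 := :0) refl _)

  mulLinear-cong : ∀ a {e e′} → (∀ i → e i ≈ e′ i) → ∀ i → mulLinear a e i ≈ mulLinear a e′ i
  mulLinear-cong a h zero    = h zero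
  mulLinear-cong a h (suc i) = +-cong (h (suc i)) (-‿cong (*-congˡ (h i)))

  mulLinear-comm : ∀ a b e i → mulLinear a (mulLinear b e) i ≈ mulLinear b (mulLinear a e) i
  mulLinear-comm a b e zero          = refl
  mulLinear-comm a b e (suc zero)    = solve 4 (λ a b x y → x :- b :* y :- a :* y := x :- a :* y :- b :* y) refl _ _ _ _
  mulLinear-comm a b e (suc (suc i)) = solve 5
    (λ a b x y z → x :- b :* y :- a :* (y :- b :* z) := x :- a :* y :- b :* (y :- a :* z)) refl _ _ _ _ _

  coefficients-↭ : ∀ {xs ys} → xs ↭ ys → ∀ i → coefficients xs i ≈ coefficients ys i
  coefficients-↭ Perm.refl         i = refl
  coefficients-↭ (Perm.prep x p)   i = mulLinear-cong (q x) (coefficients-↭ p) i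
  coefficients-↭ (Perm.swap x y p) i = trans
    (mulLinear-cong (q x) (mulLinear-cong (q y) (coefficients-↭ p)) i) (mulLinear-comm (q x) (q y) _ i)
  coefficients-↭ (Perm.trans p r)  i = trans (coefficients-↭ p i) (coefficients-↭ r i)

  -- Convolution: the coefficient of degree b in the product of the generating functions of e and k.
  dot : (ℕ → Carrier) → ℕ → Coefficients → Carrier
  dot k zero    e = e 0 * k 0
  dot k (suc b) e = e 0 * k (suc b) + dot k b (e ∘ suc)

  dot-cong : ∀ k b {e e′} → (∀ i → e i ≈ e′ i) → dot k b e ≈ dot k b e′
  dot-cong k zero    h = *-congʳ (h 0)
  dot-cong k (suc b) h = +-cong (*-congʳ (h 0)) (dot-cong k b (h ∘ suc))

  dot-mulLinear′ : ∀ m b y e →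
    dot (λ j → complete m j y) b (λ i → e (suc i) - q y * e i)
      ≈ dot (λ j → powers m j y) b (e ∘ suc) - q y * e 0 * complete m b y
  dot-mulLinear′ m zero    y e = trans
    (solve 4 (λ e₁ a e₀ k → (e₁ :- a :* e₀) :* k := e₁ :* k :- a :* e₀ :* k) refl _ _ _ _)
    (+-congʳ (*-congˡ (sym (powers-zero m y))))
  dot-mulLinear′ m (suc b) y e = trans (+-congˡ (dot-mulLinear′ m b y (e ∘ suc)))
    (solve 6 (λ e₁ a e₀ k p d → (e₁ :- a :* e₀) :* (a :* k :+ p) :+ (d :- a :* e₁ :* k)
               := e₁ :* p :+ d :- a :* e₀ :* (a :* k :+ p)) refl _ _ _ _ _ _)

  -- The generating function of the `complete` columns is that of `powers` divided by 1 - q y * t,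
  -- and `mulLinear (q y)` multiplies by exactly this factor.
  dot-mulLinear : ∀ m b y e →
    dot (λ j → complete m j y) b (mulLinear (q y) e) ≈ dot (λ j → powers m j y) b e
  dot-mulLinear m zero    y e = *-congˡ (sym (powers-zero m y))
  dot-mulLinear m (suc b) y e = trans (+-congˡ (dot-mulLinear′ m b y e))
    (solve 5 (λ e₀ a k p d → e₀ :* (a :* k :+ p) :+ (d :- a :* e₀ :* k) := e₀ :* p :+ d) refl _ _ _ _ _)

  -- The value at Z = v, Y = y of the form of degree b with coefficients e, that is y^b times its
  -- value at Z = p, Y = 1.
  eval : Carrier → ℕ → Coefficients → Carrier
  eval y zero    e = e 0
  eval y (suc b) e = e 0 * v ^ suc b + y * eval y b (e ∘ suc)

  -- `eval` unfolds at the coefficient e 0; here the other end is split off, where the coefficient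
  -- beyond the degree of the form vanishes.
  eval-suc : ∀ y b e → eval y (suc b) e ≈ v * eval y b e + y ^ suc b * e (suc b)
  eval-suc y zero    e = solve 4 (λ e₀ e₁ v y → e₀ :* (v :* :1) :+ y :* e₁ := v :* e₀ :+ y :* :1 :* e₁) refl _ _ _ _
  eval-suc y (suc b) e = trans (+-congˡ (*-congˡ (eval-suc y b (e ∘ suc))))
    (solve 7 (λ e₀ v vb y d a e₁ → e₀ :* (v :* vb) :+ y :* (v :* d :+ a :* e₁) := v :* (e₀ :* vb :+ y :* d) :+ y :* a :* e₁)
      refl _ _ _ _ _ _ _)

  eval-difference : ∀ y b a e e′ → eval y b (λ i → e i - a * e′ i) ≈ eval y b e - a * eval y b e′
  eval-difference y zero    a e e′ = refl
  eval-difference y (suc b) a e e′ = trans (+-congˡ (*-congˡ (eval-difference y b a (e ∘ suc) (e′ ∘ suc))))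
    (solve 7 (λ e e′ a v y d d′ → (e :- a :* e′) :* v :+ y :* (d :- a :* d′)
               := e :* v :+ y :* d :- a :* (e′ :* v :+ y :* d′)) refl _ _ _ _ _ _ _)

  eval-coefficients : ∀ y xs → eval y (length xs) (coefficients xs) ≈ Π (map (λ z → v - y * q z) xs)
  eval-coefficients y []       = refl
  eval-coefficients y (x ∷ xs) = begin
    e 0 * v ^ suc b + y * eval y b (λ i → e (suc i) - q x * e i)
      ≈⟨ +-congˡ (*-congˡ (eval-difference y b (q x) (e ∘ suc) e)) ⟩
    e 0 * v ^ suc b + y * (eval y b (e ∘ suc) - q x * eval y b e)
      ≈⟨ solve 5 (λ a y d q d′ → a :+ y :* (d :- q :* d′) := a :+ y :* d :- y :* q :* d′) refl _ _ _ _ _ ⟩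
    eval y (suc b) e - y * q x * eval y b e
      ≈⟨ +-congʳ (trans (eval-suc y b e) (+-congˡ (trans (*-congˡ (coefficients-> xs (suc b) ℕ.≤-refl)) (zeroʳ _)))) ⟩
    v * eval y b e + 0# - y * q x * eval y b e
      ≈⟨ solve 3 (λ v d a → v :* d :+ :0 :- a :* d := (v :- a) :* d) refl _ _ _ ⟩
    (v - y * q x) * eval y b e
      ≈⟨ *-congˡ (eval-coefficients y xs) ⟩
    (v - y * q x) * Π (map (λ z → v - y * q z) xs) ∎
    where
    b = length xs
    e = coefficients xs

  dot-powers : ∀ m b y e → b ≤ m → dot (λ j → powers m j y) b e ≈ y ^ (m ∸ b) * eval y b e
  dot-powers m       zero    y e _         = trans (*-congˡ (powers-zero m y)) (*-comm _ _)
  dot-powers (suc m) (suc b) y e (s≤s b≤m) = begin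
    e 0 * (v ^ suc b * y ^ (m ∸ b)) + dot (λ j → powers (suc m) j y) b (e ∘ suc)
      ≈⟨ +-congˡ (dot-powers (suc m) b y (e ∘ suc) (ℕ.m≤n⇒m≤1+n b≤m)) ⟩
    e 0 * (v ^ suc b * y ^ (m ∸ b)) + y ^ (suc m ∸ b) * eval y b (e ∘ suc)
      ≡⟨ ≡.cong (λ k → e 0 * (v ^ suc b * y ^ (m ∸ b)) + y ^ k * eval y b (e ∘ suc)) (ℕ.+-∸-assoc 1 b≤m) ⟩
    e 0 * (v ^ suc b * y ^ (m ∸ b)) + y * y ^ (m ∸ b) * eval y b (e ∘ suc)
      ≈⟨ solve 5 (λ e v a y d → e :* (v :* a) :+ y :* a :* d := a :* (e :* v :+ y :* d)) refl _ _ _ _ _ ⟩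
    y ^ (m ∸ b) * (e 0 * v ^ suc b + y * eval y b (e ∘ suc)) ∎

  -- Dividing ∏_{x ∈ xs} (Z - q_x Y) by Z - q_y Y expresses the product over ys as a combination of
  -- the k_b(y) whose coefficients do not depend on which y is removed from xs.
  dot-complete : ∀ m xs y ys → length ys ≡ m → xs ↭ y ∷ ys →
    dot (λ j → complete m j y) m (coefficients xs) ≈ Π (map (λ z → v - y * q z) ys)
  dot-complete m xs y ys ≡.refl p = begin
    dot (λ j → complete m j y) m (coefficients xs)
      ≈⟨ dot-cong _ m (coefficients-↭ p) ⟩
    dot (λ j → complete m j y) m (mulLinear (q y) (coefficients ys))
      ≈⟨ dot-mulLinear m m y (coefficients ys) ⟩
    dot (λ j → powers m j y) m (coefficients ys)
      ≈⟨ dot-powers m m y (coefficients ys) ℕ.≤-refl ⟩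
    y ^ (m ∸ m) * eval y m (coefficients ys)
      ≈⟨ trans (*-congʳ (reflexive (≡.cong (y ^_) (ℕ.n∸n≡0 m)))) (*-identityˡ _) ⟩
    eval y m (coefficients ys)
      ≈⟨ eval-coefficients y ys ⟩
    Π (map (λ z → v - y * q z) ys) ∎

  hooks-∋ : ∀ m {b n} → b ≤ n → ∃₂ λ ps fs → hooks m n ≡ ps ++ hook m b ∷ fs
  hooks-∋ m {zero} {zero}  _ = [] , [] , ≡.refl
  hooks-∋ m {b} {suc n} b≤n with ℕ.m≤n⇒m<n∨m≡n b≤n
  ... | inj₂ ≡.refl = [] , hooks m n , ≡.refl
  ... | inj₁ (s≤s b≤n′) with hooks-∋ m b≤n′
  ... | ps , fs , e = hook m (suc n) ∷ ps , fs , ≡.cong (hook m (suc n) ∷_) e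

  module _ (xs : List Carrier) (m : ℕ) where

    -- A linear functional of the first column that kills every hook of index at most m, since these
    -- are the remaining columns. Column operations thereby become computations with values of `Λ`.
    Λ : Column → Carrier
    Λ f = det xs (f ∷ hooks (suc m) m)

    Λ-+ : ∀ f g → Λ (λ y → f y + g y) ≈ Λ f + Λ g
    Λ-+ f g = det-+ xs [] f g (hooks (suc m) m)

    Λ-*ˡ : ∀ k f → Λ (λ y → k * f y) ≈ k * Λ f
    Λ-*ˡ k f = det-*ˡ xs [] k f (hooks (suc m) m)

    Λ-cong : ∀ {f g} → (∀ y → f y ≈ g y) → Λ f ≈ Λ g
    Λ-cong e = pick-cong xs (λ y ys _ → *-congʳ (e y))

    Λ-linear : ∀ a b f g → Λ (λ y → a * f y + b * g y) ≈ a * Λ f + b * Λ g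
    Λ-linear a b f g = trans (Λ-+ (λ y → a * f y) (λ y → b * g y))
      (+-cong (Λ-*ˡ a f) (Λ-*ˡ b g))

    Λ-hook : ∀ {b} → b ≤ m → Λ (hook (suc m) b) ≈ 0#
    Λ-hook {b} b≤m with hooks-∋ (suc m) b≤m
    ... | ps , fs , e = trans (reflexive (≡.cong (λ hs → det xs (hook (suc m) b ∷ hs)) e))
      (alternating-dup (det-alternating xs) (hook (suc m) b) ps fs)

    -- By `complete-1` and `complete-2+` the two columns differ by multiples of `complete` columns
    -- of lower index, which `Λ` kills.
    Λ-complete-hook : ∀ b → suc b ≤ suc m → (∀ {j} → j ≤ b → Λ (complete (suc m) j) ≈ 0#) →
                      Λ (complete (suc m) (suc b)) ≈ Λ (hook (suc m) (suc b))
    Λ-complete-hook zero _ ih = begin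
      Λ (complete (suc m) 1)
        ≈⟨ Λ-cong (complete-1 (suc m)) ⟩
      Λ (λ y → hook (suc m) 1 y + - w * hook (suc m) 0 y)
        ≈⟨ Λ-+ _ _ ⟩
      Λ (hook (suc m) 1) + Λ (λ y → - w * hook (suc m) 0 y)
        ≈⟨ +-congˡ (trans (Λ-*ˡ _ _) (trans (*-congˡ (ih ℕ.≤-refl)) (zeroʳ _))) ⟩
      Λ (hook (suc m) 1) + 0#
        ≈⟨ +-identityʳ _ ⟩
      Λ (hook (suc m) 1) ∎
    Λ-complete-hook (suc b) b<m ih = begin
      Λ (complete (suc m) (suc (suc b)))
        ≈⟨ Λ-cong (λ y → complete-2+ (suc m) b y (ℕ.<⇒≤ b<m)) ⟩
      Λ (λ y → hook (suc m) (suc (suc b)) y + (- w * complete (suc m) (suc b) y + - (u * v) * complete (suc m) b y))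
        ≈⟨ Λ-+ _ _ ⟩
      Λ (hook (suc m) (suc (suc b))) + Λ (λ y → - w * complete (suc m) (suc b) y + - (u * v) * complete (suc m) b y)
        ≈⟨ +-congˡ (Λ-linear (- w) (- (u * v)) _ _) ⟩
      Λ (hook (suc m) (suc (suc b))) + (- w * Λ (complete (suc m) (suc b)) + - (u * v) * Λ (complete (suc m) b))
        ≈⟨ +-congˡ (+-cong (*-congˡ (ih ℕ.≤-refl)) (*-congˡ (ih (ℕ.n≤1+n b)))) ⟩
      Λ (hook (suc m) (suc (suc b))) + (- w * 0# + - (u * v) * 0#)
        ≈⟨ solve 3 (λ a b c → a :+ (b :* :0 :+ c :* :0) := a) refl _ _ _ ⟩
      Λ (hook (suc m) (suc (suc b))) ∎

    -- The bound k on b turns the recursion into strong induction: the recurrence for `complete`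
    -- reaches back two steps.
    Λ-complete : ∀ k {b} → b ≤ k → b ≤ m → Λ (complete (suc m) b) ≈ 0#
    Λ-complete k       {zero}  _         b≤m = Λ-hook {zero} b≤m
    Λ-complete (suc k) {suc b} (s≤s b≤k) b≤m = trans
      (Λ-complete-hook b (ℕ.m≤n⇒m≤1+n b≤m)
        (λ j≤b → Λ-complete k (ℕ.≤-trans j≤b b≤k) (ℕ.≤-trans j≤b (ℕ.<⇒≤ b≤m))))
      (Λ-hook {suc b} b≤m)

    Λ-dot-zero : ∀ b e → b ≤ m → Λ (λ y → dot (λ j → complete (suc m) j y) b e) ≈ 0#
    Λ-dot-zero zero    e b≤m = trans (Λ-*ˡ _ _) (trans (*-congˡ (Λ-hook {zero} z≤n)) (zeroʳ _))
    Λ-dot-zero (suc b) e b≤m = trans (Λ-+ (λ y → e 0 * complete (suc m) (suc b) y) _) (trans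
      (+-cong (trans (Λ-*ˡ _ _) (trans (*-congˡ (Λ-complete (suc b) ℕ.≤-refl b≤m)) (zeroʳ _)))
              (Λ-dot-zero b (e ∘ suc) (ℕ.<⇒≤ b≤m)))
      (+-identityˡ 0#))

    -- Only the `complete` column of top index survives. Its coefficient is e 0 = 1, because the
    -- form in question is monic in Z.
    Λ-dot : ∀ e → e 0 ≈ 1# →
            Λ (λ y → dot (λ j → complete (suc m) j y) (suc m) e) ≈ det xs (hooks (suc m) (suc m))
    Λ-dot e e₀ = trans (Λ-+ (λ y → e 0 * complete (suc m) (suc m) y) _) (trans
      (+-cong (trans (Λ-*ˡ _ _) (trans (*-cong e₀ (Λ-complete-hook m ℕ.≤-refl
                (λ {j} j≤m → Λ-complete m j≤m j≤m))) (*-identityˡ _)))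
              (Λ-dot-zero m (e ∘ suc) ℕ.≤-refl))
      (+-identityʳ _))

  -- Absorbs the product of the remaining variables, left over from the staircase, into the columns
  -- of the smaller determinant.
  hook-shift : ∀ m b y → b ≤ m → y * hook m b y ≈ hook (suc m) b y
  hook-shift m zero    y b≤m = refl
  hook-shift m (suc b) y b≤m = begin
    y * (v ^ suc b * y ^ (m ∸ suc b) - u * y ^ suc m * q y ^ b)
      ≈⟨ solve 6 (λ y vb a u ym qb → y :* (vb :* a :- u :* ym :* qb) := vb :* (y :* a) :- u :* (y :* ym) :* qb) refl _ _ _ _ _ _ ⟩
    v ^ suc b * y ^ suc (m ∸ suc b) - u * y ^ suc (suc m) * q y ^ b
      ≡⟨ ≡.cong (λ k → v ^ suc b * y ^ k - u * y ^ suc (suc m) * q y ^ b) (≡.sym (ℕ.+-∸-assoc 1 b≤m)) ⟩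
    v ^ suc b * y ^ (suc m ∸ suc b) - u * y ^ suc (suc m) * q y ^ b ∎

  hooks-shift : ∀ m b → b ≤ m →
    Pointwise (λ f g → ∀ y → f y ≈ g y) (map (λ f y → y * f y) (hooks m b)) (hooks (suc m) b)
  hooks-shift m zero    b≤m = (λ y → hook-shift m zero y b≤m) ∷ []
  hooks-shift m (suc b) b≤m = (λ y → hook-shift m (suc b) y b≤m) ∷ hooks-shift m b (ℕ.<⇒≤ b≤m)

  length-hooks : ∀ m b → length (hooks m b) ≡ suc b
  length-hooks m zero    = ≡.refl
  length-hooks m (suc b) = ≡.cong suc (length-hooks m b)

  -- `summand u v` with the coefficient w kept free; for w = 1 - u - v the two are the same term.
  Summand : List Carrier → Carrier
  Summand ys = staircase ys * Πpairs (λ a b → v + w * a + u * a * b) ys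

  Π-zipWith-shift : ∀ ys (f : ℕ → ℕ) n → length ys ≡ n →
    Π (zipWith _^_ ys (applyUpTo (suc ∘ f) n)) ≈ Π (map id ys) * Π (zipWith _^_ ys (applyUpTo f n))
  Π-zipWith-shift []       f zero    _ = sym (*-identityˡ _)
  Π-zipWith-shift (y ∷ ys) f (suc n) e = trans (*-congˡ (Π-zipWith-shift ys (f ∘ suc) n (ℕ.suc-injective e)))
    (solve 4 (λ a b c d → a :* b :* (c :* d) := a :* c :* (b :* d)) refl _ _ _ _)

  -- The first variable has exponent 0 in the staircase, and removing it lowers every other exponent
  -- by one, which leaves the product of ys. A pair factor containing y is v + w y + u y z = v - y
  -- q(z).
  Summand-∷ : ∀ y ys →
    Summand (y ∷ ys) ≈ Π (map (λ z → v - y * q z) ys) * (Π (map id ys) * Summand ys)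
  Summand-∷ y ys = begin
    1# * Π (zipWith _^_ ys (applyUpTo suc (length ys))) * (Π (map (λ b → v + w * y + u * y * b) ys) * P)
      ≈⟨ *-cong (trans (*-identityˡ _) (Π-zipWith-shift ys id (length ys) ≡.refl)) (*-congʳ (factors ys)) ⟩
    Π (map id ys) * staircase ys * (Π (map (λ z → v - y * q z) ys) * P)
      ≈⟨ solve 4 (λ a b c d → a :* b :* (c :* d) := c :* (a :* (b :* d))) refl _ _ _ _ ⟩
    Π (map (λ z → v - y * q z) ys) * (Π (map id ys) * (staircase ys * P)) ∎
    where
    P = Πpairs (λ a b → v + w * a + u * a * b) ys
    factors : ∀ zs → Π (map (λ b → v + w * y + u * y * b) zs) ≈ Π (map (λ z → v - y * q z) zs)
    factors []       = refl
    factors (z ∷ zs) = *-cong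
      (solve 5 (λ v w u y z → v :+ w :* y :+ u :* y :* z := v :- y :* (:- (w :+ u :* z))) refl v w u y z) (factors zs)

  -- Both products are symmetric in the remaining variables and so leave the antisymmetrizer.
  asym-Summand-step : ∀ m xs → length xs ≡ suc m → ∀ y ys → xs ↭ y ∷ ys →
    asym m ys (Summand ∘ (y ∷_)) ≈ Π (map (λ z → v - y * q z) ys) * (Π (map id ys) * asym m ys Summand)
  asym-Summand-step m xs e y ys p = begin
    asym m ys (Summand ∘ (y ∷_))
      ≈⟨ asym-cong m ys (ℕ.suc-injective (≡.trans (≡.sym (↭-length p)) e)) (λ zs r → trans (Summand-∷ y zs)
           (trans (*-cong (Π-map-↭ (λ z → v - y * q z) (Perm.↭-sym r)) (*-congʳ (Π-map-↭ id (Perm.↭-sym r))))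
             (sym (*-assoc _ _ _)))) ⟩
    asym m ys (λ zs → Π (map (λ z → v - y * q z) ys) * Π (map id ys) * Summand zs)
      ≈⟨ trans (asym-*ˡ m ys _ Summand) (*-assoc _ _ _) ⟩
    Π (map (λ z → v - y * q z) ys) * (Π (map id ys) * asym m ys Summand) ∎

  asym-Summand : ∀ m xs → length xs ≡ suc m → asym (suc m) xs Summand ≈ det xs (hooks m m)
  asym-Summand zero (x ∷ []) _ = +-congʳ (solve 0 ((:1 :* :1) :* (:1 :* :1) := :1 :* :1) refl)
  asym-Summand (suc m) xs e = begin
    pick xs (λ y ys → asym (suc m) ys (Summand ∘ (y ∷_)))
      ≈⟨ pick-cong xs (λ y ys p → trans (asym-Summand-step (suc m) xs e y ys p) (*-cong
           (sym (dot-complete (suc m) xs y ys (len p) p)) (trans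
             (*-congˡ (asym-Summand m ys (len p)))
             (sym (det-scale-rows id ys (hooks m m) (≡.trans (len p) (≡.sym (length-hooks m m)))))))) ⟩
    pick xs (λ y ys → dot (λ j → complete (suc m) j y) (suc m) (coefficients xs)
                        * det ys (map (λ f y → y * f y) (hooks m m)))
      ≈⟨ pick-cong xs (λ y ys _ → *-congˡ (det-cong ys (hooks-shift m m ℕ.≤-refl))) ⟩
    Λ xs m (λ y → dot (λ j → complete (suc m) j y) (suc m) (coefficients xs))
      ≈⟨ Λ-dot xs m (coefficients xs) (coefficients-0 xs) ⟩
    det xs (hooks (suc m) (suc m)) ∎
    where
    len : ∀ {y ys} → xs ↭ y ∷ ys → length ys ≡ suc m
    len p = ℕ.suc-injective (≡.trans (≡.sym (↭-length p)) e)

-- Chains of strict partitions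

-- For a strict partition as, the results bs are those for which bs / as is a vertical strip with at
-- most one new row. Equal parts are allowed here because the expansion of the determinant does
-- produce them.
raises : List ℕ → List (List ℕ)
raises []       = [] ∷ [ 1 ] ∷ []
raises (a ∷ as) = concatMap (λ bs → (a ∷ bs) ∷ (suc a ∷ bs) ∷ []) (raises as)

data Raise : List ℕ → List ℕ → Set where
  none : Raise [] []
  new  : Raise [] [ 1 ]
  stay : ∀ {a as bs} → Raise as bs → Raise (a ∷ as) (a ∷ bs)
  up   : ∀ {a as bs} → Raise as bs → Raise (a ∷ as) (suc a ∷ bs)

∈-raises⁻ : ∀ {as bs} → bs ∈ raises as → Raise as bs
∈-raises⁻ {[]}     (here ≡.refl)         = none
∈-raises⁻ {[]}     (there (here ≡.refl)) = new
∈-raises⁻ {a ∷ as} p with find (∈-concatMap⁻ (λ bs → (a ∷ bs) ∷ (suc a ∷ bs) ∷ []) {xs = raises as} p)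
... | bs , q , here ≡.refl         = stay (∈-raises⁻ q)
... | bs , q , there (here ≡.refl) = up (∈-raises⁻ q)

∈-raises⁺ : ∀ {as bs} → Raise as bs → bs ∈ raises as
∈-raises⁺ none     = here ≡.refl
∈-raises⁺ new      = there (here ≡.refl)
∈-raises⁺ (stay r) = ∈-concatMap⁺ _ (lose (∈-raises⁺ r) (here ≡.refl))
∈-raises⁺ (up r)   = ∈-concatMap⁺ _ (lose (∈-raises⁺ r) (there (here ≡.refl)))

strict : List ℕ → Bool
strict []           = true
strict (a ∷ [])     = true
strict (a ∷ b ∷ as) = (b <ᵇ a) ∧ strict (b ∷ as)

-- A chain of length m lists strict partitions with the newest one first.  A totally symmetric plane
-- partition in the m-box corresponds to the chain whose entry d (counted from 0) consists of the positive
-- numbers #{ j ≥ i : (i, j, j + d) ∈ π }, i = 1, 2, ….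
Chain : Set
Chain = List (List ℕ)

newest : Chain → List ℕ
newest c = nth [] c 0

chains : ℕ → List Chain
chains zero    = [ [] ]
chains (suc m) = concatMap (λ c → map (_∷ c) (filterᵇ strict (raises (newest c)))) (chains m)

data IsChain : Chain → Set where
  []  : IsChain []
  _∷_ : ∀ {α c} → Raise (newest c) α × T (strict α) → IsChain c → IsChain (α ∷ c)

∈-chains⁻ : ∀ m {c} → c ∈ chains m → IsChain c × length c ≡ m
∈-chains⁻ zero    (here ≡.refl) = [] , ≡.refl
∈-chains⁻ (suc m) p with find (∈-concatMap⁻ (λ c → map (_∷ c) (filterᵇ strict (raises (newest c)))) {xs = chains m} p)
... | c , c∈ , q with ∈-map⁻ (_∷ c) q
... | α , α∈ , ≡.refl with ∈-filter⁻ _ {xs = raises (newest c)} α∈ | ∈-chains⁻ m c∈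
... | α∈′ , s | ic , e = ((∈-raises⁻ α∈′ , s) ∷ ic) , ≡.cong suc e

∈-chains⁺ : ∀ {c} → IsChain c → c ∈ chains (length c)
∈-chains⁺ []                        = here ≡.refl
∈-chains⁺ (_∷_ {α} {c} (r , s) ic) = ∈-concatMap⁺ _
  (lose (∈-chains⁺ ic) (∈-map⁺ (_∷ c) (∈-filter⁺ _ (∈-raises⁺ r) s)))

raise-positive : ∀ {as bs} → Raise as bs → All (0 <_) as → All (0 <_) bs
raise-positive none     []       = []
raise-positive new      []       = z<s ∷ []
raise-positive (stay r) (p ∷ ps) = p ∷ raise-positive r ps
raise-positive (up r)   (p ∷ ps) = z<s ∷ raise-positive r ps

newest-positive : ∀ {c} → IsChain c → All (0 <_) (newest c)
newest-positive []             = []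
newest-positive ((r , _) ∷ ic) = raise-positive r (newest-positive ic)

newest-strict : ∀ {c} → IsChain c → T (strict (newest c))
newest-strict []             = _
newest-strict ((_ , s) ∷ ic) = s

AdjacentEqual : List ℕ → Set
AdjacentEqual as = ∃₂ λ ps a → ∃ λ fs → as ≡ ps ++ a ∷ a ∷ fs

adjacentEqual-∷ : ∀ {as} b → AdjacentEqual as → AdjacentEqual (b ∷ as)
adjacentEqual-∷ b (ps , a , fs , e) = b ∷ ps , a , fs , ≡.cong (b ∷_) e

strict-∷ : ∀ {a b} as → b < a → strict (a ∷ b ∷ as) ≡ strict (b ∷ as)
strict-∷ {b = b} as b<a = ≡.cong (_∧ strict (b ∷ as)) (<⇒<ᵇ≡true b<a)

-- A part is smaller than its predecessor and grows by at most one, while the predecessor does not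
-- shrink. It can thus catch up but never overtake, and a failure of strictness is an equality of
-- neighbours.
raise-nonstrict-∷ : ∀ {a a′ as bs} → Raise as bs → a ≤ a′ → All (0 <_) (a ∷ as) → T (strict (a ∷ as)) →
                    strict (a′ ∷ bs) ≡ false → AdjacentEqual (a′ ∷ bs)
raise-nonstrict-∷ none _ _ _ ()
raise-nonstrict-∷ {a′ = suc zero}    new _ _ _ _ = [] , 1 , [] , ≡.refl
raise-nonstrict-∷ {a′ = suc (suc _)} new _ _ _ ()
raise-nonstrict-∷ {a′ = zero}        new z≤n (() ∷ _) _ _
raise-nonstrict-∷ {a} {a′} (stay {b} {bs = bs} r) a≤a′ (_ ∷ ps) s e with T-∧ .to s
... | b<a , s′ = adjacentEqual-∷ a′ (raise-nonstrict-∷ r ℕ.≤-refl ps s′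
  (≡.trans (≡.sym (strict-∷ bs (ℕ.<-≤-trans (ℕ.<ᵇ⇒< b a b<a) a≤a′))) e))
raise-nonstrict-∷ {a} {a′} (up {b} {bs = bs} r) a≤a′ (_ ∷ ps) s e with T-∧ .to s
... | b<a , s′ with ℕ.m≤n⇒m<n∨m≡n (ℕ.<-≤-trans (ℕ.<ᵇ⇒< b a b<a) a≤a′)
... | inj₂ ≡.refl = [] , suc b , bs , ≡.refl
... | inj₁ b<a′ = adjacentEqual-∷ a′ (raise-nonstrict-∷ r (ℕ.n≤1+n b) ps s′ (≡.trans (≡.sym (strict-∷ bs b<a′)) e))

raise-nonstrict : ∀ {as bs} → Raise as bs → All (0 <_) as → T (strict as) → strict bs ≡ false → AdjacentEqual bs
raise-nonstrict none     _ _ ()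
raise-nonstrict new      _ _ ()
raise-nonstrict (stay r) ps s e = raise-nonstrict-∷ r ℕ.≤-refl ps s e
raise-nonstrict (up r)   ps s e = raise-nonstrict-∷ r (ℕ.n≤1+n _) ps s e

born : List ℕ → List ℕ → Bool
born as bs = length as <ᵇ length bs

-- If no part is born, the central column x^m keeps its exponent m from then on; m is the length of
-- the chain at that time. `exponents` lists the columns above the centre, the centre and these low
-- columns.
low : Chain → List ℕ
low []      = []
low (α ∷ c) = if born (newest c) α then low c else length c ∷ low c

exponents : Chain → List ℕ
exponents c = map (length c ℕ.+_) (newest c) ++ length c ∷ low c

low-< : ∀ c → All (_< length c) (low c)
low-< []      = []
low-< (α ∷ c) with born (newest c) α
... | true  = All.map ℕ.m<n⇒m<1+n (low-< c)
... | false = ℕ.≤-refl ∷ All.map ℕ.m<n⇒m<1+n (low-< c)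

-- Multilinear extension of functions of exponents

module Multilinear {c ℓ : Level} (R : CommutativeRing c ℓ) where
  open CommutativeRing R hiding (zero)
  open import Algebra.Definitions.RawSemiring (Semiring.rawSemiring semiring) using (_^_)
  open IntegerSolver R
  open Sums R
  open Determinants R
  open Alternating
  open Algebra.Properties.Ring ring
  open Relation.Binary.Reasoning.Setoid setoid

  -- Formal sums of monomials: the map that raises the number of variables acts on exponents, which
  -- a `Column`, being a function on the ring, does not determine.
  Poly : Set c
  Poly = List (Carrier × ℕ)

  evalPoly : Poly → Column
  evalPoly P y = ∑ P (λ (a , e) → a * y ^ e)

  multilinear : (List ℕ → Carrier) → List Poly → Carrier
  multilinear L []       = L []
  multilinear L (P ∷ Ps) = ∑ P (λ (a , e) → a * multilinear (L ∘ (e ∷_)) Ps)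

  multilinear-cong : ∀ {L M} Ps → (∀ es → L es ≈ M es) → multilinear L Ps ≈ multilinear M Ps
  multilinear-cong []       h = h []
  multilinear-cong (P ∷ Ps) h = ∑-cong P (λ (a , e) → *-congˡ (multilinear-cong Ps (λ es → h (e ∷ es))))

  multilinear-zero : ∀ {L} Ps → (∀ es → L es ≈ 0#) → multilinear L Ps ≈ 0#
  multilinear-zero []       h = h []
  multilinear-zero (P ∷ Ps) h = ∑-zero P (λ (a , e) →
    trans (*-congˡ (multilinear-zero Ps (λ es → h (e ∷ es)))) (zeroʳ a))

  multilinear-+ : ∀ L M Ps → multilinear (λ es → L es + M es) Ps ≈ multilinear L Ps + multilinear M Ps
  multilinear-+ L M []       = refl
  multilinear-+ L M (P ∷ Ps) = trans
    (∑-cong P (λ (a , e) → trans (*-congˡ (multilinear-+ _ _ Ps)) (distribˡ _ _ _))) (∑-+ P _ _)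

  multilinear-*ˡ : ∀ k L Ps → multilinear (λ es → k * L es) Ps ≈ k * multilinear L Ps
  multilinear-*ˡ k L []       = refl
  multilinear-*ˡ k L (P ∷ Ps) = trans
    (∑-cong P (λ (a , e) → trans (*-congˡ (multilinear-*ˡ k _ Ps))
      (solve 3 (λ a k b → a :* (k :* b) := k :* (a :* b)) refl _ _ _))) (∑-*ˡ k P _)

  multilinear-neg : ∀ L Ps → multilinear (λ es → - L es) Ps ≈ - multilinear L Ps
  multilinear-neg L Ps = trans (multilinear-cong Ps (λ es → sym (-1*x≈-x _)))
    (trans (multilinear-*ˡ (- 1#) L Ps) (-1*x≈-x _))

  multilinear-∑ : ∀ {a} {A : Set a} (xs : List A) (L : A → List ℕ → Carrier) Ps →
                  multilinear (λ es → ∑ xs (λ x → L x es)) Ps ≈ ∑ xs (λ x → multilinear (L x) Ps)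
  multilinear-∑ []       L Ps = multilinear-zero Ps (λ _ → refl)
  multilinear-∑ (x ∷ xs) L Ps = trans (multilinear-+ (L x) _ Ps) (+-congˡ (multilinear-∑ xs L Ps))

  substitute : (ℕ → Poly) → Poly → Poly
  substitute φ = concatMap (λ (a , e) → map (λ (b , e′) → a * b , e′) (φ e))

  -- Moves a linear map from the columns to the functional, so that an induction over the columns
  -- may be applied to another alternating functional.
  multilinear-substitute : ∀ L φ Ps →
    multilinear L (map (substitute φ) Ps) ≈ multilinear (multilinear L ∘ map φ) Ps
  multilinear-substitute L φ []       = refl
  multilinear-substitute L φ (P ∷ Ps) = trans (∑-concatMap _ P _) (∑-cong P (λ (a , e) → trans
    (∑-map _ (φ e) _) (trans
    (∑-cong (φ e) (λ (b , e′) → trans (*-assoc _ _ _) (*-congˡ (*-congˡ (multilinear-substitute _ φ Ps)))))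
    (trans (∑-*ˡ a (φ e) _) (*-congˡ (trans
      (∑-cong (φ e) (λ (b , e′) → sym (multilinear-*ˡ b _ Ps)))
      (sym (multilinear-∑ (φ e) (λ (b , e′) es → b * multilinear (L ∘ (e′ ∷_)) (map φ es)) Ps))))))))

  -- Diagonal terms vanish by assumption and the others cancel in pairs, which avoids a division by
  -- 2.
  ∑∑-antisym : ∀ {a} {A : Set a} (xs : List A) (f : A → A → Carrier) →
               (∀ x → f x x ≈ 0#) → (∀ x y → f x y ≈ - f y x) → ∑ xs (λ x → ∑ xs (f x)) ≈ 0#
  ∑∑-antisym []       f z s = refl
  ∑∑-antisym (x ∷ xs) f z s = begin
    f x x + ∑ xs (f x) + ∑ xs (λ y → f y x + ∑ xs (f y))
      ≈⟨ +-cong (+-congʳ (z x)) (trans (∑-+ xs _ _) (+-cong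
           (trans (∑-cong xs (λ y → s y x)) (∑-neg xs (f x))) (∑∑-antisym xs f z s))) ⟩
    0# + ∑ xs (f x) + (- ∑ xs (f x) + 0#)
      ≈⟨ solve 1 (λ a → :0 :+ a :+ ((:- a) :+ :0) := :0) refl _ ⟩
    0# ∎

  multilinear-alternating : ∀ {L} → Alternating L → Alternating (multilinear L)
  multilinear-alternating alt .zero-dup [] P Ps = trans
    (∑-cong P (λ (a , e) → sym (∑-*ˡ a P _)))
    (∑∑-antisym P (λ (a , e) (b , e′) → a * (b * multilinear _ Ps))
      (λ (a , e) → trans (*-congˡ (trans (*-congˡ (multilinear-zero Ps (zero-dup alt [] e))) (zeroʳ _))) (zeroʳ _))
      (λ (a , e) (b , e′) → trans
        (*-congˡ (*-congˡ (trans (multilinear-cong Ps (swap alt [] e e′)) (multilinear-neg _ Ps))))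
        (solve 3 (λ a b m → a :* (b :* (:- m)) := :- (b :* (a :* m))) refl _ _ _)))
  multilinear-alternating alt .zero-dup (Q ∷ Qs) P Ps = ∑-zero Q (λ (a , e) →
    trans (*-congˡ (multilinear-alternating (alternating-∷ alt e) .zero-dup Qs P Ps)) (zeroʳ _))
  multilinear-alternating {L} alt .swap [] P Q Ps = begin
    ∑ P (λ (a , e) → a * ∑ Q (λ (b , e′) → b * multilinear (L ∘ (e ∷_) ∘ (e′ ∷_)) Ps))
      ≈⟨ ∑-cong P (λ (a , e) → sym (∑-*ˡ a Q _)) ⟩
    ∑ P (λ (a , e) → ∑ Q (λ (b , e′) → a * (b * multilinear (L ∘ (e ∷_) ∘ (e′ ∷_)) Ps)))
      ≈⟨ ∑-swap P Q _ ⟩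
    ∑ Q (λ (b , e′) → ∑ P (λ (a , e) → a * (b * multilinear (L ∘ (e ∷_) ∘ (e′ ∷_)) Ps)))
      ≈⟨ ∑-cong Q (λ (b , e′) → trans (∑-cong P (λ (a , e) → trans
           (*-congˡ (*-congˡ (trans (multilinear-cong Ps (swap alt [] e e′)) (multilinear-neg _ Ps))))
           (solve 3 (λ a b m → a :* (b :* (:- m)) := (:- b) :* (a :* m)) refl _ _ _)))
           (trans (∑-*ˡ (- b) P _) (sym (-‿distribˡ-* _ _)))) ⟩
    ∑ Q (λ (b , e′) → - (b * ∑ P (λ (a , e) → a * multilinear (L ∘ (e′ ∷_) ∘ (e ∷_)) Ps)))
      ≈⟨ ∑-neg Q _ ⟩
    - ∑ Q (λ (b , e′) → b * ∑ P (λ (a , e) → a * multilinear (L ∘ (e′ ∷_) ∘ (e ∷_)) Ps)) ∎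
  multilinear-alternating alt .swap (U ∷ Us) P Q Ps = trans
    (∑-cong U (λ (a , e) → trans (*-congˡ (multilinear-alternating (alternating-∷ alt e) .swap Us P Q Ps))
      (sym (-‿distribʳ-* _ _)))) (∑-neg U _)

  monomial : ℕ → Column
  monomial e y = y ^ e

  pick-multilinear : ∀ xs (L : Carrier → List Carrier → List ℕ → Carrier) Ps →
    pick xs (λ y ys → multilinear (L y ys) Ps) ≈ multilinear (λ es → pick xs (λ y ys → L y ys es)) Ps
  pick-multilinear []       L Ps = sym (multilinear-zero Ps (λ _ → refl))
  pick-multilinear (x ∷ xs) L Ps = sym (trans (multilinear-+ _ _ Ps) (+-congˡ (trans (multilinear-neg _ Ps)
    (-‿cong (sym (pick-multilinear xs (λ y ys → L y (x ∷ ys)) Ps))))))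

  pick-∑ : ∀ {a} {A : Set a} xs (zs : List A) (φ : A → Carrier → List Carrier → Carrier) →
           pick xs (λ y ys → ∑ zs (λ z → φ z y ys)) ≈ ∑ zs (λ z → pick xs (φ z))
  pick-∑ xs []       φ = pick-zero xs (λ _ _ _ → refl)
  pick-∑ xs (z ∷ zs) φ = trans (pick-+ xs _ _) (+-congˡ (pick-∑ xs zs φ))

  det-evalPoly : ∀ xs Ps → det xs (map evalPoly Ps) ≈ multilinear (det xs ∘ map monomial) Ps
  det-evalPoly xs []       = refl
  det-evalPoly xs (P ∷ Ps) = begin
    pick xs (λ y ys → evalPoly P y * det ys (map evalPoly Ps))
      ≈⟨ pick-cong xs (λ y ys _ → trans (*-congˡ (det-evalPoly ys Ps)) (trans (*-comm _ _) (trans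
           (sym (∑-*ˡ _ P _)) (∑-cong P (λ (a , e) → solve 3 (λ m a b → m :* (a :* b) := a :* (b :* m)) refl _ _ _))))) ⟩
    pick xs (λ y ys → ∑ P (λ (a , e) → a * (y ^ e * multilinear (det ys ∘ map monomial) Ps)))
      ≈⟨ pick-∑ xs P _ ⟩
    ∑ P (λ (a , e) → pick xs (λ y ys → a * (y ^ e * multilinear (det ys ∘ map monomial) Ps)))
      ≈⟨ ∑-cong P (λ (a , e) → trans (pick-*ˡ a xs _) (*-congˡ (trans
           (pick-cong xs (λ y ys _ → sym (multilinear-*ˡ _ _ Ps))) (pick-multilinear xs _ Ps)))) ⟩
    ∑ P (λ (a , e) → a * multilinear (λ es → pick xs (λ y ys → y ^ e * det ys (map monomial es))) Ps) ∎

-- Expansion of the hook determinant along chains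

module Expansion {c ℓ : Level} (R : CommutativeRing c ℓ) (u v w : CommutativeRing.Carrier R) where
  open CommutativeRing R hiding (zero)
  open import Algebra.Definitions.RawSemiring (Semiring.rawSemiring semiring) using (_^_)
  open IntegerSolver R
  open Sums R
  open Determinants R
  open Alternating
  open Multilinear R
  open AntisymmetrizerToDeterminant R u v w using (hook; hooks; q)
  open Relation.Binary.Reasoning.Setoid setoid

  -- The linear map taking the hook columns for m + 1 variables to those for m + 2 variables.
  lift : ℕ → ℕ → Poly
  lift m e = if e <ᵇ m then [ v , e ]
             else if m <ᵇ e then (- w , suc e) ∷ (- u , suc (suc e)) ∷ []
             else (v , m) ∷ (- u , suc (suc m)) ∷ []

  lift-< : ∀ {m e} → e < m → lift m e ≡ [ v , e ]
  lift-< p rewrite <⇒<ᵇ≡true p = ≡.refl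

  lift-≡ : ∀ m → lift m m ≡ (v , m) ∷ (- u , suc (suc m)) ∷ []
  lift-≡ m rewrite ≤⇒<ᵇ≡false (ℕ.≤-refl {m}) = ≡.refl

  lift-> : ∀ {m e} → m < e → lift m e ≡ (- w , suc e) ∷ (- u , suc (suc e)) ∷ []
  lift-> p rewrite ≤⇒<ᵇ≡false (ℕ.<⇒≤ p) | <⇒<ᵇ≡true p = ≡.refl

  -- Ordered by increasing hook index, opposite to `hooks`: the new central column stands in front
  -- and the lifted old columns follow.
  formalHooks : ℕ → List Poly
  formalHooks zero    = [ 1# , 0 ] ∷ []
  formalHooks (suc m) = [ 1# , suc m ] ∷ map (substitute (lift m)) (formalHooks m)

  -- The coefficients of `lift` with their signs removed: a factor w or u for every part, and a
  -- final v or u for the central column. The value 0# is a default for lists that are not related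
  -- by a raise.
  raiseWeight : List ℕ → List ℕ → Carrier
  raiseWeight []       []       = v
  raiseWeight []       (b ∷ bs) = u
  raiseWeight (a ∷ as) []       = 0#
  raiseWeight (a ∷ as) (b ∷ bs) = (if b ≡ᵇ a then w else u) * raiseWeight as bs

  raiseWeight-stay : ∀ a as bs → raiseWeight (a ∷ as) (a ∷ bs) ≡ w * raiseWeight as bs
  raiseWeight-stay a as bs rewrite ≡ᵇ-refl a = ≡.refl

  raiseWeight-up : ∀ a as bs → raiseWeight (a ∷ as) (suc a ∷ bs) ≡ u * raiseWeight as bs
  raiseWeight-up a as bs rewrite >⇒≡ᵇ≡false (ℕ.n<1+n a) = ≡.refl

  -- The power of v accounts for the low columns, each of which is multiplied by v in every later
  -- step.
  chainWeight : Chain → Carrier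
  chainWeight []      = 1#
  chainWeight (α ∷ c) = chainWeight c * (raiseWeight (newest c) α * v ^ length (low c))

  multilinear-low : ∀ m L es → All (_< m) es → multilinear L (map (lift m) es) ≈ v ^ length es * L es
  multilinear-low m L []       []       = sym (*-identityˡ _)
  multilinear-low m L (e ∷ es) (p ∷ ps) rewrite lift-< p = trans (+-identityʳ _)
    (trans (*-congˡ (multilinear-low m _ es ps)) (sym (*-assoc _ _ _)))

  -- Moving the column m + 1 past the columns of the parts absorbs the signs in lift.
  multilinear-raise : ∀ m {L} → Alternating L → ∀ α es → All (0 <_) α → All (_< m) es →
    multilinear L ([ 1# , suc m ] ∷ map (lift m) (map (m ℕ.+_) α ++ m ∷ es))
      ≈ ∑ (raises α) (λ β → raiseWeight α β *
          (v ^ length es * L (map (suc m ℕ.+_) β ++ suc m ∷ (if born α β then es else m ∷ es))))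
  multilinear-raise m {L} alt [] es [] ps rewrite lift-≡ m | ℕ.+-comm m 1 = begin
    1# * (v * multilinear _ (map (lift m) es) + (- u * multilinear _ (map (lift m) es) + 0#)) + 0#
      -- The term x^m stands in order behind the central x^(m+1). The term x^(m+2) has to change
      -- places with it, and this cancels the sign of - u.
      ≈⟨ +-congʳ (*-congˡ (+-cong (*-congˡ (multilinear-low m _ es ps)) (+-congʳ (*-congˡ
           (trans (multilinear-low m _ es ps) (*-congˡ (swap alt [] (suc m) (suc (suc m)) es))))))) ⟩
    1# * (v * (v ^ length es * L (suc m ∷ m ∷ es))
      + (- u * (v ^ length es * - L (suc (suc m) ∷ suc m ∷ es)) + 0#)) + 0#
      ≈⟨ solve 5 (λ v a b c u → :1 :* (v :* (a :* b) :+ ((:- u) :* (a :* (:- c)) :+ :0)) :+ :0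
                        := v :* (a :* b) :+ (u :* (a :* c) :+ :0)) refl _ _ _ _ _ ⟩
    v * (v ^ length es * L (suc m ∷ m ∷ es)) + (u * (v ^ length es * L (suc (suc m) ∷ suc m ∷ es)) + 0#) ∎
  multilinear-raise m {L} alt (a ∷ α) es (0<a ∷ pα) ps rewrite lift-> (ℕ.m<m+n m 0<a) = begin
    1# * (- w * multilinear (L ∘ (suc m ∷_) ∘ (e₁ ∷_)) Ps + (- u * multilinear (L ∘ (suc m ∷_) ∘ (e₂ ∷_)) Ps + 0#)) + 0#
      ≈⟨ +-congʳ (*-congˡ (+-cong (*-congˡ (move e₁)) (+-congʳ (*-congˡ (move e₂))))) ⟩
    1# * (- w * - M e₁ + (- u * - M e₂ + 0#)) + 0#
      ≈⟨ solve 4 (λ w a u b → :1 :* ((:- w) :* (:- a) :+ ((:- u) :* (:- b) :+ :0)) :+ :0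
              := w :* (:1 :* a :+ :0) :+ u :* (:1 :* b :+ :0)) refl _ _ _ _ ⟩
    w * (1# * M e₁ + 0#) + u * (1# * M e₂ + 0#)
      ≈⟨ +-cong (*-congˡ (multilinear-raise m (alternating-∷ alt e₁) α es pα ps))
                (*-congˡ (multilinear-raise m (alternating-∷ alt e₂) α es pα ps)) ⟩
    w * ∑ (raises α) (S e₁) + u * ∑ (raises α) (S e₂)
      ≈⟨ sym (+-cong (∑-*ˡ w (raises α) (S e₁)) (∑-*ˡ u (raises α) (S e₂))) ⟩
    ∑ (raises α) (λ β → w * S e₁ β) + ∑ (raises α) (λ β → u * S e₂ β)
      ≈⟨ sym (∑-+ (raises α) _ _) ⟩
    ∑ (raises α) (λ β → w * S e₁ β + u * S e₂ β)
      ≈⟨ ∑-cong (raises α) (λ β → +-cong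
           (trans (sym (*-assoc _ _ _)) (*-congʳ (reflexive (≡.sym (raiseWeight-stay a α β)))))
           (trans (trans (sym (*-assoc _ _ _)) (*-cong (reflexive (≡.sym (raiseWeight-up a α β)))
             (reflexive (≡.cong (λ e → v ^ length es * L (e ∷ tail β)) (≡.cong suc (≡.sym (ℕ.+-suc m a)))))))
             (sym (+-identityʳ _)))) ⟩
    ∑ (raises α) (λ β → ∑ ((a ∷ β) ∷ (suc a ∷ β) ∷ []) G)
      ≈⟨ sym (∑-concatMap (λ β → (a ∷ β) ∷ (suc a ∷ β) ∷ []) (raises α) G) ⟩
    ∑ (raises (a ∷ α)) G ∎
    where
    e₁ = suc (m ℕ.+ a)
    e₂ = suc (suc (m ℕ.+ a))
    Ps = map (lift m) (map (m ℕ.+_) α ++ m ∷ es)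
    M  = λ e → multilinear (L ∘ (e ∷_) ∘ (suc m ∷_)) Ps
    tail : List ℕ → List ℕ
    tail β = map (suc m ℕ.+_) β ++ suc m ∷ (if born α β then es else m ∷ es)
    S : ℕ → List ℕ → Carrier
    S e β = raiseWeight α β * (v ^ length es * L (e ∷ tail β))
    G : List ℕ → Carrier
    G β = raiseWeight (a ∷ α) β *
      (v ^ length es * L (map (suc m ℕ.+_) β ++ suc m ∷ (if born (a ∷ α) β then es else m ∷ es)))
    move : ∀ e → multilinear (L ∘ (suc m ∷_) ∘ (e ∷_)) Ps ≈ - M e
    move e = trans (multilinear-cong Ps (λ fs → swap alt [] (suc m) e fs)) (multilinear-neg _ Ps)

  alternating-adjacentEqual : ∀ {L} → Alternating L → ∀ (f : ℕ → ℕ) {as} fs → AdjacentEqual as → L (map f as ++ fs) ≈ 0#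
  alternating-adjacentEqual {L} alt f fs (ps , a , gs , ≡.refl) = trans
    (reflexive (≡.cong L (≡.trans (≡.cong (_++ fs) (map-++ f ps (a ∷ a ∷ gs))) (++-assoc (map f ps) _ fs))))
    (zero-dup alt (map f ps) (f a) (map f gs ++ fs))

  multilinear-formalHooks : ∀ m {L} → Alternating L →
    multilinear L (formalHooks m) ≈ ∑ (chains m) (λ c → chainWeight c * L (exponents c))
  multilinear-formalHooks zero    alt = +-congʳ refl
  multilinear-formalHooks (suc m) {L} alt = begin
    1# * multilinear L₁ (map (substitute (lift m)) (formalHooks m)) + 0#
      ≈⟨ +-congʳ (*-congˡ (multilinear-substitute L₁ (lift m) (formalHooks m))) ⟩
    1# * multilinear (multilinear L₁ ∘ map (lift m)) (formalHooks m) + 0#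
      ≈⟨ +-congʳ (*-congˡ (multilinear-formalHooks m
           (alternating-map (lift m) (multilinear-alternating (alternating-∷ alt (suc m)))))) ⟩
    1# * ∑ (chains m) (λ c → chainWeight c * multilinear L₁ (map (lift m) (exponents c))) + 0#
      ≈⟨ trans (+-identityʳ _) (*-identityˡ _) ⟩
    ∑ (chains m) (λ c → chainWeight c * multilinear L₁ (map (lift m) (exponents c)))
      ≈⟨ ∑-cong∈ (chains m) (λ {c} c∈ → step c (∈-chains⁻ m c∈)) ⟩
    ∑ (chains m) (λ c → ∑ (map (_∷ c) (filterᵇ strict (raises (newest c)))) (λ c → chainWeight c * L (exponents c)))
      ≈⟨ sym (∑-concatMap _ (chains m) _) ⟩
    ∑ (chains (suc m)) (λ c → chainWeight c * L (exponents c)) ∎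
    where
    L₁ = L ∘ (suc m ∷_)
    step : ∀ c → IsChain c × length c ≡ m →
      chainWeight c * multilinear L₁ (map (lift m) (exponents c))
        ≈ ∑ (map (_∷ c) (filterᵇ strict (raises (newest c)))) (λ c → chainWeight c * L (exponents c))
    step c (ic , ≡.refl) = begin
      chainWeight c * multilinear L₁ (map (lift m) (exponents c))
        ≈⟨ *-congˡ (sym (trans (+-identityʳ _) (*-identityˡ _))) ⟩
      chainWeight c * multilinear L ([ 1# , suc m ] ∷ map (lift m) (exponents c))
        ≈⟨ *-congˡ (multilinear-raise m alt (newest c) (low c) (newest-positive ic) (low-< c)) ⟩
      chainWeight c * ∑ (raises (newest c)) (λ β → raiseWeight (newest c) β * (v ^ length (low c) * L (exponents (β ∷ c))))
        ≈⟨ trans (sym (∑-*ˡ (chainWeight c) (raises (newest c)) _)) (∑-cong (raises (newest c)) (λ β →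
             solve 4 (λ a b d e → a :* (b :* (d :* e)) := a :* (b :* d) :* e) refl _ _ _ _)) ⟩
      ∑ (raises (newest c)) (λ β → chainWeight (β ∷ c) * L (exponents (β ∷ c)))
        ≈⟨ ∑-cong∈ (raises (newest c)) (λ {β} β∈ → strictOnly β (∈-raises⁻ β∈)) ⟩
      ∑ (raises (newest c)) (λ β → when (strict β) (chainWeight (β ∷ c) * L (exponents (β ∷ c))))
        ≈⟨ sym (∑-filterᵇ strict (raises (newest c)) _) ⟩
      ∑ (filterᵇ strict (raises (newest c))) (λ β → chainWeight (β ∷ c) * L (exponents (β ∷ c)))
        ≈⟨ sym (∑-map (_∷ c) (filterᵇ strict (raises (newest c))) _) ⟩
      ∑ (map (_∷ c) (filterᵇ strict (raises (newest c)))) (λ c → chainWeight c * L (exponents c)) ∎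
      where
      strictOnly : ∀ β → Raise (newest c) β →
        chainWeight (β ∷ c) * L (exponents (β ∷ c))
          ≈ when (strict β) (chainWeight (β ∷ c) * L (exponents (β ∷ c)))
      strictOnly β r with strict β in e
      ... | true  = refl
      ... | false = trans (*-congˡ (alternating-adjacentEqual alt _ _
                      (raise-nonstrict r (newest-positive ic) (newest-strict ic) e))) (zeroʳ _)

  -- The terms above m are recorded only by a bound on their exponents and by their value. This
  -- determines the branch of `lift` that applies, and no power of q has to be expanded.
  data IsHook (m : ℕ) : Poly → ℕ → Set (c Level.⊔ ℓ) where
    leading : IsHook m [ 1# , m ] 0
    hooked  : ∀ {a H b} → a ≈ v ^ suc b → All (λ (_ , e) → m < e) H →
              (∀ y → evalPoly H y ≈ - (u * y ^ suc m * q y ^ b)) → IsHook m ((a , m ∸ suc b) ∷ H) (suc b)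

  -- Above the exponent m, `lift` is multiplication by y * q y = - w y - u y^2.
  evalPoly-substitute : ∀ m H → All (λ (_ , e) → m < e) H → ∀ y →
    evalPoly (substitute (lift m) H) y ≈ y * q y * evalPoly H y
  evalPoly-substitute m []            []       y = sym (zeroʳ _)
  evalPoly-substitute m ((a , e) ∷ H) (p ∷ ps) y rewrite lift-> p = trans
    (+-congˡ (+-congˡ (evalPoly-substitute m H ps y)))
    (solve 6 (λ a w ye u y d → a :* (:- w) :* (y :* ye) :+ (a :* (:- u) :* (y :* (y :* ye)) :+ y :* (:- (w :+ u :* y)) :* d)
      := y :* (:- (w :+ u :* y)) :* (a :* ye :+ d)) refl a w (y ^ e) u y (evalPoly H y))

  substitute-> : ∀ m H → All (λ (_ , e) → m < e) H → All (λ (_ , e) → suc m < e) (substitute (lift m) H)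
  substitute-> m []            []       = []
  substitute-> m ((a , e) ∷ H) (p ∷ ps) rewrite lift-> p = s≤s p ∷ s≤s (ℕ.m<n⇒m<1+n p) ∷ substitute-> m H ps

  isHook-suc : ∀ m {P b} → b ≤ m → IsHook m P b → IsHook (suc m) (substitute (lift m) P) (suc b)
  isHook-suc m b≤m leading rewrite lift-≡ m = hooked (*-comm _ _) (ℕ.≤-refl ∷ [])
    (λ y → solve 3 (λ u y a → :1 :* (:- u) :* (y :* (y :* a)) :+ :0 := :- (u :* (y :* (y :* a)) :* :1)) refl u y (y ^ m))
  isHook-suc m b<m (hooked {a} {H} {b} ea m<H eH) rewrite lift-< {m} {m ∸ suc b} (ℕ.∸-monoʳ-< z<s b<m) =
    hooked (trans (*-congʳ ea) (*-comm _ _)) (substitute-> m H m<H)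
      (λ y → trans (evalPoly-substitute m H m<H y) (trans (*-congˡ (eH y))
        (solve 5 (λ y q u ym qb → y :* q :* (:- (u :* ym :* qb)) := :- (u :* (y :* ym) :* (q :* qb))) refl _ _ _ _ _)))

  isHook-eval : ∀ m {P b} → IsHook m P b → ∀ y → evalPoly P y ≈ hook m b y
  isHook-eval m leading          y = trans (+-identityʳ _) (*-identityˡ _)
  isHook-eval m (hooked ea _ eH) y = +-cong (*-congʳ ea) (eH y)

  formalHooks-isHook : ∀ m → Pointwise (λ P b → IsHook m P b × b ≤ m) (formalHooks m) (upTo (suc m))
  formalHooks-isHook zero    = (leading , z≤n) ∷ []
  formalHooks-isHook (suc m) = (leading , z≤n) ∷
    ≡.subst (Pointwise _ _) (map-upTo suc (suc m)) (Pointwise.map⁺ _ suc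
      (Pointwise.map (λ (h , b≤m) → isHook-suc m b≤m h , s≤s b≤m) (formalHooks-isHook m)))

  -- The sign comes from reversing the hooks into the order of `formalHooks`; `bialternant` supplies
  -- the same sign again.
  det-hooks : ∀ xs m → det xs (hooks m m) ≈
    ε (suc m) * ∑ (chains m) (λ c → chainWeight c * det xs (map monomial (exponents c)))
  det-hooks xs m = begin
    det xs (hooks m m)
      ≈⟨ alternating-reverse (det-alternating xs) (hooks m m) ⟩
    ε (length (hooks m m)) * det xs (reverse (hooks m m))
      ≡⟨ ≡.cong₂ (λ k hs → ε k * det xs hs) (≡.trans (length-map (hook m) (downFrom (suc m))) (length-downFrom (suc m)))
           (≡.trans (≡.sym (reverse-map (hook m) (downFrom (suc m)))) (≡.cong (map (hook m)) (reverse-downFrom (suc m)))) ⟩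
    ε (suc m) * det xs (map (hook m) (upTo (suc m)))
      ≈⟨ *-congˡ (sym (det-cong xs (Pointwise.map⁺ _ _ (Pointwise.map (λ (h , _) → isHook-eval m h) (formalHooks-isHook m))))) ⟩
    ε (suc m) * det xs (map evalPoly (formalHooks m))
      ≈⟨ *-congˡ (det-evalPoly xs (formalHooks m)) ⟩
    ε (suc m) * multilinear (det xs ∘ map monomial) (formalHooks m)
      ≈⟨ *-congˡ (multilinear-formalHooks m (alternating-map monomial (det-alternating xs))) ⟩
    ε (suc m) * ∑ (chains m) (λ c → chainWeight c * det xs (map monomial (exponents c))) ∎

-- Rows of tableaux and their largest letter; interlacing

≤⇒≤ᵇ≡true : ∀ {m n} → m ≤ n → (m ≤ᵇ n) ≡ true
≤⇒≤ᵇ≡true {zero}  _ = ≡.refl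
≤⇒≤ᵇ≡true {suc m} p = <⇒<ᵇ≡true p

>⇒≤ᵇ≡false : ∀ {m n} → n < m → (m ≤ᵇ n) ≡ false
>⇒≤ᵇ≡false {suc m} (s≤s p) = ≤⇒<ᵇ≡false p

-- A pair (k , c) stands for a row of length r = k + c that ends with c copies of the largest
-- letter.
splits : ℕ → List (ℕ × ℕ)
splits zero    = [ 0 , 0 ]
splits (suc r) = (0 , suc r) ∷ map (map₁ suc) (splits r)

∈-splits : ∀ r {k c} → (k , c) ∈ splits r → k ℕ.+ c ≡ r
∈-splits zero    (here ≡.refl) = ≡.refl
∈-splits (suc r) (here ≡.refl) = ≡.refl
∈-splits (suc r) (there p) with ∈-map⁻ (map₁ suc) p
... | (k , c) , q , ≡.refl = ≡.cong suc (∈-splits r q)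

∈-allLists⁻ : ∀ {a} {A : Set a} {xs : List A} k {ys} → ys ∈ allLists xs k → length ys ≡ k × All (_∈ xs) ys
∈-allLists⁻ zero    (here ≡.refl) = ≡.refl , []
∈-allLists⁻ {xs = xs} (suc k) p with find (∈-concatMap⁻ (λ a → map (a ∷_) (allLists xs k)) {xs = xs} p)
... | a , a∈ , q with ∈-map⁻ (a ∷_) q
... | ys , r , ≡.refl with ∈-allLists⁻ k r
... | e , all = ≡.cong suc e , a∈ ∷ all

-- λ + δ with δ = (n - 1, ..., 1, 0): the exponents of the alternant that belongs to λ.
addStaircase : List ℕ → List ℕ
addStaircase []      = []
addStaircase (r ∷ λs) = r ℕ.+ length λs ∷ addStaircase λs

colPair : ∀ {n} → List (Fin n) → List (Fin n) → Bool
colPair r s = all (λ b → b) (zipWith (λ a b → toℕ a <ᵇ toℕ b) r s)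

leHead : ∀ {n} → Fin n → List (Fin n) → Bool
leHead a []       = true
leHead a (b ∷ bs) = toℕ a ≤ᵇ toℕ b

rowWeak-∷ : ∀ {n} (a : Fin n) as → rowWeak (a ∷ as) ≡ leHead a as ∧ rowWeak as
rowWeak-∷ a []       = ≡.refl
rowWeak-∷ a (b ∷ as) = ≡.refl

extend : ∀ {n} → List (Fin n) → ℕ → List (Fin (suc n))
extend {n} row c = map inject₁ row ++ replicate c (fromℕ n)

leHead-inject₁ : ∀ {n} (b : Fin n) row c → leHead (inject₁ b) (extend row c) ≡ leHead b row
leHead-inject₁ {n} b []        zero    = ≡.refl
leHead-inject₁ {n} b []        (suc c) rewrite toℕ-inject₁ b | toℕ-fromℕ n = ≤⇒≤ᵇ≡true (ℕ.<⇒≤ (toℕ<n b))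
leHead-inject₁ {n} b (d ∷ row) c       rewrite toℕ-inject₁ b | toℕ-inject₁ d = ≡.refl

leHead-fromℕ : ∀ n c → leHead (fromℕ n) (extend {n} [] c) ≡ true
leHead-fromℕ n zero    = ≡.refl
leHead-fromℕ n (suc c) = ≤⇒≤ᵇ≡true (ℕ.≤-refl {toℕ (fromℕ n)})

leHead-fromℕ-inject₁ : ∀ {n} (d : Fin n) row → leHead (fromℕ n) (inject₁ d ∷ row) ≡ false
leHead-fromℕ-inject₁ {n} d row rewrite toℕ-fromℕ n | toℕ-inject₁ d = >⇒≤ᵇ≡false (toℕ<n d)

≤ᵇ≡<ᵇsuc : ∀ m n → (m ≤ᵇ n) ≡ (m <ᵇ suc n)
≤ᵇ≡<ᵇsuc zero    n = ≡.refl
≤ᵇ≡<ᵇsuc (suc m) n = ≡.refl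

colPair-[] : ∀ {n} (p : List (Fin n)) → colPair p [] ≡ true
colPair-[] []      = ≡.refl
colPair-[] (_ ∷ _) = ≡.refl

-- Nothing can stand below the largest letter, so the whole lower row has to fit under the small
-- letters of the upper one. There its own largest letters are automatically admissible, and only
-- the small letters remain to be compared.
colPair-extend : ∀ {n} (p : List (Fin n)) c row d → length row ℕ.+ d ≤ length p ℕ.+ c →
  colPair (extend p c) (extend row d) ≡ (length row ℕ.+ d ≤ᵇ length p) ∧ colPair p row
colPair-extend     []      c       []        zero    _ = colPair-[] (extend [] c)
colPair-extend {n} []      (suc c) []        (suc d) _
  rewrite ≤⇒<ᵇ≡false (ℕ.≤-refl {toℕ (fromℕ n)}) = ≡.refl
colPair-extend {n} []      (suc c) (b ∷ row) d       _
  rewrite toℕ-fromℕ n | toℕ-inject₁ b | ≤⇒<ᵇ≡false (ℕ.<⇒≤ (toℕ<n b)) = ≡.refl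
colPair-extend     (a ∷ p) c       []        zero    _ = ≡.refl
colPair-extend {n} (a ∷ p) c       []        (suc d) (s≤s le)
  rewrite toℕ-fromℕ n | toℕ-inject₁ a | <⇒<ᵇ≡true (toℕ<n a) = ≡.trans (colPair-extend p c [] d le)
    (≡.cong₂ _∧_ (≤ᵇ≡<ᵇsuc d (length p)) (colPair-[] p))
colPair-extend     (a ∷ p) c       (b ∷ row) d       (s≤s le)
  rewrite toℕ-inject₁ a | toℕ-inject₁ b | colPair-extend p c row d le = begin
    A ∧ (L ∧ C)          ≡⟨ ≡.sym (∧-assoc A L C) ⟩
    (A ∧ L) ∧ C          ≡⟨ ≡.cong (_∧ C) (∧-comm A L) ⟩
    (L ∧ A) ∧ C          ≡⟨ ∧-assoc L A C ⟩
    L ∧ (A ∧ C)          ≡⟨ ≡.cong (_∧ (A ∧ C)) (≤ᵇ≡<ᵇsuc (length row ℕ.+ d) (length p)) ⟩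
    (length row ℕ.+ d <ᵇ suc (length p)) ∧ (A ∧ C) ∎
  where
  open ≡.≡-Reasoning
  A = toℕ a <ᵇ toℕ b
  L = length row ℕ.+ d ≤ᵇ length p
  C = colPair p row

-- Two consecutive rows of a Gelfand-Tsetlin pattern; the second list has one part fewer.
data Interlace : List ℕ → List ℕ → Set where
  [-] : ∀ {r} → Interlace [ r ] []
  _∷_ : ∀ {r s k λs μs} → s ≤ k × k ≤ r → Interlace (s ∷ λs) μs → Interlace (r ∷ s ∷ λs) (k ∷ μs)

lastPart : List ℕ → ℕ
lastPart []           = 0
lastPart (r ∷ [])     = r
lastPart (r ∷ s ∷ λs) = lastPart (s ∷ λs)

interlace-length : ∀ {r λs μs} → Interlace (r ∷ λs) μs → length μs ≡ length λs
interlace-length [-]     = ≡.refl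
interlace-length (_ ∷ i) = ≡.cong suc (interlace-length i)

interlace-decreasing : ∀ {λs μs} → Interlace λs μs → Linked _≥_ μs
interlace-decreasing [-]                        = []
interlace-decreasing (_ ∷ [-])                  = [-]
interlace-decreasing ((s≤k , _) ∷ i@((_ , k′≤s) ∷ _)) = ℕ.≤-trans k′≤s s≤k ∷ interlace-decreasing i

interlace-lastPart : ∀ {λs μs} → Interlace λs μs → Linked _≥_ λs → All (lastPart λs ≤_) μs
interlace-lastPart [-]             _       = []
interlace-lastPart ((s≤k , _) ∷ i) (_ ∷ d) = ℕ.≤-trans (lastPart≤ d) s≤k ∷ interlace-lastPart i d
  where
  lastPart≤ : ∀ {s λs} → Linked _≥_ (s ∷ λs) → lastPart (s ∷ λs) ≤ s
  lastPart≤ [-]          = ℕ.≤-refl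
  lastPart≤ (p ∷ d@[-])  = p
  lastPart≤ (p ∷ d@(_ ∷ _)) = ℕ.≤-trans (lastPart≤ d) p

-- Branching of Schur polynomials and the bialternant formula

module Schur {c ℓ : Level} (R : CommutativeRing c ℓ) where
  open CommutativeRing R hiding (zero)
  open WithRing R
  open import Algebra.Definitions.RawSemiring (Semiring.rawSemiring semiring) using (_^_)
  open IntegerSolver R
  open Sums R
  open Determinants R
  open Alternating
  open Multilinear R
  open Algebra.Properties.Ring ring
  open Relation.Binary.Reasoning.Setoid setoid

  rowWeight : ∀ {n} → (Fin n → Carrier) → List (Fin n) → Carrier
  rowWeight x row = Π (map x row)

  weight : ∀ {n} → (Fin n → Carrier) → List (List (Fin n)) → Carrier
  weight x t = Π (map (rowWeight x) t)

  schurPolynomial : ∀ n → (Fin n → Carrier) → List ℕ → Carrier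
  schurPolynomial n x λs = ∑ (SSYT n λs) (weight x)

  ∑-tableaux : ∀ n → (Fin n → Carrier) → List ℕ → (List (List (Fin n)) → Bool) → Carrier
  ∑-tableaux n x λs p = ∑ (tableaux n λs) (λ t → when (p t) (weight x t))

  -- The tableaux of shape λs that can be placed below a fixed row. Column strictness relates
  -- neighbouring rows only, so with this function the sum over tableaux can be carried out row by
  -- row.
  schurBelow : ∀ n → (Fin n → Carrier) → List (Fin n) → List ℕ → Carrier
  schurBelow n x row λs = ∑-tableaux n x λs (λ t → all rowWeak t ∧ colStrict (row ∷ t))

  when-0# : ∀ b → when b 0# ≈ 0#
  when-0# true  = refl
  when-0# false = refl

  ∑-weakRows : ∀ n → ℕ → (List (Fin n) → Carrier) → Carrier
  ∑-weakRows n r f = ∑ (allLists (allFin n) r) (λ row → when (rowWeak row) (f row))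

  ∑-weakRows-cong : ∀ n r {f g} → (∀ row → length row ≡ r → f row ≈ g row) → ∑-weakRows n r f ≈ ∑-weakRows n r g
  ∑-weakRows-cong n r h = ∑-cong∈ (allLists (allFin n) r) (λ {row} row∈ →
    when-cong (rowWeak row) (h row (proj₁ (∈-allLists⁻ r row∈))))

  ∑-weakRows-zero : ∀ n r {f} → (∀ row → length row ≡ r → f row ≈ 0#) → ∑-weakRows n r f ≈ 0#
  ∑-weakRows-zero n r h = trans (∑-weakRows-cong n r h)
    (∑-zero (allLists (allFin n) r) (λ row → when-0# (rowWeak row)))

  when-*ˡ : ∀ b k a → k * when b a ≈ when b (k * a)
  when-*ˡ true  k a = refl
  when-*ˡ false k a = zeroʳ k

  ∑-weakRows-*ˡ : ∀ n r k f → ∑-weakRows n r (λ row → k * f row) ≈ k * ∑-weakRows n r f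
  ∑-weakRows-*ˡ n r k f = trans
    (∑-cong (allLists (allFin n) r) (λ row → sym (when-*ˡ (rowWeak row) k (f row))))
    (∑-*ˡ k (allLists (allFin n) r) _)

  ∑-allLists-suc : ∀ {a} {A : Set a} (xs : List A) k (f : List A → Carrier) →
    ∑ (allLists xs (suc k)) f ≈ ∑ xs (λ a → ∑ (allLists xs k) (f ∘ (a ∷_)))
  ∑-allLists-suc xs k f = trans (∑-concatMap _ xs f) (∑-cong xs (λ a → ∑-map (a ∷_) (allLists xs k) f))

  ∑-weakRows-suc : ∀ n r f → ∑-weakRows n (suc r) f
    ≈ ∑ (allFin n) (λ a → ∑-weakRows n r (λ row → when (leHead a row) (f (a ∷ row))))
  ∑-weakRows-suc n r f = trans (∑-allLists-suc (allFin n) r _) (∑-cong (allFin n) (λ a →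
    ∑-cong (allLists (allFin n) r) (λ row → reflexive (≡.trans
      (≡.cong (λ b → when b (f (a ∷ row))) (≡.trans (rowWeak-∷ a row) (∧-comm (leHead a row) (rowWeak row))))
      (when-∧ (rowWeak row) (leHead a row) (f (a ∷ row)))))))

  ∑-tabulate-last : ∀ {a} {A : Set a} n (h : Fin (suc n) → A) (g : A → Carrier) →
    ∑ (tabulate h) g ≈ ∑ (tabulate (h ∘ inject₁)) g + g (h (fromℕ n))
  ∑-tabulate-last zero    h g = +-comm _ _
  ∑-tabulate-last (suc n) h g = trans (+-congˡ (∑-tabulate-last n (h ∘ fsuc) g)) (sym (+-assoc _ _ _))

  ∑-allFin-suc : ∀ n (g : Fin (suc n) → Carrier) →
    ∑ (allFin (suc n)) g ≈ ∑ (allFin n) (g ∘ inject₁) + g (fromℕ n)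
  ∑-allFin-suc n g = trans (∑-tabulate-last n id g) (+-congʳ (trans
    (reflexive (≡.cong (λ ys → ∑ ys g) (≡.sym (map-tabulate id inject₁)))) (∑-map inject₁ (allFin n) g)))

  ∑-splits-suc : ∀ r (f : ℕ × ℕ → Carrier) → ∑ (splits (suc r)) f ≈ f (0 , suc r) + ∑ (splits r) (f ∘ map₁ suc)
  ∑-splits-suc r f = +-congˡ (∑-map (map₁ suc) (splits r) f)

  -- A weak row over n + 1 letters is a weak row over n letters followed by copies of the largest letter.
  ∑-weakRows-extend : ∀ n r (f : List (Fin (suc n)) → Carrier) →
    ∑-weakRows (suc n) r f ≈ ∑ (splits r) (λ (k , c) → ∑-weakRows n k (λ row → f (extend row c)))
  ∑-weakRows-extend n zero    f = sym (+-identityʳ _)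
  ∑-weakRows-extend n (suc r) f = begin
    ∑-weakRows (suc n) (suc r) f
      ≈⟨ ∑-weakRows-suc (suc n) r f ⟩
    ∑ (allFin (suc n)) (λ a → ∑-weakRows (suc n) r (F a))
      ≈⟨ ∑-allFin-suc n _ ⟩
    ∑ (allFin n) (λ b → ∑-weakRows (suc n) r (F (inject₁ b))) + ∑-weakRows (suc n) r (F (fromℕ n))
      ≈⟨ +-cong small large ⟩
    ∑ (splits r) (λ (k , c) → ∑-weakRows n (suc k) (λ row → f (extend row c)))
      + ∑-weakRows n 0 (λ row → f (extend row (suc r)))
      ≈⟨ +-comm _ _ ⟩
    ∑-weakRows n 0 (λ row → f (extend row (suc r)))
      + ∑ (splits r) (λ (k , c) → ∑-weakRows n (suc k) (λ row → f (extend row c)))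
      ≈⟨ sym (∑-splits-suc r _) ⟩
    ∑ (splits (suc r)) (λ (k , c) → ∑-weakRows n k (λ row → f (extend row c))) ∎
    where
    F : Fin (suc n) → List (Fin (suc n)) → Carrier
    F a row = when (leHead a row) (f (a ∷ row))

    small : ∑ (allFin n) (λ b → ∑-weakRows (suc n) r (F (inject₁ b)))
              ≈ ∑ (splits r) (λ (k , c) → ∑-weakRows n (suc k) (λ row → f (extend row c)))
    small = begin
      ∑ (allFin n) (λ b → ∑-weakRows (suc n) r (F (inject₁ b)))
        ≈⟨ ∑-cong (allFin n) (λ b → trans (∑-weakRows-extend n r (F (inject₁ b)))
             (∑-cong (splits r) (λ (k , c) → ∑-weakRows-cong n k (λ row _ → reflexive
               (≡.cong (λ t → when t (f (extend (b ∷ row) c))) (leHead-inject₁ b row c)))))) ⟩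
      ∑ (allFin n) (λ b → ∑ (splits r) (λ (k , c) → ∑-weakRows n k (λ row → when (leHead b row) (f (extend (b ∷ row) c)))))
        ≈⟨ ∑-swap (allFin n) (splits r) _ ⟩
      ∑ (splits r) (λ (k , c) → ∑ (allFin n) (λ b → ∑-weakRows n k (λ row → when (leHead b row) (f (extend (b ∷ row) c)))))
        ≈⟨ ∑-cong (splits r) (λ (k , c) → sym (∑-weakRows-suc n k (λ row → f (extend row c)))) ⟩
      ∑ (splits r) (λ (k , c) → ∑-weakRows n (suc k) (λ row → f (extend row c))) ∎

    large-suc : ∀ k c → ∑-weakRows n (suc k) (λ row → F (fromℕ n) (extend row c)) ≈ 0#
    large-suc k c = ∑-weakRows-zero n (suc k) λ where
      (d ∷ row) _ → reflexive (≡.cong (λ t → when t (f (fromℕ n ∷ extend (d ∷ row) c)))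
        (leHead-fromℕ-inject₁ d (extend row c)))

    large-0 : ∀ c → ∑-weakRows n 0 (λ row → F (fromℕ n) (extend row c)) ≈ ∑-weakRows n 0 (λ row → f (extend row (suc c)))
    large-0 c = +-congʳ (reflexive (≡.cong (λ t → when t (f (fromℕ n ∷ replicate c (fromℕ n)))) (leHead-fromℕ n c)))

    large-splits : ∀ r → ∑ (splits r) (λ (k , c) → ∑-weakRows n k (λ row → F (fromℕ n) (extend row c)))
                         ≈ ∑-weakRows n 0 (λ row → f (extend row (suc r)))
    large-splits zero    = trans (+-identityʳ _) (large-0 0)
    large-splits (suc r) = trans (∑-splits-suc r _) (trans
      (+-cong (large-0 (suc r)) (∑-zero (splits r) (λ (k , c) → large-suc k c))) (+-identityʳ _))

    large : ∑-weakRows (suc n) r (F (fromℕ n)) ≈ ∑-weakRows n 0 (λ row → f (extend row (suc r)))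
    large = trans (∑-weakRows-extend n r (F (fromℕ n))) (large-splits r)

  ∑-tableaux-∷ : ∀ n x r λs (p : List (List (Fin n)) → Bool) →
    ∑-tableaux n x (r ∷ λs) p ≈ ∑ (allLists (allFin n) r) (λ row → rowWeight x row * ∑-tableaux n x λs (p ∘ (row ∷_)))
  ∑-tableaux-∷ n x r λs p = trans (∑-concatMap _ (allLists (allFin n) r) _) (∑-cong (allLists (allFin n) r) (λ row →
    trans (∑-map (row ∷_) (tableaux n λs) _) (trans
      (∑-cong (tableaux n λs) (λ t → sym (when-*ˡ (p (row ∷ t)) (rowWeight x row) (weight x t))))
      (∑-*ˡ (rowWeight x row) (tableaux n λs) _))))

  ∑-tableaux-when : ∀ n x λs b (p : List (List (Fin n)) → Bool) →
    ∑-tableaux n x λs (λ t → b ∧ p t) ≈ when b (∑-tableaux n x λs p)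
  ∑-tableaux-when n x λs true  p = refl
  ∑-tableaux-when n x λs false p = ∑-zero (tableaux n λs) (λ _ → refl)

  ∑-tableaux-cong : ∀ n x λs {p p′ : List (List (Fin n)) → Bool} → (∀ t → p t ≡ p′ t) →
    ∑-tableaux n x λs p ≈ ∑-tableaux n x λs p′
  ∑-tableaux-cong n x λs e = ∑-cong (tableaux n λs) (λ t → reflexive (≡.cong (λ b → when b (weight x t)) (e t)))

  schurBelow-∷ : ∀ n x row r λs → schurBelow n x row (r ∷ λs)
    ≈ ∑-weakRows n r (λ row′ → when (colPair row row′) (rowWeight x row′ * schurBelow n x row′ λs))
  schurBelow-∷ n x row r λs = trans (∑-tableaux-∷ n x r λs _) (∑-cong (allLists (allFin n) r) (λ row′ → begin
    rowWeight x row′ * ∑-tableaux n x λs (λ t → (rowWeak row′ ∧ all rowWeak t) ∧ (colPair row row′ ∧ colStrict (row′ ∷ t)))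
      ≈⟨ *-congˡ (∑-tableaux-cong n x λs (λ t → rearrange (rowWeak row′) (all rowWeak t) (colPair row row′) _)) ⟩
    rowWeight x row′ * ∑-tableaux n x λs (λ t → rowWeak row′ ∧ (colPair row row′ ∧ (all rowWeak t ∧ colStrict (row′ ∷ t))))
      ≈⟨ *-congˡ (trans (∑-tableaux-when n x λs (rowWeak row′) _)
           (when-cong (rowWeak row′) (∑-tableaux-when n x λs (colPair row row′) _))) ⟩
    rowWeight x row′ * when (rowWeak row′) (when (colPair row row′) (schurBelow n x row′ λs))
      ≈⟨ trans (when-*ˡ (rowWeak row′) _ _) (when-cong (rowWeak row′) (when-*ˡ (colPair row row′) _ _)) ⟩
    when (rowWeak row′) (when (colPair row row′) (rowWeight x row′ * schurBelow n x row′ λs)) ∎))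
    where
    rearrange : ∀ a b c d → (a ∧ b) ∧ (c ∧ d) ≡ a ∧ (c ∧ (b ∧ d))
    rearrange false b c     d = ≡.refl
    rearrange true  b false d = ∧-zeroʳ b
    rearrange true  b true  d = ≡.refl

  schur-[] : ∀ n x → schurPolynomial n x [] ≈ 1#
  schur-[] n x = +-identityʳ 1#

  schur-∷ : ∀ n x r λs →
    schurPolynomial n x (r ∷ λs) ≈ ∑-weakRows n r (λ row → rowWeight x row * schurBelow n x row λs)
  schur-∷ n x r λs = trans (∑-filterᵇ isSSYT (tableaux n (r ∷ λs)) (weight x)) (trans
    (∑-tableaux-∷ n x r λs isSSYT) (∑-cong (allLists (allFin n) r) (λ row → trans
      (*-congˡ (trans
        (∑-tableaux-cong n x λs (λ t → ∧-assoc (rowWeak row) (all rowWeak t) (colStrict (row ∷ t))))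
        (∑-tableaux-when n x λs (rowWeak row) _)))
      (when-*ˡ (rowWeak row) _ _))))

  -- Here and in `branch`, g(μ) is summed with the weight z^(|λ| - |μ|) over all μ for which λ / μ
  -- is a horizontal strip. The number s is the part of μ chosen just before, and r ≤ s is the
  -- condition that no two cells of the strip share a column.
  branchBelow : Carrier → ℕ → List ℕ → (List ℕ → Carrier) → Carrier
  branchBelow z s []       g = g []
  branchBelow z s (r ∷ λs) g = when (r ≤ᵇ s) (∑ (splits r) (λ (k , c) → z ^ c * branchBelow z k λs (g ∘ (k ∷_))))

  branch : Carrier → List ℕ → (List ℕ → Carrier) → Carrier
  branch z []       g = g []
  branch z (r ∷ λs) g = ∑ (splits r) (λ (k , c) → z ^ c * branchBelow z k λs (g ∘ (k ∷_)))

  branchBelow-cong : ∀ z s λs {g h} → (∀ μ → g μ ≈ h μ) → branchBelow z s λs g ≈ branchBelow z s λs h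
  branchBelow-cong z s []       e = e []
  branchBelow-cong z s (r ∷ λs) e = when-cong (r ≤ᵇ s) (∑-cong (splits r) (λ (k , c) →
    *-congˡ (branchBelow-cong z k λs (λ μ → e (k ∷ μ)))))

  branchBelow-linear : ∀ {a} {A : Set a} z s λs (xs : List A) (f : A → Carrier) (g : A → List ℕ → Carrier) →
    branchBelow z s λs (λ μ → ∑ xs (λ a → f a * g a μ)) ≈ ∑ xs (λ a → f a * branchBelow z s λs (g a))
  branchBelow-linear z s []       xs f g = refl
  branchBelow-linear z s (r ∷ λs) xs f g = begin
    when (r ≤ᵇ s) (∑ (splits r) (λ (k , c) → z ^ c * branchBelow z k λs (λ μ → ∑ xs (λ a → f a * g a (k ∷ μ)))))
      ≈⟨ when-cong (r ≤ᵇ s) (∑-cong (splits r) (λ (k , c) → trans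
           (*-congˡ (branchBelow-linear z k λs xs f (λ a → g a ∘ (k ∷_)))) (trans (sym (∑-*ˡ _ xs _))
           (∑-cong xs (λ a → solve 3 (λ a b d → a :* (b :* d) := b :* (a :* d)) refl _ _ _))))) ⟩
    when (r ≤ᵇ s) (∑ (splits r) (λ (k , c) → ∑ xs (λ a → f a * (z ^ c * branchBelow z k λs (g a ∘ (k ∷_))))))
      ≈⟨ when-cong (r ≤ᵇ s) (trans (∑-swap (splits r) xs _) (∑-cong xs (λ a → ∑-*ˡ (f a) (splits r) _))) ⟩
    when (r ≤ᵇ s) (∑ xs (λ a → f a * branch z (r ∷ λs) (g a)))
      ≈⟨ sym (∑-when (r ≤ᵇ s) xs _) ⟩
    ∑ xs (λ a → when (r ≤ᵇ s) (f a * branch z (r ∷ λs) (g a)))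
      ≈⟨ ∑-cong xs (λ a → sym (when-*ˡ (r ≤ᵇ s) (f a) _)) ⟩
    ∑ xs (λ a → f a * branchBelow z s (r ∷ λs) (g a)) ∎

  when-*ʳ : ∀ b k a → when b (a * k) ≈ when b a * k
  when-*ʳ true  k a = refl
  when-*ʳ false k a = sym (zeroˡ k)

  belowWeight : ∀ {n} → (Fin n → Carrier) → List (Fin n) → List (Fin n) → Carrier
  belowWeight x p row = when (rowWeak row) (when (colPair p row) (rowWeight x row))

  ∑-weakRows-below : ∀ n x p k (f : List (Fin n) → Carrier) →
    ∑-weakRows n k (λ row → when (colPair p row) (rowWeight x row * f row))
      ≈ ∑ (allLists (allFin n) k) (λ row → belowWeight x p row * f row)
  ∑-weakRows-below n x p k f = ∑-cong (allLists (allFin n) k) (λ row → trans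
    (when-cong (rowWeak row) (when-*ʳ (colPair p row) (f row) _)) (when-*ʳ (rowWeak row) (f row) _))

  branchBelow-schurBelow : ∀ n x z s p k λs →
    branchBelow z s λs (λ μ → schurBelow n x p (k ∷ μ))
      ≈ ∑-weakRows n k (λ row → when (colPair p row) (rowWeight x row * branchBelow z s λs (schurBelow n x row)))
  branchBelow-schurBelow n x z s p k λs = trans
    (branchBelow-cong z s λs (λ μ → trans (schurBelow-∷ n x p k μ) (∑-weakRows-below n x p k _)))
    (trans (branchBelow-linear z s λs (allLists (allFin n) k) (belowWeight x p) _)
      (sym (∑-weakRows-below n x p k _)))

  branchBelow-schur : ∀ n x z s k λs →
    branchBelow z s λs (λ μ → schurPolynomial n x (k ∷ μ))
      ≈ ∑-weakRows n k (λ row → rowWeight x row * branchBelow z s λs (schurBelow n x row))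
  branchBelow-schur n x z s k λs = trans
    (branchBelow-cong z s λs (λ μ → trans (schur-∷ n x k μ)
      (∑-cong (allLists (allFin n) k) (λ row → when-*ʳ (rowWeak row) _ _))))
    (trans (branchBelow-linear z s λs (allLists (allFin n) k) (λ row → when (rowWeak row) (rowWeight x row)) _)
      (∑-cong (allLists (allFin n) k) (λ row → sym (when-*ʳ (rowWeak row) _ _))))

  rowWeight-extend : ∀ {n} (x : Fin (suc n) → Carrier) row c →
    rowWeight x (extend row c) ≈ x (fromℕ n) ^ c * rowWeight (x ∘ inject₁) row
  rowWeight-extend x []        zero    = sym (*-identityˡ _)
  rowWeight-extend x []        (suc c) = trans (*-congˡ (rowWeight-extend x [] c)) (sym (*-assoc _ _ _))
  rowWeight-extend x (a ∷ row) c       = trans (*-congˡ (rowWeight-extend x row c))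
    (solve 3 (λ a b d → a :* (b :* d) := b :* (a :* d)) refl _ _ _)

  -- `colPair-extend` separates the conditions on the next row: its total length is at most the
  -- length of p, which is the bound in `branchBelow`, and its small letters fit below p.
  schurBelow-branch : ∀ n x p c λs → Linked _≥_ (length p ℕ.+ c ∷ λs) →
    schurBelow (suc n) x (extend p c) λs ≈ branchBelow (x (fromℕ n)) (length p) λs (schurBelow n (x ∘ inject₁) p)
  schurBelow-branch n x p c []       _         = refl
  schurBelow-branch n x p c (r ∷ λs) (r≤ ∷ dec) = begin
    schurBelow (suc n) x (extend p c) (r ∷ λs)
      ≈⟨ trans (schurBelow-∷ (suc n) x (extend p c) r λs) (∑-weakRows-extend n r _) ⟩
    ∑ (splits r) (λ (k , d) → ∑-weakRows n k (λ row → when (colPair (extend p c) (extend row d))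
      (rowWeight x (extend row d) * schurBelow (suc n) x (extend row d) λs)))
      ≈⟨ ∑-cong∈ (splits r) (λ {(k , d)} kd∈ → term k d (∈-splits r kd∈)) ⟩
    ∑ (splits r) (λ (k , d) → when (r ≤ᵇ length p) (z ^ d * branchBelow z k λs (λ μ → schurBelow n x′ p (k ∷ μ))))
      ≈⟨ ∑-when (r ≤ᵇ length p) (splits r) _ ⟩
    branchBelow z (length p) (r ∷ λs) (schurBelow n x′ p) ∎
    where
    z  = x (fromℕ n)
    x′ = x ∘ inject₁
    term : ∀ k d → k ℕ.+ d ≡ r →
      ∑-weakRows n k (λ row → when (colPair (extend p c) (extend row d))
        (rowWeight x (extend row d) * schurBelow (suc n) x (extend row d) λs))
      ≈ when (r ≤ᵇ length p) (z ^ d * branchBelow z k λs (λ μ → schurBelow n x′ p (k ∷ μ)))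
    term k d ≡.refl = begin
      ∑-weakRows n k (λ row → when (colPair (extend p c) (extend row d))
        (rowWeight x (extend row d) * schurBelow (suc n) x (extend row d) λs))
        ≈⟨ ∑-weakRows-cong n k entry ⟩
      ∑-weakRows n k (λ row → when (r ≤ᵇ length p) (z ^ d * f row))
        ≈⟨ ∑-weakRows-cong n k (λ row _ → sym (when-*ʳ′ (r ≤ᵇ length p) _)) ⟩
      ∑-weakRows n k (λ row → when (r ≤ᵇ length p) (z ^ d) * f row)
        ≈⟨ trans (∑-weakRows-*ˡ n k _ f) (when-*ʳ′ (r ≤ᵇ length p) _) ⟩
      when (r ≤ᵇ length p) (z ^ d * ∑-weakRows n k f)
        ≈⟨ when-cong (r ≤ᵇ length p) (*-congˡ (sym (branchBelow-schurBelow n x′ z k p k λs))) ⟩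
      when (r ≤ᵇ length p) (z ^ d * branchBelow z k λs (λ μ → schurBelow n x′ p (k ∷ μ))) ∎
      where
      f : List (Fin n) → Carrier
      f row = when (colPair p row) (rowWeight x′ row * branchBelow z k λs (schurBelow n x′ row))
      when-*ʳ′ : ∀ b a → when b (z ^ d) * a ≈ when b (z ^ d * a)
      when-*ʳ′ b a = sym (when-*ʳ b a (z ^ d))
      entry : ∀ row → length row ≡ k →
        when (colPair (extend p c) (extend row d)) (rowWeight x (extend row d) * schurBelow (suc n) x (extend row d) λs)
          ≈ when (r ≤ᵇ length p) (z ^ d * f row)
      entry row ≡.refl = begin
        when (colPair (extend p c) (extend row d)) (rowWeight x (extend row d) * schurBelow (suc n) x (extend row d) λs)
          ≡⟨ ≡.trans (≡.cong (λ b → when b _) (colPair-extend p c row d r≤)) (when-∧ (r ≤ᵇ length p) (colPair p row) _) ⟩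
        when (r ≤ᵇ length p) (when (colPair p row) (rowWeight x (extend row d) * schurBelow (suc n) x (extend row d) λs))
          ≈⟨ when-cong (r ≤ᵇ length p) (trans (when-cong (colPair p row) (trans
               (*-cong (rowWeight-extend x row d) (schurBelow-branch n x row d λs dec)) (*-assoc _ _ _)))
               (sym (when-*ˡ (colPair p row) (z ^ d) _))) ⟩
        when (r ≤ᵇ length p) (z ^ d * f row) ∎

  schur-branch : ∀ n x λs → Linked _≥_ λs →
    schurPolynomial (suc n) x λs ≈ branch (x (fromℕ n)) λs (schurPolynomial n (x ∘ inject₁))
  schur-branch n x []       _   = refl
  schur-branch n x (r ∷ λs) dec = begin
    schurPolynomial (suc n) x (r ∷ λs)
      ≈⟨ trans (schur-∷ (suc n) x r λs) (∑-weakRows-extend n r _) ⟩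
    ∑ (splits r) (λ (k , d) → ∑-weakRows n k (λ row → rowWeight x (extend row d) * schurBelow (suc n) x (extend row d) λs))
      ≈⟨ ∑-cong∈ (splits r) (λ {(k , d)} kd∈ → term k d (∈-splits r kd∈)) ⟩
    branch z (r ∷ λs) (schurPolynomial n x′) ∎
    where
    z  = x (fromℕ n)
    x′ = x ∘ inject₁
    term : ∀ k d → k ℕ.+ d ≡ r →
      ∑-weakRows n k (λ row → rowWeight x (extend row d) * schurBelow (suc n) x (extend row d) λs)
      ≈ z ^ d * branchBelow z k λs (λ μ → schurPolynomial n x′ (k ∷ μ))
    term k d ≡.refl = trans
      (∑-weakRows-cong n k (λ { row ≡.refl → trans
        (*-cong (rowWeight-extend x row d) (schurBelow-branch n x row d λs dec)) (*-assoc _ _ _) }))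
      (trans (∑-weakRows-*ˡ n k (z ^ d) _) (*-congˡ (sym (branchBelow-schur n x′ z k k λs))))

  -- Letters increase strictly down the first column, so fewer than n - a nonempty rows fit below
  -- the letter a.
  schurBelow-vanish : ∀ n x a row λs → All (0 <_) λs → n ≤ length λs ℕ.+ toℕ a → schurBelow n x (a ∷ row) λs ≈ 0#
  schurBelow-vanish n x a row []           []       le = ⊥-elim (ℕ.<⇒≱ (toℕ<n a) le)
  schurBelow-vanish n x a row (suc r ∷ λs) (_ ∷ ps) le = trans (schurBelow-∷ n x (a ∷ row) (suc r) λs)
    (∑-weakRows-zero n (suc r) λ where
      (b ∷ row′) _ → vanish b row′ (ℕ.<-≤-connex (toℕ a) (toℕ b)))
    where
    vanish : ∀ b row′ → toℕ a < toℕ b ⊎ toℕ b ≤ toℕ a →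
      when (colPair (a ∷ row) (b ∷ row′)) (rowWeight x (b ∷ row′) * schurBelow n x (b ∷ row′) λs) ≈ 0#
    vanish b row′ (inj₂ b≤a) rewrite ≤⇒<ᵇ≡false b≤a = refl
    vanish b row′ (inj₁ a<b) = trans (when-cong (colPair (a ∷ row) (b ∷ row′)) (trans
      (*-congˡ (schurBelow-vanish n x b row′ λs ps
        (ℕ.≤-trans le (ℕ.≤-trans (ℕ.≤-reflexive (≡.sym (ℕ.+-suc (length λs) (toℕ a)))) (ℕ.+-monoʳ-≤ (length λs) a<b)))))
      (zeroʳ _))) (when-0# (colPair (a ∷ row) (b ∷ row′)))

  schur-vanish : ∀ n x λs → All (0 <_) λs → length λs ≡ suc n → schurPolynomial n x λs ≈ 0#
  schur-vanish n x (suc r ∷ λs) (_ ∷ ps) e = trans (schur-∷ n x (suc r) λs) (∑-weakRows-zero n (suc r) λ where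
    (a ∷ row) _ → trans (*-congˡ (schurBelow-vanish n x a row λs ps
      (ℕ.≤-trans (ℕ.≤-reflexive (≡.sym (ℕ.suc-injective e))) (ℕ.m≤m+n _ _)))) (zeroʳ _))

  schurBelow-0 : ∀ n x row λs → schurBelow n x row (0 ∷ λs) ≈ schurBelow n x [] λs
  schurBelow-0 n x row λs = trans (schurBelow-∷ n x row 0 λs) (trans (+-identityʳ _) (trans
    (reflexive (≡.cong (λ b → when b (1# * schurBelow n x [] λs)) (colPair-[] row))) (*-identityˡ _)))

  schur-0 : ∀ n x λs → schurPolynomial n x (0 ∷ λs) ≈ schurBelow n x [] λs
  schur-0 n x λs = trans (schur-∷ n x 0 λs) (trans (+-identityʳ _) (*-identityˡ _))

  schurBelow-filter : ∀ n x row λs → Linked _≥_ λs → schurBelow n x row (filterᵇ (1 ≤ᵇ_) λs) ≈ schurBelow n x row λs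
  schurBelow-filter n x row []                 _            = refl
  schurBelow-filter n x row (zero ∷ [])        _            = sym (schurBelow-0 n x row [])
  schurBelow-filter n x row (zero ∷ zero ∷ λs) (_ ∷ dec)    = trans
    (trans (schurBelow-filter n x row (zero ∷ λs) dec) (schurBelow-0 n x row λs))
    (sym (trans (schurBelow-0 n x row (0 ∷ λs)) (schurBelow-0 n x [] λs)))
  schurBelow-filter n x row (suc r ∷ [])       _            = refl
  schurBelow-filter n x row (suc r ∷ s ∷ λs)   (_ ∷ dec)    = trans
    (schurBelow-∷ n x row (suc r) (filterᵇ (1 ≤ᵇ_) (s ∷ λs)))
    (trans (∑-weakRows-cong n (suc r) (λ row′ _ → when-cong (colPair row row′)
        (*-congˡ (schurBelow-filter n x row′ (s ∷ λs) dec))))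
      (sym (schurBelow-∷ n x row (suc r) (s ∷ λs))))

  -- Empty rows do not affect tableaux. The bialternant formula needs as many parts as variables,
  -- hence zeros, whereas `fromFrob` discards them.
  schur-filter : ∀ n x λs → Linked _≥_ λs → schurPolynomial n x (filterᵇ (1 ≤ᵇ_) λs) ≈ schurPolynomial n x λs
  schur-filter n x []                 _         = refl
  schur-filter n x (zero ∷ λs)        dec       = trans (all-0 λs dec) (sym (schur-0 n x λs))
    where
    filter-0 : ∀ λs → Linked _≥_ (0 ∷ λs) → filterᵇ (1 ≤ᵇ_) λs ≡ []
    filter-0 []          _          = ≡.refl
    filter-0 (zero ∷ λs) (_ ∷ dec) = filter-0 λs dec
    all-0 : ∀ λs → Linked _≥_ (0 ∷ λs) → schurPolynomial n x (filterᵇ (1 ≤ᵇ_) λs) ≈ schurBelow n x [] λs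
    all-0 []          _          = refl
    all-0 (zero ∷ λs) (_ ∷ dec) = trans (all-0 λs dec) (sym (schurBelow-0 n x [] λs))
  schur-filter n x (suc r ∷ λs)       dec       = trans (schur-∷ n x (suc r) (filterᵇ (1 ≤ᵇ_) λs)) (trans
    (∑-weakRows-cong n (suc r) (λ row _ → *-congˡ (schurBelow-filter n x row λs (Linked.tail dec))))
    (sym (schur-∷ n x (suc r) λs)))

  schurBelow-∷ʳ0 : ∀ n x row λs → schurBelow n x row (λs ++ [ 0 ]) ≈ schurBelow n x row λs
  schurBelow-∷ʳ0 n x row []       = schurBelow-0 n x row []
  schurBelow-∷ʳ0 n x row (r ∷ λs) = trans (schurBelow-∷ n x row r (λs ++ [ 0 ])) (trans
    (∑-weakRows-cong n r (λ row′ _ → when-cong (colPair row row′) (*-congˡ (schurBelow-∷ʳ0 n x row′ λs))))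
    (sym (schurBelow-∷ n x row r λs)))

  schur-∷ʳ0 : ∀ n x λs → schurPolynomial n x (λs ++ [ 0 ]) ≈ schurPolynomial n x λs
  schur-∷ʳ0 n x []       = schur-0 n x []
  schur-∷ʳ0 n x (r ∷ λs) = trans (schur-∷ n x r (λs ++ [ 0 ])) (trans
    (∑-weakRows-cong n r (λ row _ → *-congˡ (schurBelow-∷ʳ0 n x row λs))) (sym (schur-∷ n x r λs)))

  -- The branching sum restricted to those μ whose last part is 0, which is dropped; the constant
  -- factor z ^ lastPart λs is left out.
  interlacing : Carrier → List ℕ → (List ℕ → Carrier) → Carrier
  interlacing z []           g = 0#
  interlacing z (r ∷ [])     g = g []
  interlacing z (r ∷ s ∷ λs) g =
    ∑ (splits r) (λ (k , c) → when (s ≤ᵇ k) (z ^ c) * interlacing z (s ∷ λs) (g ∘ (k ∷_)))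

  when-≤ᵇ : ∀ s k {a b} → (s ≤ k → a ≈ b) → when (s ≤ᵇ k) a ≈ when (s ≤ᵇ k) b
  when-≤ᵇ s k h with s ≤ᵇ k in e
  ... | true  = h (ℕ.≤ᵇ⇒≤ s k (≡.subst T (≡.sym e) _))
  ... | false = refl

  interlacing-cong : ∀ z λs {g h} → (∀ {μ} → Interlace λs μ → g μ ≈ h μ) → interlacing z λs g ≈ interlacing z λs h
  interlacing-cong z []           e = refl
  interlacing-cong z (r ∷ [])     e = e [-]
  interlacing-cong z (r ∷ s ∷ λs) e = ∑-cong∈ (splits r) (λ {(k , c)} kc∈ →
    trans (sym (when-*ʳ (s ≤ᵇ k) _ _)) (trans
      (when-≤ᵇ s k (λ s≤k → *-congˡ (interlacing-cong z (s ∷ λs) (λ i →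
        e ((s≤k , ℕ.≤-trans (ℕ.m≤m+n k c) (ℕ.≤-reflexive (∈-splits r kc∈))) ∷ i)))))
      (when-*ʳ (s ≤ᵇ k) _ _)))

  interlacing-*ˡ : ∀ a z λs g → interlacing z λs (λ μ → a * g μ) ≈ a * interlacing z λs g
  interlacing-*ˡ a z []           g = sym (zeroʳ a)
  interlacing-*ˡ a z (r ∷ [])     g = refl
  interlacing-*ˡ a z (r ∷ s ∷ λs) g = trans (∑-cong (splits r) (λ (k , c) → trans
    (*-congˡ (interlacing-*ˡ a z (s ∷ λs) (g ∘ (k ∷_))))
    (solve 3 (λ b a d → b :* (a :* d) := a :* (b :* d)) refl _ _ _))) (∑-*ˡ a (splits r) _)

  ∑-splits-0 : ∀ r (f : ℕ × ℕ → Carrier) → (∀ k c → suc k ≤ r → f (suc k , c) ≈ 0#) → ∑ (splits r) f ≈ f (0 , r)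
  ∑-splits-0 zero    f h = +-identityʳ _
  ∑-splits-0 (suc r) f h = trans (∑-splits-suc r f) (trans
    (+-congˡ (∑-zero∈ (splits r) (λ {(k , c)} kc∈ →
      h k c (s≤s (ℕ.≤-trans (ℕ.m≤m+n k c) (ℕ.≤-reflexive (∈-splits r kc∈)))))))
    (+-identityʳ _))

  -- For g a Schur polynomial in as many variables as μ has parts in `Interlace`, a further positive
  -- part makes g vanish, so only the last part 0 contributes. The premise states these two
  -- properties of g.
  branch-interlacing : ∀ z r λs g →
    (∀ {μ} → Interlace (r ∷ λs) μ →
      g (μ ++ [ 0 ]) ≈ g μ × (∀ k → suc k ≤ lastPart (r ∷ λs) → g (μ ++ [ suc k ]) ≈ 0#)) →
    branch z (r ∷ λs) g ≈ z ^ lastPart (r ∷ λs) * interlacing z (r ∷ λs) g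
  branch-interlacing z r []       g h = trans
    (∑-splits-0 r _ (λ k c k<r → trans (*-congˡ (proj₂ (h [-]) k k<r)) (zeroʳ _))) (*-congˡ (proj₁ (h [-])))
  branch-interlacing z r (s ∷ λs) g h = trans
    (∑-cong∈ (splits r) (λ {(k , c)} kc∈ → begin
      z ^ c * when (s ≤ᵇ k) (branch z (s ∷ λs) (g ∘ (k ∷_)))
        ≈⟨ when-*ˡ (s ≤ᵇ k) (z ^ c) _ ⟩
      when (s ≤ᵇ k) (z ^ c * branch z (s ∷ λs) (g ∘ (k ∷_)))
        ≈⟨ when-≤ᵇ s k (λ s≤k → *-congˡ (branch-interlacing z s λs (g ∘ (k ∷_)) (λ i →
             h ((s≤k , ℕ.≤-trans (ℕ.m≤m+n k c) (ℕ.≤-reflexive (∈-splits r kc∈))) ∷ i)))) ⟩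
      when (s ≤ᵇ k) (z ^ c * (Z * interlacing z (s ∷ λs) (g ∘ (k ∷_))))
        ≈⟨ when-*ʳ (s ≤ᵇ k) _ _ ⟩
      when (s ≤ᵇ k) (z ^ c) * (Z * interlacing z (s ∷ λs) (g ∘ (k ∷_)))
        ≈⟨ solve 3 (λ b a d → b :* (a :* d) := a :* (b :* d)) refl _ _ _ ⟩
      Z * (when (s ≤ᵇ k) (z ^ c) * interlacing z (s ∷ λs) (g ∘ (k ∷_))) ∎))
    (∑-*ˡ Z (splits r) _)
    where Z = z ^ lastPart (s ∷ λs)

  -- The geometric sum of z^(r-k) y^(k+N) over s ≤ k ≤ r; terms with k < s are kept with coefficient
  -- 0.
  columnPoly : Carrier → ℕ → ℕ → ℕ → Poly
  columnPoly z r s N = map (λ (k , c) → when (s ≤ᵇ k) (z ^ c) , k ℕ.+ N) (splits r)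

  evalPoly-columnPoly-0 : ∀ z r N y → evalPoly (columnPoly z (suc r) 0 N) y
    ≈ z ^ suc r * y ^ N + y * evalPoly (columnPoly z r 0 N) y
  evalPoly-columnPoly-0 z r N y = +-congˡ (trans (∑-map _ (map (map₁ suc) (splits r)) _) (trans
    (∑-map (map₁ suc) (splits r) _) (trans
    (∑-cong (splits r) (λ (k , c) → solve 3 (λ a y b → a :* (y :* b) := y :* (a :* b)) refl _ _ _))
    (trans (∑-*ˡ y (splits r) _) (*-congˡ (sym (∑-map _ (splits r) _)))))))

  evalPoly-columnPoly-suc : ∀ z r s N y → evalPoly (columnPoly z (suc r) (suc s) N) y
    ≈ y * evalPoly (columnPoly z r s N) y
  evalPoly-columnPoly-suc z r s N y = trans (+-cong (zeroˡ _) (trans (∑-map _ (map (map₁ suc) (splits r)) _) (trans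
    (∑-map (map₁ suc) (splits r) _) (trans
    (∑-cong (splits r) (λ (k , c) → trans
      (*-congʳ (reflexive (≡.cong (λ b → when b (z ^ c)) (≡.sym (≤ᵇ≡<ᵇsuc s k)))))
      (solve 3 (λ a y b → a :* (y :* b) := y :* (a :* b)) refl _ _ _)))
    (trans (∑-*ˡ y (splits r) _) (*-congˡ (sym (∑-map _ (splits r) _)))))))) (+-identityˡ _)

  columnPoly-geometric : ∀ z r s N y → s ≤ r →
    (y - z) * evalPoly (columnPoly z r s N) y ≈ y ^ (r ℕ.+ suc N) - z ^ (suc r ∸ s) * y ^ (s ℕ.+ N)
  columnPoly-geometric z zero    zero    N y _ =
    solve 3 (λ y z a → (y :- z) :* (:1 :* a :+ :0) := y :* a :- z :* :1 :* a) refl y z (y ^ N)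
  columnPoly-geometric z (suc r) zero    N y _ = begin
    (y - z) * evalPoly (columnPoly z (suc r) 0 N) y
      ≈⟨ *-congˡ (evalPoly-columnPoly-0 z r N y) ⟩
    (y - z) * (z ^ suc r * y ^ N + y * E)
      ≈⟨ solve 5 (λ y z a b d → (y :- z) :* (a :* b :+ y :* d) := (y :- z) :* (a :* b) :+ y :* ((y :- z) :* d)) refl _ _ _ _ _ ⟩
    (y - z) * (z ^ suc r * y ^ N) + y * ((y - z) * E)
      ≈⟨ +-congˡ (*-congˡ (columnPoly-geometric z r 0 N y z≤n)) ⟩
    (y - z) * (z ^ suc r * y ^ N) + y * (y ^ (r ℕ.+ suc N) - z ^ suc r * y ^ N)
      ≈⟨ solve 5 (λ y z a b d → (y :- z) :* (a :* b) :+ y :* (d :- a :* b) := y :* d :- z :* a :* b) refl _ _ _ _ _ ⟩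
    y * y ^ (r ℕ.+ suc N) - z * z ^ suc r * y ^ N ∎
    where E = evalPoly (columnPoly z r 0 N) y
  columnPoly-geometric z (suc r) (suc s) N y (s≤s s≤r) = begin
    (y - z) * evalPoly (columnPoly z (suc r) (suc s) N) y
      ≈⟨ *-congˡ (evalPoly-columnPoly-suc z r s N y) ⟩
    (y - z) * (y * evalPoly (columnPoly z r s N) y)
      ≈⟨ solve 3 (λ a y b → a :* (y :* b) := y :* (a :* b)) refl _ _ _ ⟩
    y * ((y - z) * evalPoly (columnPoly z r s N) y)
      ≈⟨ *-congˡ (columnPoly-geometric z r s N y s≤r) ⟩
    y * (y ^ (r ℕ.+ suc N) - z ^ (suc r ∸ s) * y ^ (s ℕ.+ N))
      ≈⟨ solve 4 (λ y a b d → y :* (a :- b :* d) := y :* a :- b :* (y :* d)) refl _ _ _ _ ⟩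
    y * y ^ (r ℕ.+ suc N) - z ^ (suc r ∸ s) * (y * y ^ (s ℕ.+ N)) ∎

  alternant : List Carrier → List ℕ → Carrier
  alternant xs λs = det xs (map monomial (addStaircase λs))

  columnPolys : Carrier → List ℕ → List Poly
  columnPolys z (r ∷ s ∷ λs) = columnPoly z r s (length λs) ∷ columnPolys z (s ∷ λs)
  columnPolys z _            = []

  reduced : Carrier → List ℕ → List Column
  reduced z []           = []
  reduced z (r ∷ [])     = [ monomial (r ℕ.+ 0) ]
  reduced z (r ∷ s ∷ λs) = (λ y → (y - z) * evalPoly (columnPoly z r s (length λs)) y) ∷ reduced z (s ∷ λs)

  -- Subtracting z ^ (r - s + 1) times its right neighbour from every column except the last one leaves
  -- a single nonzero entry in the row of the variable z.
  alternant-reduced : ∀ z λs → Linked _≥_ λs → ∀ xs → alternant xs λs ≈ det xs (reduced z λs)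
  alternant-reduced z []           _           xs = refl
  alternant-reduced z (r ∷ [])     _           xs = refl
  alternant-reduced z (r ∷ s ∷ λs) (s≤r ∷ dec) xs = begin
    alternant xs (r ∷ s ∷ λs)
      ≈⟨ pick-cong xs (λ y ys _ → *-congˡ (alternant-reduced z (s ∷ λs) dec ys)) ⟩
    det xs (monomial e₁ ∷ reduced z (s ∷ λs))
      ≈⟨ sym (trans (+-congˡ (trans (*-congˡ zero-det) (zeroʳ _))) (+-identityʳ _)) ⟩
    det xs (monomial e₁ ∷ reduced z (s ∷ λs)) + - zc * det xs (monomial e₂ ∷ reduced z (s ∷ λs))
      ≈⟨ +-congˡ (sym (det-*ˡ xs [] (- zc) (monomial e₂) (reduced z (s ∷ λs)))) ⟩
    det xs (monomial e₁ ∷ reduced z (s ∷ λs)) + det xs ((λ y → - zc * y ^ e₂) ∷ reduced z (s ∷ λs))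
      ≈⟨ sym (det-+ xs [] (monomial e₁) _ (reduced z (s ∷ λs))) ⟩
    det xs ((λ y → y ^ e₁ + - zc * y ^ e₂) ∷ reduced z (s ∷ λs))
      ≈⟨ pick-cong xs (λ y ys _ → *-congʳ (trans (+-congˡ (sym (-‿distribˡ-* _ _)))
           (sym (columnPoly-geometric z r s (length λs) y s≤r)))) ⟩
    det xs (reduced z (r ∷ s ∷ λs)) ∎
    where
    e₁ = r ℕ.+ suc (length λs)
    e₂ = s ℕ.+ length λs
    zc = z ^ (suc r ∸ s)
    zero-det : det xs (monomial e₂ ∷ reduced z (s ∷ λs)) ≈ 0#
    zero-det = trans (sym (pick-cong xs (λ y ys _ → *-congˡ (alternant-reduced z (s ∷ λs) dec ys))))
      (zero-dup (det-alternating xs) [] (monomial e₂) (map monomial (addStaircase λs)))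

  pick-∷ʳ : ∀ {a} {A : Set a} (xs : List A) z (φ : A → List A → Carrier) →
    pick (xs ++ [ z ]) φ ≈ pick xs (λ y ys → φ y (ys ++ [ z ])) + sgn (length xs) * φ z xs
  pick-∷ʳ []       z φ = solve 1 (λ a → a :- :0 := :0 :+ :1 :* a) refl _
  pick-∷ʳ (x ∷ xs) z φ = trans (+-congˡ (-‿cong (pick-∷ʳ xs z _)))
    (solve 4 (λ a b s d → a :- (b :+ s :* d) := a :- b :+ (:- s) :* d) refl _ _ _ _)

  -- In the row of z every column except the last carries the factor z - z. Hence z is picked last
  -- of all and contributes z ^ lastPart.
  det-reduced-∷ʳ : ∀ z r λs xs → length xs ≡ length λs →
    det (xs ++ [ z ]) (reduced z (r ∷ λs))
      ≈ z ^ lastPart (r ∷ λs) * det xs (map (λ f y → (y - z) * f y) (map evalPoly (columnPolys z (r ∷ λs))))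
  det-reduced-∷ʳ z r []       []       _ rewrite ℕ.+-identityʳ r = solve 1 (λ a → a :* :1 :- :0 := a :* :1) refl _
  det-reduced-∷ʳ z r (s ∷ λs) xs       e = begin
    pick (xs ++ [ z ]) (λ y ys → (y - z) * f y * det ys (reduced z (s ∷ λs)))
      ≈⟨ pick-∷ʳ xs z _ ⟩
    pick xs (λ y ys → (y - z) * f y * det (ys ++ [ z ]) (reduced z (s ∷ λs)))
      + sgn (length xs) * ((z - z) * f z * det xs (reduced z (s ∷ λs)))
      ≈⟨ solve 5 (λ a s z f d → a :+ s :* ((z :- z) :* f :* d) := a) refl _ _ _ _ _ ⟩
    pick xs (λ y ys → (y - z) * f y * det (ys ++ [ z ]) (reduced z (s ∷ λs)))
      ≈⟨ pick-cong xs (λ y ys p → trans (*-congˡ (det-reduced-∷ʳ z s λs ys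
           (ℕ.suc-injective (≡.trans (≡.sym (↭-length p)) e))))
           (solve 3 (λ b a d → b :* (a :* d) := a :* (b :* d)) refl _ _ _)) ⟩
    pick xs (λ y ys → Z * ((y - z) * f y * det ys (map (λ f y → (y - z) * f y) (map evalPoly (columnPolys z (s ∷ λs))))))
      ≈⟨ pick-*ˡ Z xs _ ⟩
    Z * det xs (map (λ f y → (y - z) * f y) (map evalPoly (columnPolys z (r ∷ s ∷ λs)))) ∎
    where
    Z = z ^ lastPart (s ∷ λs)
    f = evalPoly (columnPoly z r s (length λs))

  length-columnPolys : ∀ z r λs → length (columnPolys z (r ∷ λs)) ≡ length λs
  length-columnPolys z r []       = ≡.refl
  length-columnPolys z r (s ∷ λs) = ≡.cong suc (length-columnPolys z s λs)

  -- Choosing a term from the geometric sum of each column is choosing an interlacing μ. The offset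
  -- N of a column is the number of parts of μ after the chosen one, so the exponents are those of μ
  -- plus its staircase.
  multilinear-columnPolys : ∀ z r λs L →
    multilinear L (columnPolys z (r ∷ λs)) ≈ interlacing z (r ∷ λs) (L ∘ addStaircase)
  multilinear-columnPolys z r []       L = refl
  multilinear-columnPolys z r (s ∷ λs) L = trans (∑-map _ (splits r) _) (∑-cong (splits r) (λ (k , c) → *-congˡ
    (trans (multilinear-columnPolys z s λs (L ∘ (k ℕ.+ length λs ∷_)))
      (interlacing-cong z (s ∷ λs) (λ {μ} i → reflexive
        (≡.cong (λ n → L (k ℕ.+ n ∷ addStaircase μ)) (≡.sym (interlace-length i))))))))

  alternant-∷ʳ : ∀ z r λs xs → Linked _≥_ (r ∷ λs) → length xs ≡ length λs →
    alternant (xs ++ [ z ]) (r ∷ λs)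
      ≈ z ^ lastPart (r ∷ λs) * (Π (map (λ y → y - z) xs) * interlacing z (r ∷ λs) (alternant xs))
  alternant-∷ʳ z r λs xs dec e = begin
    alternant (xs ++ [ z ]) (r ∷ λs)
      ≈⟨ alternant-reduced z (r ∷ λs) dec (xs ++ [ z ]) ⟩
    det (xs ++ [ z ]) (reduced z (r ∷ λs))
      ≈⟨ det-reduced-∷ʳ z r λs xs e ⟩
    Z * det xs (map (λ f y → (y - z) * f y) (map evalPoly Ps))
      ≈⟨ *-congˡ (det-scale-rows (λ y → y - z) xs (map evalPoly Ps)
           (≡.trans e (≡.sym (≡.trans (length-map evalPoly Ps) (length-columnPolys z r λs))))) ⟩
    Z * (Π (map (λ y → y - z) xs) * det xs (map evalPoly Ps))
      ≈⟨ *-congˡ (*-congˡ (trans (det-evalPoly xs Ps) (multilinear-columnPolys z r λs _))) ⟩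
    Z * (Π (map (λ y → y - z) xs) * interlacing z (r ∷ λs) (alternant xs)) ∎
    where
    Z  = z ^ lastPart (r ∷ λs)
    Ps = columnPolys z (r ∷ λs)

  Vandermonde : List Carrier → Carrier
  Vandermonde = Πpairs (λ a b → b - a)

  Π-++ : ∀ as bs → Π (as ++ bs) ≈ Π as * Π bs
  Π-++ []       bs = sym (*-identityˡ _)
  Π-++ (a ∷ as) bs = trans (*-congˡ (Π-++ as bs)) (sym (*-assoc _ _ _))

  Vandermonde-∷ʳ : ∀ xs z → Vandermonde (xs ++ [ z ]) ≈ Vandermonde xs * Π (map (λ y → z - y) xs)
  Vandermonde-∷ʳ []       z = *-congˡ refl
  Vandermonde-∷ʳ (x ∷ xs) z = trans
    (*-cong (trans (reflexive (≡.cong Π (map-++ (λ y → y - x) xs [ z ]))) (Π-++ (map (λ y → y - x) xs) _)) (Vandermonde-∷ʳ xs z))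
    (solve 4 (λ a b v p → a :* (b :* :1) :* (v :* p) := a :* v :* (b :* p)) refl _ _ _ _)

  Π-negate : ∀ z xs → Π (map (λ y → y - z) xs) ≈ sgn (length xs) * Π (map (λ y → z - y) xs)
  Π-negate z []       = sym (*-identityˡ _)
  Π-negate z (x ∷ xs) = trans (*-congˡ (Π-negate z xs))
    (solve 4 (λ x z s p → (x :- z) :* (s :* p) := (:- s) :* ((z :- x) :* p)) refl _ _ _ _)

  tabulate-∷ʳ : ∀ {a} {A : Set a} n (x : Fin (suc n) → A) → tabulate x ≡ tabulate (x ∘ inject₁) ++ [ x (fromℕ n) ]
  tabulate-∷ʳ zero    x = ≡.refl
  tabulate-∷ʳ (suc n) x = ≡.cong (x fzero ∷_) (tabulate-∷ʳ n (x ∘ fsuc))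

  -- Induction on the number of variables: alternant and Schur polynomial branch along the last
  -- variable in the same way. The sign arises because the exponents decrease while `Vandermonde`
  -- subtracts the earlier variable from the later one.
  bialternant : ∀ n (x : Fin n → Carrier) λs → Linked _≥_ λs → length λs ≡ n →
    alternant (tabulate x) λs ≈ ε n * (Vandermonde (tabulate x) * schurPolynomial n x λs)
  bialternant zero    x []       _   _ = sym (trans (*-identityˡ _) (trans (*-identityˡ _) (schur-[] 0 x)))
  bialternant (suc n) x (r ∷ λs) dec e = begin
    alternant (tabulate x) (r ∷ λs)
      ≡⟨ ≡.cong (λ xs → alternant xs (r ∷ λs)) (tabulate-∷ʳ n x) ⟩
    alternant (ys ++ [ z ]) (r ∷ λs)
      ≈⟨ alternant-∷ʳ z r λs ys dec (≡.trans lys (≡.sym lλs)) ⟩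
    Z * (Π (map (λ y → y - z) ys) * interlacing z (r ∷ λs) (alternant ys))
      ≈⟨ *-congˡ (*-cong (Π-negate z ys) (trans
           (interlacing-cong z (r ∷ λs) (λ i → trans
             (bialternant n x′ _ (interlace-decreasing i) (≡.trans (interlace-length i) lλs)) (sym (*-assoc _ _ _))))
           (interlacing-*ˡ _ z (r ∷ λs) (schurPolynomial n x′)))) ⟩
    Z * (sgn (length ys) * P * (ε n * V * I))
      ≈⟨ solve 6 (λ Z s P e V I → Z :* (s :* P :* (e :* V :* I)) := s :* e :* (V :* P :* (Z :* I))) refl _ _ _ _ _ _ ⟩
    sgn (length ys) * ε n * (V * P * (Z * I))
      ≈⟨ *-cong (*-congʳ (reflexive (≡.cong sgn lys))) (*-cong
           (trans (sym (Vandermonde-∷ʳ ys z)) (reflexive (≡.cong Vandermonde (≡.sym (tabulate-∷ʳ n x)))))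
           (trans (sym (branch-interlacing z r λs (schurPolynomial n x′) last-column)) (sym (schur-branch n x (r ∷ λs) dec)))) ⟩
    ε (suc n) * (Vandermonde (tabulate x) * schurPolynomial (suc n) x (r ∷ λs)) ∎
    where
    z  = x (fromℕ n)
    x′ = x ∘ inject₁
    ys = tabulate x′
    Z  = z ^ lastPart (r ∷ λs)
    P  = Π (map (λ y → z - y) ys)
    V  = Vandermonde ys
    I  = interlacing z (r ∷ λs) (schurPolynomial n x′)
    lys : length ys ≡ n
    lys = length-tabulate x′
    lλs : length λs ≡ n
    lλs = ℕ.suc-injective e
    last-column : ∀ {μ} → Interlace (r ∷ λs) μ →
      schurPolynomial n x′ (μ ++ [ 0 ]) ≈ schurPolynomial n x′ μ
        × (∀ k → suc k ≤ lastPart (r ∷ λs) → schurPolynomial n x′ (μ ++ [ suc k ]) ≈ 0#)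
    last-column {μ} i = schur-∷ʳ0 n x′ μ , λ k k< → schur-vanish n x′ (μ ++ [ suc k ])
      (All.++⁺ (All.map (ℕ.≤-trans (ℕ.≤-trans z<s k<)) (interlace-lastPart i dec)) (z<s ∷ []))
      (≡.trans (length-++ μ) (≡.trans (ℕ.+-comm (length μ) 1) (≡.cong suc (≡.trans (interlace-length i) lλs))))

-- The partition of a chain and its Frobenius notation

open import Data.Nat using (_+_)

raise-born : ∀ {as bs} → Raise as bs →
  (born as bs ≡ true × length bs ≡ suc (length as)) ⊎ (born as bs ≡ false × length bs ≡ length as)
raise-born none     = inj₂ (≡.refl , ≡.refl)
raise-born new      = inj₁ (≡.refl , ≡.refl)
raise-born (stay r) with raise-born r
... | inj₁ (e , l) = inj₁ (e , ≡.cong suc l)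
... | inj₂ (e , l) = inj₂ (e , ≡.cong suc l)
raise-born (up r)   with raise-born r
... | inj₁ (e , l) = inj₁ (e , ≡.cong suc l)
... | inj₂ (e , l) = inj₂ (e , ≡.cong suc l)

-- The Frobenius notation of the partition of a chain c is (map pred (newest c) | legs c): its rows are
-- arm rows, one row of length l (the side of the Durfee square) and the rows in lowRows c, which include zeros.
legs : Chain → List ℕ
legs []      = []
legs (α ∷ c) = map suc (legs c) ++ (if born (newest c) α then [ 1 ] else [])

lowRows : Chain → List ℕ
lowRows []      = []
lowRows (α ∷ c) = if born (newest c) α then lowRows c else length (newest c) ∷ lowRows c

armRows : ℕ → List ℕ → List ℕ
armRows i []       = []
armRows i (a ∷ as) = a + i ∷ armRows (suc i) as

partition : Chain → List ℕ
partition c = armRows 0 (newest c) ++ length (newest c) ∷ lowRows c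

length-armRows : ∀ i as → length (armRows i as) ≡ length as
length-armRows i []       = ≡.refl
length-armRows i (a ∷ as) = ≡.cong suc (length-armRows (suc i) as)

length-legs : ∀ {c} → IsChain c → length (legs c) ≡ length (newest c)
length-legs [] = ≡.refl
length-legs (_∷_ {α} {c} (r , _) ic) with raise-born r
... | inj₁ (e , l) rewrite e | l | length-++ (map suc (legs c)) {[ 1 ]} | length-map suc (legs c) | length-legs ic =
  ℕ.+-comm _ 1
... | inj₂ (e , l) rewrite e | l | ++-identityʳ (map suc (legs c)) | length-map suc (legs c) = length-legs ic

length-lowRows : ∀ {c} → IsChain c → length (newest c) + length (lowRows c) ≡ length c
length-lowRows [] = ≡.refl
length-lowRows (_∷_ {α} {c} (r , _) ic) with raise-born r
... | inj₁ (e , l) rewrite e | l = ≡.cong suc (length-lowRows ic)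
... | inj₂ (e , l) rewrite e | l = ≡.trans (ℕ.+-suc _ _) (≡.cong suc (length-lowRows ic))

length-partition : ∀ {c} → IsChain c → length (partition c) ≡ suc (length c)
length-partition {c} ic rewrite length-++ (armRows 0 (newest c)) {length (newest c) ∷ lowRows c}
  | length-armRows 0 (newest c) = ≡.trans (ℕ.+-suc _ _) (≡.cong suc (length-lowRows ic))

-- At any time the parts and the steps without a birth add up to the length of the chain
-- (`length-lowRows`). Adding the staircase therefore replaces the number of parts at such a step by
-- the time of the step.
low-addStaircase : ∀ {c} → IsChain c → addStaircase (lowRows c) ≡ low c
low-addStaircase [] = ≡.refl
low-addStaircase (_∷_ {α} {c} (r , _) ic) with born (newest c) α
... | true  = low-addStaircase ic
... | false = ≡.cong₂ _∷_ (length-lowRows ic) (low-addStaircase ic)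

addStaircase-armRows : ∀ m i as bs → i + length as + length bs ≡ suc m →
  addStaircase (armRows i as ++ bs) ≡ map (m +_) as ++ addStaircase bs
addStaircase-armRows m i []       bs e = ≡.refl
addStaircase-armRows m i (a ∷ as) bs e = ≡.cong₂ _∷_ head
  (addStaircase-armRows m (suc i) as bs (≡.trans (≡.cong (_+ length bs) (≡.sym (ℕ.+-suc i (length as)))) e))
  where
  head : a + i + length (armRows (suc i) as ++ bs) ≡ m + a
  head rewrite length-++ (armRows (suc i) as) {bs} | length-armRows (suc i) as = ℕ.suc-injective (begin
    suc (a + i + (length as + length bs))   ≡⟨ solve 4 (λ a i x y → con 1 :+ (a :+ i :+ (x :+ y)) := a :+ (i :+ (con 1 :+ x) :+ y)) ≡.refl a i (length as) (length bs) ⟩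
    a + (i + suc (length as) + length bs)   ≡⟨ ≡.cong (a +_) e ⟩
    a + suc m                               ≡⟨ ℕ.+-comm a (suc m) ⟩
    suc (m + a)                             ∎)
    where
    open +-*-Solver
    open ≡.≡-Reasoning

addStaircase-partition : ∀ {c} → IsChain c → addStaircase (partition c) ≡ exponents c
addStaircase-partition {c} ic = ≡.trans
  (addStaircase-armRows (length c) 0 (newest c) _ (≡.trans (ℕ.+-suc _ _) (≡.cong suc (length-lowRows ic))))
  (≡.cong (map (length c +_) (newest c) ++_) (≡.cong₂ _∷_ (length-lowRows ic) (low-addStaircase ic)))

linked-≥-head : ∀ {a b as} → b ≤ a → Linked _≥_ (b ∷ as) → Linked _≥_ (a ∷ as)
linked-≥-head b≤a [-]     = [-]
linked-≥-head b≤a (p ∷ d) = ℕ.≤-trans p b≤a ∷ d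

lowRows-decreasing : ∀ {c} → IsChain c → Linked _≥_ (length (newest c) ∷ lowRows c)
lowRows-decreasing [] = [-]
lowRows-decreasing (_∷_ {α} {c} (r , _) ic) with raise-born r
... | inj₁ (e , l) rewrite e | l = linked-≥-head (ℕ.n≤1+n _) (lowRows-decreasing ic)
... | inj₂ (e , l) rewrite e | l = ℕ.≤-refl ∷ lowRows-decreasing ic

armRows-decreasing : ∀ i as {b bs} → All (0 <_) as → T (strict as) → b ≡ i + length as →
  Linked _≥_ (b ∷ bs) → Linked _≥_ (armRows i as ++ b ∷ bs)
armRows-decreasing i []           _        _ _      d = d
armRows-decreasing i (a ∷ [])     (p ∷ _)  _ ≡.refl d =
  ℕ.≤-trans (ℕ.≤-reflexive (ℕ.+-comm i 1)) (ℕ.+-monoˡ-≤ i p) ∷ d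
armRows-decreasing i (a ∷ b ∷ as) (p ∷ ps) s e      d =
  ℕ.≤-trans (ℕ.≤-reflexive (ℕ.+-suc b i)) (ℕ.+-monoˡ-≤ i (ℕ.<ᵇ⇒< b a (proj₁ (T-∧ .to s))))
    ∷ armRows-decreasing (suc i) (b ∷ as) ps (proj₂ (T-∧ .to s)) (≡.trans e (ℕ.+-suc i _)) d

partition-decreasing : ∀ {c} → IsChain c → Linked _≥_ (partition c)
partition-decreasing {c} ic =
  armRows-decreasing 0 (newest c) (newest-positive ic) (newest-strict ic) ≡.refl (lowRows-decreasing ic)

indicator : Bool → ℕ
indicator b = if b then 1 else 0

-- The number of indices j ≥ 1 (counted from i + 1) with t ≤ b_j + j.
countLegs : ℕ → List ℕ → ℕ → ℕ
countLegs i []       t = 0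
countLegs i (b ∷ bs) t = indicator (t ≤ᵇ b + suc i) + countLegs (suc i) bs t

countLegs-map-suc : ∀ i bs t → countLegs i (map suc bs) (suc t) ≡ countLegs i bs t
countLegs-map-suc i []       t = ≡.refl
countLegs-map-suc i (b ∷ bs) t = ≡.cong₂ _+_ (≡.cong indicator (≡.sym (≤ᵇ≡<ᵇsuc t (b + suc i)))) (countLegs-map-suc (suc i) bs t)

countLegs-∷ʳ : ∀ i bs b t → countLegs i (bs ++ [ b ]) t ≡ countLegs i bs t + indicator (t ≤ᵇ b + suc (i + length bs))
countLegs-∷ʳ i []       b t rewrite ℕ.+-identityʳ i = ℕ.+-identityʳ _
countLegs-∷ʳ i (a ∷ bs) b t rewrite countLegs-∷ʳ (suc i) bs b t | ℕ.+-suc i (length bs) =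
  ≡.sym (ℕ.+-assoc (indicator (t ≤ᵇ a + suc i)) _ _)

indicator-anti : ∀ t s → indicator (suc t ≤ᵇ s) ≤ indicator (t ≤ᵇ s)
indicator-anti t s with ℕ.<-≤-connex t s
... | inj₁ t<s rewrite <⇒<ᵇ≡true t<s | ≤⇒≤ᵇ≡true (ℕ.<⇒≤ t<s) = ℕ.≤-refl
... | inj₂ s≤t rewrite ≤⇒<ᵇ≡false s≤t = z≤n

indicator≤1 : ∀ b → indicator b ≤ 1
indicator≤1 true  = ℕ.≤-refl
indicator≤1 false = z≤n

countLegs-anti : ∀ i bs t → countLegs i bs (suc t) ≤ countLegs i bs t
countLegs-anti i []       t = z≤n
countLegs-anti i (b ∷ bs) t = ℕ.+-mono-≤ (indicator-anti t (b + suc i)) (countLegs-anti (suc i) bs t)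

countLegs-≤ : ∀ i bs t → countLegs i bs t ≤ length bs
countLegs-≤ i []       t = z≤n
countLegs-≤ i (b ∷ bs) t = ℕ.+-mono-≤ (indicator≤1 (t ≤ᵇ b + suc i)) (countLegs-≤ (suc i) bs t)

countLegs-> : ∀ i bs t → i + length bs + sum bs < t → countLegs i bs t ≡ 0
countLegs-> i []       t p = ≡.refl
countLegs-> i (b ∷ bs) t p = ≡.cong₂ _+_
  (≡.cong indicator (>⇒≤ᵇ≡false (ℕ.≤-<-trans (≤-rearrange b (length bs) (sum bs)) p)))
  (countLegs-> (suc i) bs t (ℕ.≤-<-trans (≤-rearrange′ b (length bs) (sum bs)) p))
  where
  open +-*-Solver
  ≤-rearrange : ∀ b x y → b + suc i ≤ i + suc x + (b + y)
  ≤-rearrange b x y = ℕ.≤-trans (ℕ.m≤m+n (b + suc i) (x + y)) (ℕ.≤-reflexive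
    (solve 4 (λ b i x y → b :+ (con 1 :+ i) :+ (x :+ y) := i :+ (con 1 :+ x) :+ (b :+ y)) ≡.refl b i x y))
  ≤-rearrange′ : ∀ b x y → suc i + x + y ≤ i + suc x + (b + y)
  ≤-rearrange′ b x y = ℕ.≤-trans (ℕ.m≤m+n (suc i + x + y) b) (ℕ.≤-reflexive
    (solve 4 (λ b i x y → con 1 :+ i :+ x :+ y :+ b := i :+ (con 1 :+ x) :+ (b :+ y)) ≡.refl b i x y))

-- Matches the rows collected step by step with the rows of `fromFrob`, which are counted by column
-- heights. Without a birth all legs grow by one and the rows move down one place; with a birth the
-- new column adds a cell to the first of these rows only.
nth-lowRows : ∀ {c} → IsChain c → ∀ k →
  nth 0 (length (newest c) ∷ lowRows c) k ≡ countLegs 0 (legs c) (length (newest c) + suc k)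
nth-lowRows [] zero    = ≡.refl
nth-lowRows [] (suc k) = ≡.refl
nth-lowRows (_∷_ {α} {c} (r , _) ic) k with raise-born r
nth-lowRows (_∷_ {α} {c} (r , _) ic) k | inj₂ (e , l)
  rewrite e | l | ++-identityʳ (map suc (legs c)) | ℕ.+-suc (length (newest c)) k
  | countLegs-map-suc 0 (legs c) (length (newest c) + k) = shift k
  where
  a = length (newest c)
  shift : ∀ k → nth 0 (a ∷ a ∷ lowRows c) k ≡ countLegs 0 (legs c) (a + k)
  shift (suc k) = nth-lowRows ic k
  -- The last row of the Durfee square meets all columns: the count is at most the number of legs,
  -- and at least its value one row further down, which the induction identifies.
  shift zero    = ℕ.≤-antisym
    (ℕ.≤-trans (ℕ.≤-reflexive (nth-lowRows ic 0))
      (ℕ.≤-trans (ℕ.≤-reflexive (≡.cong (countLegs 0 (legs c)) (ℕ.+-suc a 0))) (countLegs-anti 0 (legs c) (a + 0))))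
    (ℕ.≤-trans (countLegs-≤ 0 (legs c) (a + 0)) (ℕ.≤-reflexive (length-legs ic)))
nth-lowRows (_∷_ {α} {c} (r , _) ic) k | inj₁ (e , l)
  rewrite e | l | countLegs-∷ʳ 0 (map suc (legs c)) 1 (suc (length (newest c) + suc k))
  | countLegs-map-suc 0 (legs c) (length (newest c) + suc k) | length-map suc (legs c) | length-legs ic = shift k
  where
  a = length (newest c)
  shift : ∀ k → nth 0 (suc a ∷ lowRows c) k
            ≡ countLegs 0 (legs c) (a + suc k) + indicator (a + suc k <ᵇ suc (suc a))
  shift zero    rewrite <⇒<ᵇ≡true {a + 1} {suc (suc a)} (s≤s (ℕ.≤-reflexive (ℕ.+-comm a 1))) =
    ≡.trans (≡.cong suc (nth-lowRows ic 0)) (ℕ.+-comm 1 _)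
  shift (suc k) rewrite ≤⇒<ᵇ≡false {a + suc (suc k)} {suc (suc a)}
      (ℕ.≤-trans (ℕ.≤-reflexive (ℕ.+-comm 2 a)) (ℕ.+-monoʳ-≤ a (s≤s (s≤s z≤n)))) =
    ≡.trans (nth-lowRows ic (suc k)) (≡.sym (ℕ.+-identityʳ _))

-- With the default 0, lists with equal `nth` differ by trailing zeros at most, and the filter
-- removes these.
filter-positive-cong : ∀ xs ys → (∀ k → nth 0 xs k ≡ nth 0 ys k) → filterᵇ (1 ≤ᵇ_) xs ≡ filterᵇ (1 ≤ᵇ_) ys
filter-positive-cong []       []       h = ≡.refl
filter-positive-cong []       (y ∷ ys) h rewrite ≡.sym (h 0) = filter-positive-cong [] ys (h ∘ suc)
filter-positive-cong (x ∷ xs) []       h rewrite h 0 = filter-positive-cong xs [] (h ∘ suc)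
filter-positive-cong (x ∷ xs) (y ∷ ys) h rewrite h 0 with 1 ≤ᵇ y
... | true  = ≡.cong (y ∷_) (filter-positive-cong xs ys (h ∘ suc))
... | false = filter-positive-cong xs ys (h ∘ suc)

module _ {a} {A : Set a} (d : A) where

  nth-ext : ∀ {xs ys : List A} → length xs ≡ length ys → (∀ i → i < length xs → nth d xs i ≡ nth d ys i) → xs ≡ ys
  nth-ext {[]}     {[]}     _ _ = ≡.refl
  nth-ext {x ∷ xs} {y ∷ ys} e h = ≡.cong₂ _∷_ (h 0 z<s) (nth-ext (ℕ.suc-injective e) (λ i p → h (suc i) (s≤s p)))

  nth-≥ : ∀ (xs : List A) {i} → length xs ≤ i → nth d xs i ≡ d
  nth-≥ []       _       = ≡.refl
  nth-≥ (x ∷ xs) (s≤s p) = nth-≥ xs p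

  nth-applyUpTo : ∀ (f : ℕ → A) {n i} → i < n → nth d (applyUpTo f n) i ≡ f i
  nth-applyUpTo f {suc n} {zero}  _       = ≡.refl
  nth-applyUpTo f {suc n} {suc i} (s≤s p) = nth-applyUpTo (f ∘ suc) p

count-map : ∀ {a b} {A : Set a} {B : Set b} (p : B → Bool) (f : A → B) xs → count p (map f xs) ≡ count (p ∘ f) xs
count-map p f []       = ≡.refl
count-map p f (x ∷ xs) = ≡.trans (count-∷ p (f x) (map f xs))
  (≡.trans (≡.cong (indicator (p (f x)) +_) (count-map p f xs)) (≡.sym (count-∷ (p ∘ f) x xs)))

count-cong : ∀ {a} {A : Set a} {p q : A → Bool} → (∀ x → p x ≡ q x) → ∀ xs → count p xs ≡ count q xs
count-cong h []       = ≡.refl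
count-cong {p = p} {q} h (x ∷ xs) = ≡.trans (count-∷ p x xs)
  (≡.trans (≡.cong₂ _+_ (≡.cong indicator (h x)) (count-cong h xs)) (≡.sym (count-∷ q x xs)))

upTo-suc : ∀ n → upTo (suc n) ≡ 0 ∷ map suc (upTo n)
upTo-suc n = ≡.cong (0 ∷_) (≡.sym (map-upTo suc n))

count-countLegs : ∀ bs t i → count (λ j → t ≤ᵇ nth 0 bs j + suc (j + i)) (upTo (length bs)) ≡ countLegs i bs t
count-countLegs []       t i = ≡.refl
count-countLegs (b ∷ bs) t i = begin
  count p (upTo (suc (length bs)))           ≡⟨ ≡.cong (count p) (upTo-suc (length bs)) ⟩
  count p (0 ∷ map suc (upTo (length bs)))   ≡⟨ count-∷ p 0 (map suc (upTo (length bs))) ⟩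
  indicator (p 0) + count p (map suc (upTo (length bs)))
    ≡⟨ ≡.cong (indicator (p 0) +_) (≡.trans (count-map p suc (upTo (length bs)))
         (count-cong (λ j → ≡.cong (λ k → t ≤ᵇ nth 0 bs j + suc k) (≡.sym (ℕ.+-suc j i))) (upTo (length bs)))) ⟩
  indicator (p 0) + count (λ j → t ≤ᵇ nth 0 bs j + suc (j + suc i)) (upTo (length bs))
    ≡⟨ ≡.cong (indicator (p 0) +_) (count-countLegs bs t (suc i)) ⟩
  countLegs i (b ∷ bs) t ∎
  where
  open ≡.≡-Reasoning
  p : ℕ → Bool
  p j = t ≤ᵇ nth 0 (b ∷ bs) j + suc (j + i)

fromFrob-arms : ∀ i as → All (0 <_) as →
  map (λ j → nth 0 (map pred as) j + suc (j + i)) (upTo (length as)) ≡ armRows i as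
fromFrob-arms i []           _        = ≡.refl
fromFrob-arms i (suc a ∷ as) (_ ∷ ps) = begin
  map f (upTo (suc (length as)))             ≡⟨ ≡.cong (map f) (upTo-suc (length as)) ⟩
  f 0 ∷ map f (map suc (upTo (length as)))   ≡⟨ ≡.cong₂ _∷_ (ℕ.+-suc a i) (≡.trans (≡.sym (map-∘ (upTo (length as))))
                                                  (map-cong (λ j → ≡.cong (λ k → nth 0 (map pred as) j + suc k) (≡.sym (ℕ.+-suc j i))) (upTo (length as)))) ⟩
  suc (a + i) ∷ map (λ j → nth 0 (map pred as) j + suc (j + suc i)) (upTo (length as))
                                             ≡⟨ ≡.cong (suc (a + i) ∷_) (fromFrob-arms (suc i) as ps) ⟩
  armRows i (suc a ∷ as)                     ∎
  where
  open ≡.≡-Reasoning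
  f : ℕ → ℕ
  f j = nth 0 (map pred (suc a ∷ as)) j + suc (j + i)

armRows-positive : ∀ i as → All (0 <_) as → All (T ∘ (1 ≤ᵇ_)) (armRows i as)
armRows-positive i []           []       = []
armRows-positive i (suc a ∷ as) (_ ∷ ps) = _ ∷ armRows-positive (suc i) as ps

-- `fromFrob` inspects as many rows below the Durfee square as the sum of the legs, and no column
-- reaches further (`countLegs->`). Both lists thus agree up to trailing zeros.
fromFrob-partition : ∀ {c} → IsChain c →
  fromFrob (map pred (newest c)) (legs c) ≡ filterᵇ (1 ≤ᵇ_) (partition c)
fromFrob-partition {c} ic = ≡.sym (≡.trans
  (filter-++ _ (armRows 0 α) (length α ∷ lowRows c))
  (≡.cong₂ _++_ arms (filter-positive-cong (length α ∷ lowRows c) (map row (map (l +_) (oneTo (sum bs)))) rows)))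
  where
  α  = newest c
  bs = legs c
  l  = length (map pred α)
  l≡ : l ≡ length α
  l≡ = length-map pred α
  row : ℕ → ℕ
  row i = count (λ j → i ≤ᵇ nth 0 bs (pred j) + j) (oneTo l)
  arms : filterᵇ (1 ≤ᵇ_) (armRows 0 α) ≡ map (λ i → nth 0 (map pred α) (pred i) + i) (oneTo l)
  arms = begin
    filterᵇ (1 ≤ᵇ_) (armRows 0 α)
      ≡⟨ filter-all _ (armRows-positive 0 α (newest-positive ic)) ⟩
    armRows 0 α
      ≡⟨ ≡.sym (fromFrob-arms 0 α (newest-positive ic)) ⟩
    map (λ j → nth 0 (map pred α) j + suc (j + 0)) (upTo (length α))
      ≡⟨ map-cong (λ j → ≡.cong (λ k → nth 0 (map pred α) j + suc k) (ℕ.+-identityʳ j)) (upTo (length α)) ⟩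
    map (λ j → nth 0 (map pred α) j + suc j) (upTo (length α))
      ≡⟨ map-∘ (upTo (length α)) ⟩
    map (λ i → nth 0 (map pred α) (pred i) + i) (map suc (upTo (length α)))
      ≡⟨ ≡.cong (λ n → map (λ i → nth 0 (map pred α) (pred i) + i) (oneTo n)) (≡.sym l≡) ⟩
    map (λ i → nth 0 (map pred α) (pred i) + i) (oneTo l) ∎
    where open ≡.≡-Reasoning
  row≡ : ∀ t → row t ≡ countLegs 0 bs t
  row≡ t rewrite l≡ | ≡.sym (length-legs ic) = ≡.trans
    (count-map (λ j → t ≤ᵇ nth 0 bs (pred j) + j) suc (upTo (length bs)))
    (≡.trans (count-cong (λ j → ≡.cong (λ k → t ≤ᵇ nth 0 bs j + suc k) (≡.sym (ℕ.+-identityʳ j))) (upTo (length bs)))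
      (count-countLegs bs t 0))
  list≡ : map row (map (l +_) (oneTo (sum bs))) ≡ applyUpTo (λ k → row (l + suc k)) (sum bs)
  list≡ = ≡.trans (≡.sym (map-∘ (oneTo (sum bs)))) (≡.trans (≡.sym (map-∘ (upTo (sum bs)))) (map-upTo _ (sum bs)))
  rows : ∀ k → nth 0 (length α ∷ lowRows c) k ≡ nth 0 (map row (map (l +_) (oneTo (sum bs)))) k
  rows k rewrite list≡ with ℕ.<-≤-connex k (sum bs)
  ... | inj₁ k<n = ≡.sym (≡.trans (nth-applyUpTo 0 _ k<n) (≡.trans (row≡ _)
    (≡.trans (≡.cong (λ l → countLegs 0 bs (l + suc k)) l≡) (≡.sym (nth-lowRows ic k)))))
  ... | inj₂ n≤k = ≡.trans (≡.trans (nth-lowRows ic k) (countLegs-> 0 bs (length α + suc k) large))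
    (≡.sym (nth-≥ 0 (applyUpTo (λ k → row (l + suc k)) (sum bs))
      (ℕ.≤-trans (ℕ.≤-reflexive (length-applyUpTo _ (sum bs))) n≤k)))
    where
    large : length bs + sum bs < length α + suc k
    large rewrite length-legs ic = ℕ.+-monoʳ-< (length α) (s≤s n≤k)

sum-map-pred : ∀ {as} → All (0 <_) as → sum (map pred as) + length as ≡ sum as
sum-map-pred []                          = ≡.refl
sum-map-pred (_∷_ {suc a} {as} _ ps) = ≡.trans (ℕ.+-suc _ _)
  (≡.cong suc (≡.trans (ℕ.+-assoc a _ _) (≡.cong (a +_) (sum-map-pred ps))))

map-suc-pred : ∀ {as} → All (0 <_) as → map suc (map pred as) ≡ as
map-suc-pred []                     = ≡.refl
map-suc-pred (_∷_ {suc a} _ ps) = ≡.cong (suc a ∷_) (map-suc-pred ps)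

legs-positive : ∀ c → All (0 <_) (legs c)
legs-positive []      = []
legs-positive (α ∷ c) with born (newest c) α
... | true  = All.++⁺ (All.map⁺ (All.universal (λ _ → z<s) (legs c))) (z<s ∷ [])
... | false = All.++⁺ (All.map⁺ (All.universal (λ _ → z<s) (legs c))) []

sum-map-suc : ∀ as → sum (map suc as) ≡ sum as + length as
sum-map-suc []       = ≡.refl
sum-map-suc (a ∷ as) = ≡.trans (≡.cong suc (≡.trans (≡.cong (a +_) (sum-map-suc as)) (≡.sym (ℕ.+-assoc a (sum as) (length as)))))
  (≡.sym (ℕ.+-suc (a + sum as) (length as)))

sum-legs-∷ : ∀ {α c} → IsChain (α ∷ c) → sum (legs (α ∷ c)) ≡ sum (legs c) + length α
sum-legs-∷ (_∷_ {α} {c} (r , _) ic) with raise-born r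
... | inj₁ (e , l) rewrite e | l | sum-++ (map suc (legs c)) [ 1 ] | sum-map-suc (legs c) | length-legs ic =
  ≡.trans (ℕ.+-assoc (sum (legs c)) _ 1) (≡.cong (sum (legs c) +_) (ℕ.+-comm _ 1))
... | inj₂ (e , l) rewrite e | l | ++-identityʳ (map suc (legs c)) | sum-map-suc (legs c) | length-legs ic = ≡.refl

length-addStaircase : ∀ as → length (addStaircase as) ≡ length as
length-addStaircase []       = ≡.refl
length-addStaircase (a ∷ as) = ≡.cong suc (length-addStaircase as)

length-low : ∀ {c} → IsChain c → length (newest c) + length (low c) ≡ length c
length-low {c} ic = ≡.trans (≡.cong (λ as → length (newest c) + length as) (≡.sym (low-addStaircase ic)))
  (≡.trans (≡.cong (length (newest c) +_) (length-addStaircase (lowRows c))) (length-lowRows ic))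

-- The weight of a chain as a monomial in u, v and w

module ChainWeight {c ℓ : Level} (R : CommutativeRing c ℓ) (u v w : CommutativeRing.Carrier R) where
  open CommutativeRing R hiding (zero) renaming (_+_ to _⊕_)
  open import Algebra.Definitions.RawSemiring (Semiring.rawSemiring semiring) using (_^_)
  open import Algebra.Properties.Semiring.Exp semiring using (^-homo-*)
  open IntegerSolver R
  open Expansion R u v w using (raiseWeight; raiseWeight-stay; raiseWeight-up; chainWeight)

  -- i counts the parts that grow or are born, j those that stay, and k is 1 if no part is born and
  -- 0 otherwise.
  raiseWeight-monomial : ∀ {as bs} → Raise as bs → ∃ λ i → ∃₂ λ j k →
    raiseWeight as bs ≈ u ^ i * w ^ j * v ^ k
      × sum bs ≡ sum as + i × i + j ≡ length bs × length bs + k ≡ suc (length as)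
  raiseWeight-monomial none = 0 , 0 , 1 ,
    solve 1 (λ v → v := :1 :* :1 :* (v :* :1)) refl v , ≡.refl , ≡.refl , ≡.refl
  raiseWeight-monomial new = 1 , 0 , 0 ,
    solve 1 (λ u → u := u :* :1 :* :1 :* :1) refl u , ≡.refl , ≡.refl , ≡.refl
  raiseWeight-monomial (stay {a} {as} {bs} r) with raiseWeight-monomial r
  ... | i , j , k , e , s , ij , lk = i , suc j , k ,
    trans (trans (reflexive (raiseWeight-stay a as bs)) (*-congˡ e))
      (solve 4 (λ w a b c → w :* (a :* b :* c) := a :* (w :* b) :* c) refl _ _ _ _) ,
    ≡.trans (≡.cong (a +_) s) (≡.sym (ℕ.+-assoc a (sum as) i)) , ≡.trans (ℕ.+-suc i j) (≡.cong suc ij) , ≡.cong suc lk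
  raiseWeight-monomial (up {a} {as} {bs} r) with raiseWeight-monomial r
  ... | i , j , k , e , s , ij , lk = suc i , j , k ,
    trans (trans (reflexive (raiseWeight-up a as bs)) (*-congˡ e))
      (solve 4 (λ u a b c → u :* (a :* b :* c) := u :* a :* b :* c) refl _ _ _ _) ,
    ≡.trans (≡.cong suc (≡.trans (≡.cong (a +_) s) (≡.sym (ℕ.+-assoc a (sum as) i)))) (≡.sym (ℕ.+-suc (a + sum as) i)) ,
    ≡.cong suc ij , ≡.cong suc lk

  -- Every u enlarges some part by one, and every part receives one factor u or w in each step of
  -- its life, whose duration is its leg. Each step assigns one factor to every column already
  -- present, so the total degree is 1 + 2 + ... + length c.
  chainWeight-monomial : ∀ {c} → IsChain c → ∃₂ λ j k →
    chainWeight c ≈ u ^ sum (newest c) * w ^ j * v ^ k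
      × sum (newest c) + j ≡ sum (legs c) × k + sum (legs c) ≡ suc (length c) C 2
  chainWeight-monomial [] = 0 , 0 , solve 0 (:1 := :1 :* :1 :* :1) refl , ≡.refl , ≡.refl
  chainWeight-monomial {α ∷ c} ic′@(_∷_ (r , _) ic) with chainWeight-monomial ic | raiseWeight-monomial r
  ... | J , K , E , sJ , sK | i , j , k , e , s , ij , lk = J + j , K + k + length (low c) ,
    trans (*-cong E (*-congʳ e)) (trans
      (solve 7 (λ U W V u w v L → U :* W :* V :* (u :* w :* v :* L) := (U :* u) :* (W :* w) :* (V :* v :* L)) refl _ _ _ _ _ _ _)
      (*-cong (*-cong
        (trans (sym (^-homo-* u (sum (newest c)) i)) (reflexive (≡.cong (u ^_) (≡.sym s))))
        (sym (^-homo-* w J j)))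
        (trans (*-congʳ (sym (^-homo-* v K k))) (sym (^-homo-* v (K + k) (length (low c))))))) ,
    sumJ , sumK
    where
    open +-*-Solver using (con) renaming (solve to solveℕ; _:+_ to _:⊕_; _:=_ to _:≡_)
    open ≡.≡-Reasoning
    sumJ : sum α + (J + j) ≡ sum (legs (α ∷ c))
    sumJ = begin
      sum α + (J + j)                   ≡⟨ ≡.cong (_+ (J + j)) s ⟩
      sum (newest c) + i + (J + j)      ≡⟨ solveℕ 4 (λ a i J j → a :⊕ i :⊕ (J :⊕ j) :≡ a :⊕ J :⊕ (i :⊕ j)) ≡.refl (sum (newest c)) i J j ⟩
      sum (newest c) + J + (i + j)      ≡⟨ ≡.cong₂ _+_ sJ ij ⟩
      sum (legs c) + length α           ≡⟨ ≡.sym (sum-legs-∷ ic′) ⟩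
      sum (legs (α ∷ c))                ∎
    sumK : K + k + length (low c) + sum (legs (α ∷ c)) ≡ suc (suc (length c)) C 2
    sumK = begin
      K + k + length (low c) + sum (legs (α ∷ c))          ≡⟨ ≡.cong (K + k + length (low c) +_) (sum-legs-∷ ic′) ⟩
      K + k + length (low c) + (sum (legs c) + length α)   ≡⟨ solveℕ 5 (λ K k L S A → K :⊕ k :⊕ L :⊕ (S :⊕ A) :≡ A :⊕ k :⊕ L :⊕ (K :⊕ S)) ≡.refl K k (length (low c)) (sum (legs c)) (length α) ⟩
      length α + k + length (low c) + (K + sum (legs c))   ≡⟨ ≡.cong₂ _+_ (≡.trans (≡.cong (_+ length (low c)) lk) (≡.cong suc (length-low ic))) sK ⟩
      suc (length c) + suc (length c) C 2                  ≡⟨ ≡.cong (_+ suc (length c) C 2) (≡.sym (nC1≡n (suc (length c)))) ⟩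
      suc (length c) C 1 + suc (length c) C 2              ≡⟨ nCk+nC[k+1]≡[n+1]C[k+1] (suc (length c)) 1 ⟩
      suc (suc (length c)) C 2                             ∎

  -- The exponents in `omega` are truncated differences; the additive relations of
  -- `chainWeight-monomial` show that nothing is cut off.
  chainWeight-frobenius : ∀ {c} → IsChain c →
    let as = map pred (newest c)
        bs = map pred (legs c)
    in chainWeight c ≈ u ^ sum (map suc as) * w ^ (sum bs ∸ sum as) * v ^ (suc (length c) C 2 ∸ sum (map suc bs))
  chainWeight-frobenius {c} ic with chainWeight-monomial ic
  ... | j , k , e , sj , sk = trans e (*-cong (*-cong
    (reflexive (≡.cong (λ as → u ^ sum as) (≡.sym (map-suc-pred (newest-positive ic)))))
    (reflexive (≡.cong (w ^_) j≡)))
    (reflexive (≡.cong (v ^_) k≡)))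
    where
    as = map pred (newest c)
    bs = map pred (legs c)
    k≡ : k ≡ suc (length c) C 2 ∸ sum (map suc bs)
    k≡ rewrite map-suc-pred (legs-positive c) | ≡.sym sk = ≡.sym (ℕ.m+n∸n≡m k (sum (legs c)))
    l = length (newest c)
    bs≡ : sum bs ≡ sum as + j
    bs≡ = ℕ.+-cancelʳ-≡ l (sum bs) (sum as + j) (begin
      sum bs + l                   ≡⟨ ≡.cong (sum bs +_) (≡.sym (length-legs ic)) ⟩
      sum bs + length (legs c)     ≡⟨ sum-map-pred (legs-positive c) ⟩
      sum (legs c)                 ≡⟨ ≡.sym sj ⟩
      sum (newest c) + j           ≡⟨ ≡.cong (_+ j) (≡.sym (sum-map-pred (newest-positive ic))) ⟩
      sum as + l + j               ≡⟨ solveℕ 3 (λ a l j → a :⊕ l :⊕ j :≡ a :⊕ j :⊕ l) ≡.refl (sum as) l j ⟩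
      sum as + j + l               ∎)
      where
      open +-*-Solver using () renaming (solve to solveℕ; _:+_ to _:⊕_; _:=_ to _:≡_)
      open ≡.≡-Reasoning
    j≡ : j ≡ sum bs ∸ sum as
    j≡ rewrite bs≡ = ≡.sym (ℕ.m+n∸m≡n (sum as) j)

-- Plane partitions as arrays and as sets of cells

≤-from-< : ∀ {a b} → (∀ k → k < a → k < b) → a ≤ b
≤-from-< {zero}  h = z≤n
≤-from-< {suc a} h = h a ℕ.≤-refl

-- Numbers are treated as initial segments, so that equalities of counts reduce to equivalences
-- between memberships of cells.
≡-from-< : ∀ {a b} → (∀ k → k < a ⇔ k < b) → a ≡ b
≡-from-< h = ℕ.≤-antisym (≤-from-< (λ k → h k .to)) (≤-from-< (λ k → h k .from))

nth-All : ∀ {a p} {A : Set a} {P : A → Set p} {d : A} {xs} → All P xs → ∀ {i} → i < length xs → P (nth d xs i)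
nth-All (px ∷ pxs) {zero}  _       = px
nth-All (px ∷ pxs) {suc i} (s≤s p) = nth-All pxs p

nth-map-upTo : ∀ {a} {A : Set a} (d : A) (f : ℕ → A) {n i} → i < n → nth d (map f (upTo n)) i ≡ f i
nth-map-upTo d f {n} {i} p = ≡.trans (≡.cong (λ xs → nth d xs i) (map-upTo f n)) (nth-applyUpTo d f p)

length-map-upTo : ∀ {a} {A : Set a} (f : ℕ → A) n → length (map f (upTo n)) ≡ n
length-map-upTo f n = ≡.trans (length-map f (upTo n)) (length-upTo n)

map-nth-upTo : ∀ {a b} {A : Set a} {B : Set b} (d : A) (f : A → B) xs → map (λ i → f (nth d xs i)) (upTo (length xs)) ≡ map f xs
map-nth-upTo d f []       = ≡.refl
map-nth-upTo d f (x ∷ xs) = ≡.trans (≡.cong (map (λ i → f (nth d (x ∷ xs) i))) (upTo-suc (length xs)))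
  (≡.cong (f x ∷_) (≡.trans (≡.sym (map-∘ (upTo (length xs)))) (map-nth-upTo d f xs)))

map-cong-< : ∀ {a} {A : Set a} {f g : ℕ → A} n → (∀ i → i < n → f i ≡ g i) → map f (upTo n) ≡ map g (upTo n)
map-cong-< n h = map-cong-local (All.applyUpTo⁺₁ id n (λ {i} p → h i p))

T⇔≡ : ∀ {b c : Bool} → (T b → T c) → (T c → T b) → b ≡ c
T⇔≡ {true}  {true}  f g = ≡.refl
T⇔≡ {true}  {false} f g = ⊥-elim (f _)
T⇔≡ {false} {true}  f g = ⊥-elim (g _)
T⇔≡ {false} {false} f g = ≡.refl

count-upTo-suc : ∀ p n → count p (upTo (suc n)) ≡ indicator (p 0) + count (p ∘ suc) (upTo n)
count-upTo-suc p n = ≡.trans (≡.cong (count p) (upTo-suc n))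
  (≡.trans (count-∷ p 0 (map suc (upTo n))) (≡.cong (indicator (p 0) +_) (count-map p suc (upTo n))))

-- The indices satisfying p form an initial segment, because p is closed downwards; their number
-- therefore determines which ones they are.
<-count : ∀ p n → (∀ s → T (p (suc s)) → T (p s)) → (∀ s → T (p s) → s < n) → ∀ s → s < count p (upTo n) ⇔ T (p s)
<-count p zero    down bound s = mk⇔ (λ ()) (λ t → bound s t)
<-count p (suc n) down bound s rewrite count-upTo-suc p n = by (p 0) ≡.refl s
  where
  IH : ∀ s → s < count (p ∘ suc) (upTo n) ⇔ T (p (suc s))
  IH = <-count (p ∘ suc) n (down ∘ suc) (λ s t → ℕ.s≤s⁻¹ (bound (suc s) t))
  by : ∀ b → p 0 ≡ b → ∀ s → s < indicator b + count (p ∘ suc) (upTo n) ⇔ T (p s)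
  by true  e zero    = mk⇔ (λ _ → ≡.subst T (≡.sym e) _) (λ _ → z<s)
  by true  e (suc s) = mk⇔ (λ q → IH s .to (ℕ.s≤s⁻¹ q)) (λ t → s≤s (IH s .from t))
  by false e s       = mk⇔ (λ q → ⊥-elim (empty (suc s) (IH s .to q))) (λ t → ⊥-elim (empty s t))
    where
    empty : ∀ s → T (p s) → ⊥
    empty zero    t = ≡.subst T e t
    empty (suc s) t = empty s (down s t)

-- The two transpositions generate all permutations of the coordinates, so closure and boundedness
-- in one coordinate give them in all three.
record TotallySymmetric (m : ℕ) (S : ℕ → ℕ → ℕ → Set) : Set where
  field
    swap₁₂  : ∀ {i j k} → S i j k → S j i k
    swap₂₃  : ∀ {i j k} → S i j k → S i k j
    down₁   : ∀ {i j k} → S (suc i) j k → S i j k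
    bounded : ∀ {i j k} → S i j k → k < m

  down₂ : ∀ {i j k} → S i (suc j) k → S i j k
  down₂ = swap₁₂ ∘ down₁ ∘ swap₁₂

  down₃ : ∀ {i j k} → S i j (suc k) → S i j k
  down₃ = swap₂₃ ∘ down₂ ∘ swap₂₃

record Shape (m : ℕ) (t : Array) : Set where
  field
    height  : length t ≡ m
    width   : All (λ row → length row ≡ m) t
    entries : All (All (_≤ m)) t

Cell : Array → ℕ → ℕ → ℕ → Set
Cell t i j k = k < ent t i j

module _ {m t} (sh : Shape m t) where
  open Shape sh

  -- Outside the array `nth` returns an empty row or the entry 0, and no k lies below 0.
  cell-row : ∀ {i j k} → Cell t i j k → i < m
  cell-row {i} {j} {k} p with ℕ.<-≤-connex i m
  ... | inj₁ i<m = i<m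
  ... | inj₂ m≤i = ⊥-elim (ℕ.n≮0 (≡.subst (λ row → k < nth 0 row j)
    (nth-≥ [] t (≡.subst (_≤ i) (≡.sym height) m≤i)) p))

  cell-column : ∀ {i j k} → Cell t i j k → j < m
  cell-column {i} {j} {k} p with ℕ.<-≤-connex j m
  ... | inj₁ j<m = j<m
  ... | inj₂ m≤j = ⊥-elim (ℕ.n≮0 (≡.subst (k <_) (nth-≥ 0 (nth [] t i) (≡.subst (_≤ j)
    (≡.sym (nth-All width (≡.subst (i <_) (≡.sym height) (cell-row {i} {j} p)))) m≤j)) p))

  cell-bounded : ∀ {i j k} → Cell t i j k → k < m
  cell-bounded {i} {j} p = ℕ.<-≤-trans p (nth-All (nth-All entries i<) j<)
    where
    i< = ≡.subst (i <_) (≡.sym height) (cell-row p)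
    j< = ≡.subst (j <_) (≡.sym (nth-All width i<)) (cell-column p)

∈-allLists⁺ : ∀ {a} {A : Set a} {xs : List A} {ys} → All (_∈ xs) ys → ys ∈ allLists xs (length ys)
∈-allLists⁺ []                    = here ≡.refl
∈-allLists⁺ (_∷_ {y} {ys} y∈ all) = ∈-concatMap⁺ _ (lose y∈ (∈-map⁺ (y ∷_) (∈-allLists⁺ all)))

shape⁻ : ∀ {m t} → t ∈ allLists (allLists (upTo (suc m)) m) m → Shape m t
shape⁻ {m} p with ∈-allLists⁻ m p
... | e , rows = record
  { height  = e
  ; width   = All.map (λ r → proj₁ (∈-allLists⁻ m r)) rows
  ; entries = All.map (λ r → All.map (ℕ.s≤s⁻¹ ∘ ∈-upTo⁻) (proj₂ (∈-allLists⁻ m r))) rows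
  }

shape⁺ : ∀ {m t} → Shape m t → t ∈ allLists (allLists (upTo (suc m)) m) m
shape⁺ {m} {t} sh = ≡.subst (λ n → t ∈ allLists (allLists (upTo (suc m)) m) n) height
  (∈-allLists⁺ (All.zipWith row (width , entries)))
  where
  open Shape sh
  row : ∀ {r} → length r ≡ m × All (_≤ m) r → r ∈ allLists (upTo (suc m)) m
  row {r} (e , es) = ≡.subst (λ n → r ∈ allLists (upTo (suc m)) n) e (∈-allLists⁺ (All.map (∈-upTo⁺ ∘ s≤s) es))

allIdx⁻ : ∀ m {p} → T (allIdx m p) → ∀ {i} → i < m → T (p i)
allIdx⁻ m {p} t i<m = All.applyUpTo⁻ id m (All.all⁺ p (upTo m) t) i<m

allIdx⁺ : ∀ m {p} → (∀ {i} → i < m → T (p i)) → T (allIdx m p)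
allIdx⁺ m {p} h = All.all⁻ p (All.applyUpTo⁺₁ id m h)

beq⁻ : ∀ {b c} → T (beq b c) → b ≡ c
beq⁻ {true}  {true}  _ = ≡.refl
beq⁻ {false} {false} _ = ≡.refl

beq⁺ : ∀ {b c} → b ≡ c → T (beq b c)
beq⁺ {true}  ≡.refl = _
beq⁺ {false} ≡.refl = _

valid : ℕ → Array → Bool
valid m t = isPlanePartition m t ∧ isTotallySymmetric m t

valid⁻ : ∀ {m t} → Shape m t → T (valid m t) → TotallySymmetric m (Cell t)
valid⁻ {m} {t} sh val = record
  { swap₁₂  = λ {i} {j} {k} p → ℕ.<ᵇ⇒< _ _ (≡.subst T
      (beq⁻ (proj₁ (T-∧ .to (proj₂ (T-∧ {beq (mem t i j k) (mem t i k j)} .to (sym (cell-row sh p) (cell-column sh p) (cell-bounded sh p)))))))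
      (ℕ.<⇒<ᵇ p))
  ; swap₂₃  = λ {i} {j} {k} p → ℕ.<ᵇ⇒< _ _ (≡.subst T
      (beq⁻ (proj₁ (T-∧ .to (sym (cell-row sh p) (cell-column sh p) (cell-bounded sh p))))) (ℕ.<⇒<ᵇ p))
  ; down₁   = λ {i} {j} {k} p → ℕ.<-≤-trans p (descend (cell-row sh p) (cell-column sh p))
  ; bounded = cell-bounded sh
  }
  where
  pp = proj₁ (T-∧ {isPlanePartition m t} .to val)
  ts = proj₂ (T-∧ {isPlanePartition m t} .to val)
  sym : ∀ {i j k} → i < m → j < m → k < m →
    T (beq (mem t i j k) (mem t i k j) ∧ (beq (mem t i j k) (mem t j i k) ∧ (beq (mem t i j k) (mem t j k i)
      ∧ (beq (mem t i j k) (mem t k i j) ∧ beq (mem t i j k) (mem t k j i)))))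
  sym i< j< k< = allIdx⁻ m (allIdx⁻ m (allIdx⁻ m ts i<) j<) k<
  descend : ∀ {i j} → suc i < m → j < m → ent t (suc i) j ≤ ent t i j
  descend {i} {j} i< j< = ℕ.≤ᵇ⇒≤ _ _ (≡.subst (λ b → T (if b then ent t (suc i) j ≤ᵇ ent t i j else true))
    (<⇒<ᵇ≡true i<) (proj₁ (T-∧ .to (allIdx⁻ m (allIdx⁻ m pp (ℕ.<⇒≤ i<)) j<))))

valid⁺ : ∀ {m t} → TotallySymmetric m (Cell t) → T (valid m t)
valid⁺ {m} {t} s = T-∧ {isPlanePartition m t} {isTotallySymmetric m t} .from
  ( allIdx⁺ m (λ {i} _ → allIdx⁺ m (λ {j} _ → T-∧ .from
      ( if⁺ (suc i <ᵇ m) (ℕ.≤⇒≤ᵇ (≤-from-< (λ k p → down₁ p)))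
      , if⁺ (suc j <ᵇ m) (ℕ.≤⇒≤ᵇ (≤-from-< (λ k p → down₂ p))))))
  , allIdx⁺ m (λ {i} _ → allIdx⁺ m (λ {j} _ → allIdx⁺ m (λ {k} _ → T-∧ .from
      ( same swap₂₃ swap₂₃ , T-∧ .from
      ( same swap₁₂ swap₁₂ , T-∧ .from
      ( same (swap₂₃ ∘ swap₁₂) (swap₁₂ ∘ swap₂₃) , T-∧ .from
      ( same (swap₁₂ ∘ swap₂₃) (swap₂₃ ∘ swap₁₂)
      , same (swap₁₂ ∘ swap₂₃ ∘ swap₁₂) (swap₁₂ ∘ swap₂₃ ∘ swap₁₂)))))))))
  where
  open TotallySymmetric s
  if⁺ : ∀ b {c} → T c → T (if b then c else true)
  if⁺ true  t = t
  if⁺ false t = _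
  same : ∀ {i j k i′ j′ k′} → (Cell t i j k → Cell t i′ j′ k′) → (Cell t i′ j′ k′ → Cell t i j k) →
         T (beq (mem t i j k) (mem t i′ j′ k′))
  same f g = beq⁺ (T⇔≡ (ℕ.<⇒<ᵇ ∘ f ∘ ℕ.<ᵇ⇒< _ _) (ℕ.<⇒<ᵇ ∘ g ∘ ℕ.<ᵇ⇒< _ _))

∈-TSPP⁻ : ∀ {m t} → t ∈ TSPP m → Shape m t × TotallySymmetric m (Cell t)
∈-TSPP⁻ {m} p with ∈-filter⁻ _ {xs = allLists (allLists (upTo (suc m)) m) m} p
... | q , val = shape⁻ q , valid⁻ (shape⁻ q) val

∈-TSPP⁺ : ∀ {m t} → Shape m t → TotallySymmetric m (Cell t) → t ∈ TSPP m
∈-TSPP⁺ {m} {t} sh s = ∈-filter⁺ _ (shape⁺ sh) (valid⁺ {m} {t} s)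

-- The numbers a d i = #{ s : (i, i + s, i + s + d) ∈ π }, with coordinates counted from 0.
record Diagonals (m : ℕ) (a : ℕ → ℕ → ℕ) : Set where
  field
    strictly : ∀ {d i s} → s < a d (suc i) → suc s < a d i
    nested   : ∀ {d i s} → s < a (suc d) i → s < a d i
    raised   : ∀ {d i s} → suc s < a d i → s < a (suc d) i
    inside   : ∀ {d i s} → s < a d i → i + s + d < m

-- From chains to totally symmetric plane partitions and back

raise-nth : ∀ {as bs} → Raise as bs → ∀ i → nth 0 as i ≤ nth 0 bs i × nth 0 bs i ≤ suc (nth 0 as i)
raise-nth none     i       = z≤n , z≤n
raise-nth new      zero    = z≤n , ℕ.≤-refl
raise-nth new      (suc i) = z≤n , z≤n
raise-nth (stay r) zero    = ℕ.≤-refl , ℕ.n≤1+n _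
raise-nth (stay r) (suc i) = raise-nth r i
raise-nth (up r)   zero    = ℕ.n≤1+n _ , ℕ.≤-refl
raise-nth (up r)   (suc i) = raise-nth r i

strict-nth : ∀ as → T (strict as) → ∀ i {s} → s < nth 0 as (suc i) → suc s < nth 0 as i
strict-nth (a ∷ b ∷ as) st zero    p = ℕ.<-≤-trans (s≤s p) (ℕ.<ᵇ⇒< b a (proj₁ (T-∧ .to st)))
strict-nth (a ∷ b ∷ as) st (suc i) p = strict-nth (b ∷ as) (proj₂ (T-∧ {b <ᵇ a} .to st)) i p

chain-diagonals : ∀ {c} → IsChain c → Diagonals (length c) (ent c)
chain-diagonals [] = record { strictly = λ () ; nested = λ () ; raised = λ () ; inside = λ () }
chain-diagonals (_∷_ {α} {c} (r , st) ic) = record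
  { strictly = λ {d} → strictly′ d ; nested = λ {d} → nested′ d ; raised = λ {d} → raised′ d ; inside = λ {d} → inside′ d }
  where
  open Diagonals (chain-diagonals ic)
  strictly′ : ∀ d {i s} → s < ent (α ∷ c) d (suc i) → suc s < ent (α ∷ c) d i
  strictly′ zero    {i} p = strict-nth α st i p
  strictly′ (suc d)     p = strictly {d} p
  nested′ : ∀ d {i s} → s < ent (α ∷ c) (suc d) i → s < ent (α ∷ c) d i
  nested′ zero    {i} p = ℕ.<-≤-trans p (proj₁ (raise-nth r i))
  nested′ (suc d)     p = nested {d} p
  raised′ : ∀ d {i s} → suc s < ent (α ∷ c) d i → s < ent (α ∷ c) (suc d) i
  raised′ zero    {i} p = ℕ.s≤s⁻¹ (ℕ.<-≤-trans p (proj₂ (raise-nth r i)))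
  raised′ (suc d)     p = raised {d} p
  inside′ : ∀ d {i s} → s < ent (α ∷ c) d i → i + s + d < suc (length c)
  inside′ (suc d) {i} {s} p = ≡.subst (_< suc (length c)) (≡.sym (ℕ.+-suc (i + s) d)) (s≤s (inside {d} p))
  inside′ zero {i} {suc s} p = ≡.subst (_< suc (length c)) (≡.cong (_+ 0) (≡.sym (ℕ.+-suc i s)))
    (s≤s (inside {0} (raised′ 0 {i} p)))
  inside′ zero {zero} {zero} p = z<s
  -- A part in position i + 1 forces its predecessor to be at least 2, and a part of size at least 2
  -- already existed one step earlier.
  inside′ zero {suc i} {zero} p = s≤s (inside {0} {i} (raised′ 0 {i} (strictly′ 0 {i} p)))

parts : ℕ → (ℕ → ℕ) → List ℕ
parts zero    f = []
parts (suc n) f = if 1 ≤ᵇ f 0 then f 0 ∷ parts n (f ∘ suc) else []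

-- Strict decrease down to 0 and constantly 0 afterwards: a strict partition padded with zeros.
Descending : (ℕ → ℕ) → Set
Descending f = ∀ i {s} → s < f (suc i) → suc s < f i

descending-zero : ∀ {f} → Descending f → f 0 ≡ 0 → ∀ i → f i ≡ 0
descending-zero h e zero    = e
descending-zero {f} h e (suc i) with f (suc i) in e′
... | zero  = ≡.refl
... | suc n = ⊥-elim (ℕ.n≮0 (≡.subst (1 <_) (descending-zero h e i) (h i {0} (≡.subst (0 <_) (≡.sym e′) z<s))))

nth-parts : ∀ n f → Descending f → (∀ i → n ≤ i → f i ≡ 0) → ∀ i → nth 0 (parts n f) i ≡ f i
nth-parts zero    f h z i = ≡.sym (z i z≤n)
nth-parts (suc n) f h z i with f 0 in e
... | zero  = ≡.sym (descending-zero h e i)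
nth-parts (suc n) f h z zero    | suc b = ≡.sym e
nth-parts (suc n) f h z (suc i) | suc b = nth-parts n (f ∘ suc) (h ∘ suc) (λ i p → z (suc i) (s≤s p)) i

parts-strict : ∀ n f → Descending f → T (strict (parts n f))
parts-strict zero          f h = _
parts-strict (suc zero)    f h with f 0
... | zero  = _
... | suc b = _
parts-strict (suc (suc n)) f h with f 0 in e | f 1 in e′ | parts-strict (suc n) (f ∘ suc) (h ∘ suc)
... | zero  | _      | _  = _
... | suc b | zero   | st = _
... | suc b | suc b′ | st = T-∧ .from
  (ℕ.<⇒<ᵇ (≡.subst (suc b′ <_) e (h 0 {b′} (≡.subst (b′ <_) (≡.sym e′) ℕ.≤-refl))) , st)

parts-zero : ∀ n f → f 0 ≡ 0 → parts n f ≡ []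
parts-zero zero    f e = ≡.refl
parts-zero (suc n) f e rewrite e = ≡.refl

descending-one : ∀ {f} → Descending f → f 0 ≡ 1 → f 1 ≡ 0
descending-one h e = ℕ.n≤0⇒n≡0 (≤-from-< (λ s p → ℕ.s≤s⁻¹ (≡.subst (suc s <_) e (h 0 p))))

parts-raise : ∀ n f g → Descending g → (∀ i → f i ≤ g i) → (∀ i → g i ≤ suc (f i)) → Raise (parts n f) (parts n g)
parts-raise zero    f g h lo hi = none
parts-raise (suc n) f g h lo hi with f 0 in ef | g 0 in eg | lo 0 | hi 0
... | zero  | zero        | _  | _        = none
... | zero  | suc zero    | _  | _        rewrite parts-zero n (g ∘ suc) (descending-one h eg) = new
... | zero  | suc (suc _) | _  | s≤s ()
... | suc b | zero        | () | _
... | suc b | suc b′      | p  | q with ℕ.m≤n⇒m<n∨m≡n (ℕ.s≤s⁻¹ p)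
... | inj₂ ≡.refl = stay (parts-raise n (f ∘ suc) (g ∘ suc) (h ∘ suc) (lo ∘ suc) (hi ∘ suc))
... | inj₁ b<b′ rewrite ℕ.≤-antisym (ℕ.s≤s⁻¹ q) b<b′ = up (parts-raise n (f ∘ suc) (g ∘ suc) (h ∘ suc) (lo ∘ suc) (hi ∘ suc))

parts-isChain : ∀ n m a → Diagonals m a → IsChain (map (λ d → parts n (a d)) (upTo m))
parts-isChain n zero    a D = []
parts-isChain n (suc m) a D = ≡.subst IsChain
  (≡.sym (≡.trans (≡.cong (map (λ d → parts n (a d))) (upTo-suc m))
    (≡.cong (parts n (a 0) ∷_) (≡.sym (map-∘ (upTo m))))))
  ((≡.subst (λ as → Raise as (parts n (a 0))) (newest≡ m inside)
      (parts-raise n (a 1) (a 0) (λ i → strictly {0} {i}) (λ i → ≤-from-< (λ s → nested {0}))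
        (λ i → ≤-from-< (λ { zero _ → z<s ; (suc s) p → s≤s (raised {0} p) })))
    , parts-strict n (a 0) (λ i → strictly {0} {i}))
   ∷ parts-isChain n m (a ∘ suc) (record
       { strictly = λ {d} → strictly {suc d} ; nested = λ {d} → nested {suc d} ; raised = λ {d} → raised {suc d}
       ; inside = λ {d} {i} {s} p → ℕ.s≤s⁻¹ (≡.subst (_< suc m) (ℕ.+-suc (i + s) d) (inside {suc d} p)) }))
  where
  open Diagonals D
  newest≡ : ∀ m → (∀ {d i s} → s < a d i → i + s + d < suc m) →
            parts n (a 1) ≡ newest (map (λ d → parts n (a (suc d))) (upTo m))
  newest≡ (suc m) _ = ≡.refl
  -- There is no older entry, so `newest` falls back to the empty list; the bound on the cells makes
  -- a 1 vanish as well.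
  newest≡ zero    b = parts-zero n (a 1) (ℕ.n≤0⇒n≡0 (≤-from-< (λ s p →
    ⊥-elim (ℕ.n≮0 (ℕ.s≤s⁻¹ (≡.subst (_< 1) (ℕ.+-suc s 0) (b {1} p)))))))

-- The median is written as the maximum of the pairwise minima, a form that shows both its symmetry
-- and its monotonicity.
lo mid hi : ℕ → ℕ → ℕ → ℕ
lo  i j k = i ⊓ (j ⊓ k)
mid i j k = (i ⊓ j) ⊔ ((i ⊓ k) ⊔ (j ⊓ k))
hi  i j k = i ⊔ (j ⊔ k)

lo-swap₁₂ : ∀ i j k → lo i j k ≡ lo j i k
lo-swap₁₂ i j k = ≡.trans (≡.sym (ℕ.⊓-assoc i j k)) (≡.trans (≡.cong (_⊓ k) (ℕ.⊓-comm i j)) (ℕ.⊓-assoc j i k))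

lo-swap₂₃ : ∀ i j k → lo i j k ≡ lo i k j
lo-swap₂₃ i j k = ≡.cong (i ⊓_) (ℕ.⊓-comm j k)

hi-swap₁₂ : ∀ i j k → hi i j k ≡ hi j i k
hi-swap₁₂ i j k = ≡.trans (≡.sym (ℕ.⊔-assoc i j k)) (≡.trans (≡.cong (_⊔ k) (ℕ.⊔-comm i j)) (ℕ.⊔-assoc j i k))

hi-swap₂₃ : ∀ i j k → hi i j k ≡ hi i k j
hi-swap₂₃ i j k = ≡.cong (i ⊔_) (ℕ.⊔-comm j k)

mid-swap₁₂ : ∀ i j k → mid i j k ≡ mid j i k
mid-swap₁₂ i j k = ≡.cong₂ _⊔_ (ℕ.⊓-comm i j) (ℕ.⊔-comm (i ⊓ k) (j ⊓ k))

mid-swap₂₃ : ∀ i j k → mid i j k ≡ mid i k j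
mid-swap₂₃ i j k = ≡.trans (hi-swap₁₂ (i ⊓ j) (i ⊓ k) (j ⊓ k)) (≡.cong (λ x → (i ⊓ k) ⊔ ((i ⊓ j) ⊔ x)) (ℕ.⊓-comm j k))

lo≤mid : ∀ i j k → lo i j k ≤ mid i j k
lo≤mid i j k = ℕ.≤-trans (ℕ.⊓-monoʳ-≤ i (ℕ.m⊓n≤m j k)) (ℕ.m≤m⊔n (i ⊓ j) _)

mid≤hi : ∀ i j k → mid i j k ≤ hi i j k
mid≤hi i j k = ℕ.⊔-lub (ℕ.≤-trans (ℕ.m⊓n≤m i j) (ℕ.m≤m⊔n i _))
  (ℕ.⊔-lub (ℕ.≤-trans (ℕ.m⊓n≤m i k) (ℕ.m≤m⊔n i _))
    (ℕ.≤-trans (ℕ.m⊓n≤m j k) (ℕ.≤-trans (ℕ.m≤m⊔n j k) (ℕ.m≤n⊔m i _))))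

descend : ∀ {P : ℕ → Set} {x′ x} → x′ ≤ x → (∀ {n} → x′ ≤ n → n < x → P (suc n) → P n) → P x → P x′
descend {x = zero}  z≤n  step p = p
descend {x = suc x} x′≤x step p with ℕ.m≤n⇒m<n∨m≡n x′≤x
... | inj₂ ≡.refl      = p
... | inj₁ (s≤s x′≤x₁) = descend x′≤x₁ (λ q r → step q (ℕ.m<n⇒m<1+n r)) (step x′≤x₁ ℕ.≤-refl p)

∸-suc : ∀ {m n} → n < m → m ∸ n ≡ suc (m ∸ suc n)
∸-suc {suc m} (s≤s n≤m) = ℕ.+-∸-assoc 1 n≤m

-- Meant for x ≤ y ≤ z: the triple (x, x + s, x + s + d) is decided by entry d, part x and offset s.
SortedCell : (ℕ → ℕ → ℕ) → ℕ → ℕ → ℕ → Set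
SortedCell a x y z = y ∸ x < a (z ∸ y) x

SymmetricCell : (ℕ → ℕ → ℕ) → ℕ → ℕ → ℕ → Set
SymmetricCell a i j k = SortedCell a (lo i j k) (mid i j k) (hi i j k)

module _ {m a} (D : Diagonals m a) where
  open Diagonals D

  -- The coordinates are lowered in the order x, y, z, which keeps the triple sorted throughout; the
  -- single steps are `strictly`, `raised` and `nested`.
  sortedCell-mono : ∀ {x y z x′ y′ z′} → x ≤ y → y ≤ z → x′ ≤ y′ → y′ ≤ z′ → x′ ≤ x → y′ ≤ y → z′ ≤ z →
                    SortedCell a x y z → SortedCell a x′ y′ z′
  sortedCell-mono {x} {y} {z} {x′} {y′} {z′} x≤y y≤z x′≤y′ y′≤z′ x′≤x y′≤y z′≤z p =
    descend {P = λ z → SortedCell a x′ y′ z} z′≤z (λ {n} z′≤n _ q →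
        nested (≡.subst (λ d → y′ ∸ x′ < a d x′) (ℕ.+-∸-assoc 1 (ℕ.≤-trans y′≤z′ z′≤n)) q))
      (descend {P = λ y → SortedCell a x′ y z} y′≤y (λ {n} y′≤n n<y q →
          ≡.subst (λ d → n ∸ x′ < a d x′) (≡.sym (∸-suc (ℕ.<-≤-trans n<y y≤z)))
            (raised (≡.subst (_< a (z ∸ suc n) x′) (ℕ.+-∸-assoc 1 (ℕ.≤-trans x′≤y′ y′≤n)) q)))
        (descend {P = λ x → SortedCell a x y z} x′≤x (λ {n} _ n<x q →
            ≡.subst (_< a (z ∸ y) n) (≡.sym (∸-suc (ℕ.<-≤-trans n<x x≤y))) (strictly q)) p))

  symmetricCell-totallySymmetric : TotallySymmetric m (SymmetricCell a)
  symmetricCell-totallySymmetric = record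
    { swap₁₂ = λ {i} {j} {k} → transport (lo-swap₁₂ i j k) (mid-swap₁₂ i j k) (hi-swap₁₂ i j k)
    ; swap₂₃ = λ {i} {j} {k} → transport (lo-swap₂₃ i j k) (mid-swap₂₃ i j k) (hi-swap₂₃ i j k)
    ; down₁  = λ {i} {j} {k} → sortedCell-mono (lo≤mid (suc i) j k) (mid≤hi (suc i) j k) (lo≤mid i j k) (mid≤hi i j k)
        (ℕ.⊓-monoˡ-≤ (j ⊓ k) (ℕ.n≤1+n i))
        (ℕ.⊔-mono-≤ (ℕ.⊓-monoˡ-≤ j (ℕ.n≤1+n i)) (ℕ.⊔-monoˡ-≤ (j ⊓ k) (ℕ.⊓-monoˡ-≤ k (ℕ.n≤1+n i))))
        (ℕ.⊔-monoˡ-≤ (j ⊔ k) (ℕ.n≤1+n i))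
    ; bounded = λ {i} {j} {k} p → ℕ.≤-<-trans (ℕ.≤-trans (ℕ.m≤n⊔m j k) (ℕ.m≤n⊔m i _))
        (≡.subst (_< m) (≡.trans
          (≡.cong (_+ (hi i j k ∸ mid i j k)) (ℕ.m+[n∸m]≡n (lo≤mid i j k)))
          (ℕ.m+[n∸m]≡n (mid≤hi i j k))) (inside p))
    }
    where
    transport : ∀ {x y z x′ y′ z′} → x ≡ x′ → y ≡ y′ → z ≡ z′ → SortedCell a x y z → SortedCell a x′ y′ z′
    transport ≡.refl ≡.refl ≡.refl p = p

symmetricCell-sorted : ∀ a i s d → SymmetricCell a i (i + s) (i + s + d) ≡ (s < a d i)
symmetricCell-sorted a i s d
  rewrite ℕ.m≤n⇒m⊓n≡m {i + s} {i + s + d} (ℕ.m≤m+n (i + s) d) | ℕ.m≤n⇒m⊓n≡m {i} {i + s} (ℕ.m≤m+n i s)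
  | ℕ.m≤n⇒m⊓n≡m {i} {i + s + d} (ℕ.≤-trans (ℕ.m≤m+n i s) (ℕ.m≤m+n (i + s) d))
  | ℕ.m≤n⇒m⊔n≡n {i} {i + s} (ℕ.m≤m+n i s) | ℕ.m≤n⇒m⊔n≡n {i} {i + s} (ℕ.m≤m+n i s)
  | ℕ.m≤n⇒m⊔n≡n {i + s} {i + s + d} (ℕ.m≤m+n (i + s) d)
  | ℕ.m≤n⇒m⊔n≡n {i} {i + s + d} (ℕ.≤-trans (ℕ.m≤m+n i s) (ℕ.m≤m+n (i + s) d))
  | ℕ.m+n∸m≡n i s | ℕ.m+n∸m≡n (i + s) d = ≡.refl

count-upTo-≤ : ∀ (p : ℕ → Bool) n → count p (upTo n) ≤ n
count-upTo-≤ p n = ℕ.≤-trans (length-filter _ (upTo n)) (ℕ.≤-reflexive (length-upTo n))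

symmetricCellᵇ : (ℕ → ℕ → ℕ) → ℕ → ℕ → ℕ → Bool
symmetricCellᵇ a i j k = (mid i j k ∸ lo i j k) <ᵇ a (hi i j k ∸ mid i j k) (lo i j k)

arrayRow : ℕ → Chain → ℕ → List ℕ
arrayRow m c i = map (λ j → count (symmetricCellᵇ (ent c) i j) (upTo m)) (upTo m)

toArray : ℕ → Chain → Array
toArray m c = map (arrayRow m c) (upTo m)

All-map-upTo : ∀ {a p} {A : Set a} {P : A → Set p} (f : ℕ → A) n → (∀ i → P (f i)) → All P (map f (upTo n))
All-map-upTo f n h = All.map⁺ (All.universal h (upTo n))

toArray-shape : ∀ m c → Shape m (toArray m c)
toArray-shape m c = record
  { height  = length-map-upTo (arrayRow m c) m
  ; width   = All-map-upTo (arrayRow m c) m (λ i → length-map-upTo _ m)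
  ; entries = All-map-upTo (arrayRow m c) m (λ i → All-map-upTo _ m (λ j → count-upTo-≤ _ m))
  }

-- For fixed i and j inside the box the counted k form an initial segment. Outside the box neither
-- side has a cell, on the right because symmetry carries the bound to every coordinate.
cell-toArray : ∀ {c} → IsChain c → ∀ i j k → Cell (toArray (length c) c) i j k ⇔ SymmetricCell (ent c) i j k
cell-toArray {c} ic i j k = mk⇔ there′ back
  where
  m = length c
  open TotallySymmetric (symmetricCell-totallySymmetric (chain-diagonals ic))
  ent≡ : i < m → j < m → ent (toArray m c) i j ≡ count (symmetricCellᵇ (ent c) i j) (upTo m)
  ent≡ i<m j<m = ≡.trans (≡.cong (λ r → nth 0 r j) (nth-map-upTo [] (arrayRow m c) i<m)) (nth-map-upTo 0 _ j<m)
  segment : k < count (symmetricCellᵇ (ent c) i j) (upTo m) ⇔ T (symmetricCellᵇ (ent c) i j k)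
  segment = <-count _ m
    (λ s t → ℕ.<⇒<ᵇ (down₃ {i} {j} {s} (ℕ.<ᵇ⇒< (mid i j (suc s) ∸ lo i j (suc s)) _ t)))
    (λ s t → bounded {i} {j} {s} (ℕ.<ᵇ⇒< (mid i j s ∸ lo i j s) _ t)) k
  there′ : Cell (toArray m c) i j k → SymmetricCell (ent c) i j k
  there′ p = ℕ.<ᵇ⇒< (mid i j k ∸ lo i j k) _ (segment .to (≡.subst (k <_)
    (ent≡ (cell-row (toArray-shape m c) p) (cell-column (toArray-shape m c) p)) p))
  back : SymmetricCell (ent c) i j k → Cell (toArray m c) i j k
  back p = ≡.subst (k <_) (≡.sym (ent≡ i<m j<m)) (segment .from (ℕ.<⇒<ᵇ p))
    where
    j<m = bounded {i} {k} {j} (swap₂₃ {i} {j} {k} p)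
    i<m = bounded {k} {j} {i} (swap₂₃ {k} {i} {j} (swap₁₂ {i} {k} {j} (swap₂₃ {i} {j} {k} p)))

cell-toArray-sorted : ∀ {c} → IsChain c → ∀ i s d → Cell (toArray (length c) c) i (i + s) (i + s + d) ⇔ s < ent c d i
cell-toArray-sorted {c} ic i s d = ≡.subst (λ P → Cell (toArray (length c) c) i (i + s) (i + s + d) ⇔ P)
  (symmetricCell-sorted (ent c) i s d) (cell-toArray ic i (i + s) (i + s + d))

transport-totallySymmetric : ∀ {m S S′} → (∀ i j k → S′ i j k ⇔ S i j k) → TotallySymmetric m S → TotallySymmetric m S′
transport-totallySymmetric e s = record
  { swap₁₂  = λ p → e _ _ _ .from (swap₁₂ (e _ _ _ .to p))
  ; swap₂₃  = λ p → e _ _ _ .from (swap₂₃ (e _ _ _ .to p))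
  ; down₁   = λ p → e _ _ _ .from (down₁ (e _ _ _ .to p))
  ; bounded = λ p → bounded (e _ _ _ .to p)
  }
  where open TotallySymmetric s

toArray-totallySymmetric : ∀ {c} → IsChain c → TotallySymmetric (length c) (Cell (toArray (length c) c))
toArray-totallySymmetric ic =
  transport-totallySymmetric (cell-toArray ic) (symmetricCell-totallySymmetric (chain-diagonals ic))

diagonalOf : ℕ → Array → ℕ → ℕ → ℕ
diagonalOf m t d i = count (λ s → mem t i (i + s) (i + s + d)) (upTo m)

chainOf : ℕ → Array → Chain
chainOf m t = map (λ d → parts m (diagonalOf m t d)) (upTo m)

module _ {m t} (ts : TotallySymmetric m (Cell t)) where
  open TotallySymmetric ts

  <-diagonalOf : ∀ d i s → s < diagonalOf m t d i ⇔ Cell t i (i + s) (i + s + d)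
  <-diagonalOf d i s = mk⇔ (λ p → ℕ.<ᵇ⇒< _ _ (segment .to p)) (λ p → segment .from (ℕ.<⇒<ᵇ p))
    where
    segment = <-count (λ s → mem t i (i + s) (i + s + d)) m
      (λ s p → ℕ.<⇒<ᵇ (down₃ (down₂ (≡.subst (λ x → Cell t i x (x + d)) (ℕ.+-suc i s) (ℕ.<ᵇ⇒< _ _ p)))))
      (λ s p → ℕ.≤-<-trans (ℕ.≤-trans (ℕ.m≤n+m s i) (ℕ.m≤m+n (i + s) d)) (bounded (ℕ.<ᵇ⇒< _ _ p))) s

  diagonalOf-diagonals : Diagonals m (diagonalOf m t)
  diagonalOf-diagonals = record
    { strictly = λ {d} {i} {s} p → <-diagonalOf d i (suc s) .from
        (≡.subst (λ x → Cell t i x (x + d)) (≡.sym (ℕ.+-suc i s)) (down₁ (<-diagonalOf d (suc i) s .to p)))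
    ; nested   = λ {d} {i} {s} p → <-diagonalOf d i s .from
        (down₃ (≡.subst (Cell t i (i + s)) (ℕ.+-suc (i + s) d) (<-diagonalOf (suc d) i s .to p)))
    ; raised   = λ {d} {i} {s} p → <-diagonalOf (suc d) i s .from
        (≡.subst (Cell t i (i + s)) (≡.sym (ℕ.+-suc (i + s) d))
          (down₂ (≡.subst (λ x → Cell t i x (x + d)) (ℕ.+-suc i s) (<-diagonalOf d i (suc s) .to p))))
    ; inside   = λ {d} {i} {s} p → bounded (<-diagonalOf d i s .to p)
    }

  chainOf-isChain : IsChain (chainOf m t)
  chainOf-isChain = parts-isChain m m (diagonalOf m t) diagonalOf-diagonals

  ent-chainOf : ∀ d i → ent (chainOf m t) d i ≡ diagonalOf m t d i
  ent-chainOf d i with ℕ.<-≤-connex d m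
  ... | inj₁ d<m = ≡.trans (≡.cong (λ r → nth 0 r i) (nth-map-upTo [] (λ d → parts m (diagonalOf m t d)) d<m))
    (nth-parts m (diagonalOf m t d) (λ i → strictly {d} {i}) (λ i m≤i → ℕ.n≤0⇒n≡0 (≤-from-< (λ s p →
      ⊥-elim (ℕ.<⇒≱ (ℕ.≤-<-trans (ℕ.≤-trans (ℕ.m≤m+n i s) (ℕ.m≤m+n (i + s) d)) (inside {d} p)) m≤i)))) i)
    where open Diagonals diagonalOf-diagonals
  ... | inj₂ m≤d = ≡.trans (≡.cong (λ r → nth 0 r i) (nth-≥ [] (chainOf m t) (≡.subst (_≤ d) (≡.sym (length-map-upTo _ m)) m≤d)))
    (≡.sym (ℕ.n≤0⇒n≡0 (≤-from-< (λ s p → ⊥-elim (ℕ.<⇒≱ (ℕ.≤-<-trans (ℕ.m≤n+m d (i + s)) (inside {d} p)) m≤d)))))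
    where open Diagonals diagonalOf-diagonals

sorted-wlog : ∀ (Q : ℕ → ℕ → ℕ → Set) → (∀ {i j k} → Q i j k → Q j i k) → (∀ {i j k} → Q i j k → Q i k j) →
              (∀ i s d → Q i (i + s) (i + s + d)) → ∀ i j k → Q i j k
sorted-wlog Q swap₁₂ swap₂₃ sorted = cases
  where
  sorted′ : ∀ {i j k} → i ≤ j → j ≤ k → Q i j k
  sorted′ {i} {j} {k} i≤j j≤k = ≡.subst (λ j′ → Q i j′ k) (ℕ.m+[n∸m]≡n i≤j)
    (≡.subst (Q i (i + (j ∸ i))) (≡.trans (≡.cong (_+ (k ∸ j)) (ℕ.m+[n∸m]≡n i≤j)) (ℕ.m+[n∸m]≡n j≤k))
      (sorted i (j ∸ i) (k ∸ j)))
  cases : ∀ i j k → Q i j k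
  cases i j k with ℕ.≤-total i j | ℕ.≤-total j k | ℕ.≤-total i k
  ... | inj₁ i≤j | inj₁ j≤k | _        = sorted′ i≤j j≤k
  ... | inj₁ i≤j | inj₂ k≤j | inj₁ i≤k = swap₂₃ (sorted′ i≤k k≤j)
  ... | inj₁ i≤j | inj₂ k≤j | inj₂ k≤i = swap₂₃ (swap₁₂ (sorted′ k≤i i≤j))
  ... | inj₂ j≤i | inj₁ j≤k | inj₁ i≤k = swap₁₂ (sorted′ j≤i i≤k)
  ... | inj₂ j≤i | inj₁ j≤k | inj₂ k≤i = swap₁₂ (swap₂₃ (sorted′ j≤k k≤i))
  ... | inj₂ j≤i | inj₂ k≤j | _        = swap₁₂ (swap₂₃ (swap₁₂ (sorted′ k≤j j≤i)))

-- Both sets of cells are totally symmetric, so it suffices to compare sorted triples, which the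
-- diagonals describe directly.
toArray-chainOf : ∀ {m t} → Shape m t → TotallySymmetric m (Cell t) → toArray m (chainOf m t) ≡ t
toArray-chainOf {m} {t} sh ts = nth-ext [] (≡.trans (length-map-upTo _ m) (≡.sym height)) (λ i i< →
  let i<m = ≡.subst (i <_) (length-map-upTo _ m) i<
      lr  = ≡.trans (≡.cong length (nth-map-upTo [] (arrayRow m c) i<m)) (length-map-upTo _ m)
  in nth-ext 0 (≡.trans lr (≡.sym (nth-All width (≡.subst (i <_) (≡.sym height) i<m))))
       (λ j _ → ≡-from-< (λ k → cell i j k)))
  where
  open Shape sh
  c  = chainOf m t
  ic = chainOf-isChain {m} {t} ts
  lc : length c ≡ m
  lc = length-map-upTo _ m
  module TS = TotallySymmetric ts
  module SC = TotallySymmetric (symmetricCell-totallySymmetric (chain-diagonals ic))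
  cell : ∀ i j k → Cell (toArray m c) i j k ⇔ Cell t i j k
  cell i j k = ⇔.trans (≡.subst (λ m → Cell (toArray m c) i j k ⇔ SymmetricCell (ent c) i j k) lc (cell-toArray ic i j k))
    (sorted-wlog (λ i j k → SymmetricCell (ent c) i j k ⇔ Cell t i j k)
      (λ {i} {j} {k} e → mk⇔ (λ p → TS.swap₁₂ (e .to (SC.swap₁₂ {j} {i} {k} p))) (λ p → SC.swap₁₂ {i} {j} {k} (e .from (TS.swap₁₂ p))))
      (λ {i} {j} {k} e → mk⇔ (λ p → TS.swap₂₃ (e .to (SC.swap₂₃ {i} {k} {j} p))) (λ p → SC.swap₂₃ {i} {j} {k} (e .from (TS.swap₂₃ p))))
      (λ i s d → ≡.subst (λ P → P ⇔ Cell t i (i + s) (i + s + d)) (≡.sym (≡.trans (symmetricCell-sorted (ent c) i s d)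
        (≡.cong (s <_) (ent-chainOf {m} {t} ts d i)))) (<-diagonalOf {m} {t} ts d i s))
      i j k)

chain-positive : ∀ {c} → IsChain c → All (All (0 <_)) c
chain-positive []            = []
chain-positive (r ∷ ic) = newest-positive (r ∷ ic) ∷ chain-positive ic

-- For positive parts the default 0 of `nth` reveals where a list ends, so no separate comparison of
-- lengths is required.
positive-ext : ∀ {xs ys} → All (0 <_) xs → All (0 <_) ys → (∀ i → nth 0 xs i ≡ nth 0 ys i) → xs ≡ ys
positive-ext []       []       h = ≡.refl
positive-ext []       (p ∷ ps) h = ⊥-elim (ℕ.<⇒≢ p (h 0))
positive-ext (p ∷ ps) []       h = ⊥-elim (ℕ.<⇒≢ p (≡.sym (h 0)))
positive-ext (p ∷ ps) (q ∷ qs) h = ≡.cong₂ _∷_ (h 0) (positive-ext ps qs (h ∘ suc))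

chainOf-toArray : ∀ {c} → IsChain c → chainOf (length c) (toArray (length c) c) ≡ c
chainOf-toArray {c} ic = nth-ext [] (length-map-upTo _ m) (λ d d< →
  positive-ext (nth-All (chain-positive (chainOf-isChain {m} {t} ts)) d<)
    (nth-All (chain-positive ic) (≡.subst (d <_) (length-map-upTo _ m) d<))
    (λ i → ≡.trans (ent-chainOf {m} {t} ts d i) (≡-from-< (λ s →
      ⇔.trans (<-diagonalOf {m} {t} ts d i s) (cell-toArray-sorted ic i s d)))))
  where
  m  = length c
  t  = toArray m c
  ts = toArray-totallySymmetric ic

-- Enumerations without repetition and the resulting bijection

-- By `tag` an element determines the x from which it was produced, so the blocks of different x are
-- disjoint.
concatMap-unique : ∀ {a b} {A : Set a} {B : Set b} (k : A → List B) → (∀ {x x′ y} → y ∈ k x → y ∈ k x′ → x ≡ x′) →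
                   (∀ x → Unique (k x)) → ∀ {xs} → Unique xs → Unique (concatMap k xs)
concatMap-unique k tag u []                          = []
concatMap-unique k tag u (_∷_ {x} {xs} x∉ unique-xs) = Unique.++⁺ (u x) (concatMap-unique k tag u unique-xs)
  (λ (y∈ , y∈′) → let (x′ , x′∈ , y∈kx′) = find (∈-concatMap⁻ k {xs = xs} y∈′) in
    All.lookup x∉ x′∈ (tag y∈ y∈kx′))

allLists-unique : ∀ {a} {A : Set a} {xs : List A} → Unique xs → ∀ k → Unique (allLists xs k)
allLists-unique         u zero    = [] ∷ []
allLists-unique {xs = xs} u (suc k) = concatMap-unique (λ a → map (a ∷_) (allLists xs k))
  (λ {x} {x′} p q → let (_ , _ , e) = ∈-map⁻ (x ∷_) p ; (_ , _ , e′) = ∈-map⁻ (x′ ∷_) q in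
    ∷-injectiveˡ (≡.trans (≡.sym e) e′))
  (λ a → Unique.map⁺ ∷-injectiveʳ (allLists-unique u k)) u

TSPP-unique : ∀ m → Unique (TSPP m)
TSPP-unique m = Unique.filter⁺ _ (allLists-unique (allLists-unique (Unique.upTo⁺ (suc m)) m) m)

raises-unique : ∀ as → Unique (raises as)
raises-unique []       = ((λ ()) ∷ []) ∷ [] ∷ []
raises-unique (a ∷ as) = concatMap-unique (λ bs → (a ∷ bs) ∷ (suc a ∷ bs) ∷ [])
  (λ p q → ∷-injectiveʳ (≡.trans (≡.sym (proj₂ (form p))) (proj₂ (form q))))
  (λ bs → ((λ e → ℕ.1+n≢n (≡.sym (∷-injectiveˡ e))) ∷ []) ∷ [] ∷ [])
  (raises-unique as)
  where
  form : ∀ {bs cs : List ℕ} → cs ∈ (a ∷ bs) ∷ (suc a ∷ bs) ∷ [] → ∃ λ b → cs ≡ b ∷ bs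
  form (here e)         = a , e
  form (there (here e)) = suc a , e

chains-unique : ∀ m → Unique (chains m)
chains-unique zero    = [] ∷ []
chains-unique (suc m) = concatMap-unique (λ c → map (_∷ c) (filterᵇ strict (raises (newest c))))
  (λ {c} {c′} p q → let (_ , _ , e) = ∈-map⁻ (_∷ c) p ; (_ , _ , e′) = ∈-map⁻ (_∷ c′) q in
    ∷-injectiveʳ (≡.trans (≡.sym e) e′))
  (λ c → Unique.map⁺ ∷-injectiveˡ (Unique.filter⁺ _ (raises-unique (newest c))))
  (chains-unique m)

map-unique : ∀ {a b} {A : Set a} {B : Set b} (f : A → B) (g : B → A) {xs} → (∀ {x} → x ∈ xs → g (f x) ≡ x) →
             Unique xs → Unique (map f xs)
map-unique f g inv []              = []
map-unique f g inv (_∷_ {x} {xs} x∉ u) = All.map⁺ (All.tabulate (λ {y} y∈ e →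
    All.lookup x∉ y∈ (≡.trans (≡.sym (inv (here ≡.refl))) (≡.trans (≡.cong g e) (inv (there y∈))))))
  ∷ map-unique f g (inv ∘ there) u

-- The two enumerations are ordered differently. They agree up to permutation because both are free
-- of repetitions and have the same elements.
TSPP-↭-chains : ∀ m → TSPP m ↭ map (toArray m) (chains m)
TSPP-↭-chains m = ∼bag⇒↭ (unique∧set⇒bag (TSPP-unique m)
  (map-unique (toArray m) (chainOf m) inverse (chains-unique m)) (mk⇔ toChain fromChain))
  where
  inverse : ∀ {c} → c ∈ chains m → chainOf m (toArray m c) ≡ c
  inverse c∈ with ∈-chains⁻ m c∈
  ... | ic , ≡.refl = chainOf-toArray ic
  toChain : ∀ {t} → t ∈ TSPP m → t ∈ map (toArray m) (chains m)
  toChain {t} t∈ with ∈-TSPP⁻ t∈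
  ... | sh , ts = ≡.subst (_∈ map (toArray m) (chains m)) (toArray-chainOf sh ts)
    (∈-map⁺ (toArray m) (≡.subst (λ n → chainOf m t ∈ chains n) (length-map-upTo _ m) (∈-chains⁺ (chainOf-isChain {m} {t} ts))))
  fromChain : ∀ {t} → t ∈ map (toArray m) (chains m) → t ∈ TSPP m
  fromChain t∈ with ∈-map⁻ (toArray m) t∈
  ... | c , c∈ , ≡.refl with ∈-chains⁻ m c∈
  ... | ic , ≡.refl = ∈-TSPP⁺ (toArray-shape m c) (toArray-totallySymmetric ic)

-- Frobenius notation of the diagonal

count-nth : ∀ {a} {A : Set a} (d : A) (p : A → Bool) xs → count p xs ≡ count (λ j → p (nth d xs j)) (upTo (length xs))
count-nth d p []       = ≡.refl
count-nth d p (x ∷ xs) = ≡.trans (count-∷ p x xs)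
  (≡.trans (≡.cong (indicator (p x) +_) (count-nth d p xs)) (≡.sym (count-upTo-suc (λ j → p (nth d (x ∷ xs) j)) (length xs))))

count-> : ∀ xs k → maxL xs ≤ k → count (λ p → k <ᵇ p) xs ≡ 0
count-> []       k _ = ≡.refl
count-> (x ∷ xs) k h = ≡.trans (count-∷ (λ p → k <ᵇ p) x xs) (≡.cong₂ _+_
  (≡.cong indicator (≤⇒<ᵇ≡false (ℕ.≤-trans (ℕ.m≤m⊔n x _) h))) (count-> xs k (ℕ.≤-trans (ℕ.m≤n⊔m x _) h)))

nth-conj : ∀ xs k → nth 0 (conj xs) k ≡ count (λ p → k <ᵇ p) xs
nth-conj xs k with ℕ.<-≤-connex k (maxL xs)
... | inj₁ k< = ≡.trans (≡.cong (λ ys → nth 0 ys k) (≡.sym (map-∘ (upTo (maxL xs))))) (nth-map-upTo 0 _ k<)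
... | inj₂ ≤k = ≡.trans (nth-≥ 0 (conj xs) (ℕ.≤-trans (ℕ.≤-reflexive length-conj) ≤k)) (≡.sym (count-> xs k ≤k))
  where
  length-conj : length (conj xs) ≡ maxL xs
  length-conj = ≡.trans (length-map _ (oneTo (maxL xs))) (length-map-upTo suc (maxL xs))

-- Legs are ages. Parts are appended at the end and never disappear, so part i is present d steps
-- before the newest entry exactly when its age exceeds d.
nth-legs : ∀ {c} → IsChain c → ∀ i d → d < nth 0 (legs c) i ⇔ i < length (nth [] c d)
nth-legs [] i d = mk⇔ (λ ()) (λ ())
nth-legs (_∷_ {α} {c} (r , st) ic) i d = by (raise-born r) (ℕ.<-≤-connex i l)
  where
  l  = length (newest c)
  l≡ = length-legs ic
  L  = legs c
  nth-++ˡ : ∀ bs → i < l → nth 0 (map suc L ++ bs) i ≡ suc (nth 0 L i)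
  nth-++ˡ bs i<l = go L i (≡.subst (i <_) (≡.sym l≡) i<l)
    where
    go : ∀ as i → i < length as → nth 0 (map suc as ++ bs) i ≡ suc (nth 0 as i)
    go (a ∷ as) zero    _       = ≡.refl
    go (a ∷ as) (suc i) (s≤s p) = go as i p
  nth-++ʳ : ∀ bs → nth 0 (map suc L ++ bs) (l + (i ∸ l)) ≡ nth 0 bs (i ∸ l)
  nth-++ʳ bs = ≡.trans (≡.cong (λ n → nth 0 (map suc L ++ bs) (n + (i ∸ l))) (≡.sym l≡)) (go L)
    where
    go : ∀ as → nth 0 (map suc as ++ bs) (length as + (i ∸ l)) ≡ nth 0 bs (i ∸ l)
    go []       = ≡.refl
    go (a ∷ as) = go as
  l≤ : l ≤ length α
  l≤ with raise-born r
  ... | inj₁ (_ , e) = ≡.subst (l ≤_) (≡.sym e) (ℕ.n≤1+n l)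
  ... | inj₂ (_ , e) = ≡.subst (l ≤_) (≡.sym e) ℕ.≤-refl
  old-≥ : l ≤ i → ∀ d → ¬ (i < length (nth [] c d))
  old-≥ l≤i d p = ℕ.n≮0 (≡.subst (d <_) (nth-≥ 0 L (≡.subst (_≤ i) (≡.sym l≡) l≤i)) (nth-legs ic i d .from p))
  by : (born (newest c) α ≡ true × length α ≡ suc l) ⊎ (born (newest c) α ≡ false × length α ≡ l) → i < l ⊎ l ≤ i →
       d < nth 0 (legs (α ∷ c)) i ⇔ i < length (nth [] (α ∷ c) d)
  by b (inj₁ i<l) rewrite nth-++ˡ (if born (newest c) α then [ 1 ] else []) i<l = small d
    where
    small : ∀ d → d < suc (nth 0 L i) ⇔ i < length (nth [] (α ∷ c) d)
    small zero    = mk⇔ (λ _ → ℕ.<-≤-trans i<l l≤) (λ _ → z<s)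
    small (suc d) = mk⇔ (λ p → nth-legs ic i d .to (ℕ.s≤s⁻¹ p)) (λ p → s≤s (nth-legs ic i d .from p))
  by (inj₁ (e , le)) (inj₂ l≤i) = ≡.subst (λ n → d < n ⇔ i < length (nth [] (α ∷ c) d)) (≡.sym nth≡) (large d (i ∸ l) ≡.refl)
    where
    nth≡ : nth 0 (legs (α ∷ c)) i ≡ nth 0 [ 1 ] (i ∸ l)
    nth≡ = ≡.trans (≡.cong₂ (λ b n → nth 0 (map suc L ++ (if b then [ 1 ] else [])) n) e (≡.sym (ℕ.m+[n∸m]≡n l≤i))) (nth-++ʳ [ 1 ])
    large : ∀ d k → k ≡ i ∸ l → d < nth 0 [ 1 ] k ⇔ i < length (nth [] (α ∷ c) d)
    large zero    zero    e′ = mk⇔ (λ _ → ≡.subst (i <_) (≡.sym le) (s≤s (ℕ.m∸n≡0⇒m≤n (≡.sym e′)))) (λ _ → z<s)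
    large zero    (suc k) e′ = mk⇔ (λ ()) (λ p → ⊥-elim (ℕ.1+n≢0 (≡.trans e′ (ℕ.m≤n⇒m∸n≡0 (ℕ.s≤s⁻¹ (≡.subst (i <_) le p))))))
    large (suc d) zero    e′ = mk⇔ (λ { (s≤s ()) }) (λ p → ⊥-elim (old-≥ l≤i d p))
    large (suc d) (suc k) e′ = mk⇔ (λ ()) (λ p → ⊥-elim (old-≥ l≤i d p))
  by (inj₂ (e , le)) (inj₂ l≤i) = ≡.subst (λ n → d < n ⇔ i < length (nth [] (α ∷ c) d)) (≡.sym nth≡) (large d)
    where
    nth≡ : nth 0 (legs (α ∷ c)) i ≡ 0
    nth≡ = ≡.trans (≡.cong₂ (λ b n → nth 0 (map suc L ++ (if b then [ 1 ] else [])) n) e (≡.sym (ℕ.m+[n∸m]≡n l≤i))) (nth-++ʳ [])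
    large : ∀ d → d < 0 ⇔ i < length (nth [] (α ∷ c) d)
    large zero    = mk⇔ (λ ()) (λ p → ⊥-elim (ℕ.<⇒≱ p (≡.subst (_≤ i) (≡.sym le) l≤i)))
    large (suc d) = mk⇔ (λ ()) (λ p → ⊥-elim (old-≥ l≤i d p))

positive-nth : ∀ {as} → All (0 <_) as → ∀ i → 0 < nth 0 as i ⇔ i < length as
positive-nth []       i       = mk⇔ (λ ()) (λ ())
positive-nth (p ∷ ps) zero    = mk⇔ (λ _ → z<s) (λ _ → p)
positive-nth (p ∷ ps) (suc i) = mk⇔ (λ q → s≤s (positive-nth ps i .to q)) (λ q → positive-nth ps i .from (ℕ.s≤s⁻¹ q))

module Frobenius {c} (ic : IsChain c) where
  m = length c
  t = toArray m c
  ts = toArray-totallySymmetric ic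
  open TotallySymmetric ts

  D : List ℕ
  D = diag m t

  -- `diag` is a conjugate: its row k counts the i whose diagonal entry exceeds k, and these form an
  -- initial segment.
  arms-nth : ∀ k i → i < nth 0 D k ⇔ Cell t i i k
  arms-nth k i = ≡.subst (λ n → i < n ⇔ Cell t i i k) (≡.sym (≡.trans (nth-conj (map (λ i → ent t i i) (upTo m)) k) (count-map (λ p → k <ᵇ p) (λ i → ent t i i) (upTo m))))
    (⇔.trans (<-count (λ i → k <ᵇ ent t i i) m
        (λ s p → ℕ.<⇒<ᵇ (down₁ (down₂ (ℕ.<ᵇ⇒< k _ p))))
        (λ s p → bounded (swap₂₃ (ℕ.<ᵇ⇒< k _ p))) i)
      (mk⇔ (ℕ.<ᵇ⇒< k _) ℕ.<⇒<ᵇ))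

  -- A second conjugation leads back to the diagonal entries of the array.
  legs-nth : ∀ k j → j < nth 0 (conj D) k ⇔ Cell t k k j
  legs-nth k j = ≡.subst (λ n → j < n ⇔ Cell t k k j) (≡.sym (≡.trans (nth-conj D k) (count-nth 0 (λ p → k <ᵇ p) D)))
    (⇔.trans (<-count (λ j → k <ᵇ nth 0 D j) (length D)
        (λ s p → ℕ.<⇒<ᵇ (arms-nth s k .from (down₃ (arms-nth (suc s) k .to (ℕ.<ᵇ⇒< k _ p)))))
        (λ s p → in-range s k (ℕ.<ᵇ⇒< k _ p)) j)
      (⇔.trans (mk⇔ (ℕ.<ᵇ⇒< k _) ℕ.<⇒<ᵇ) (arms-nth j k)))
    where
    in-range : ∀ s k → k < nth 0 D s → s < length D
    in-range s k p with ℕ.<-≤-connex s (length D)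
    ... | inj₁ q = q
    ... | inj₂ q = ⊥-elim (ℕ.n≮0 (≡.subst (k <_) (nth-≥ 0 D q) p))

  leg-cell : ∀ p d → Cell t p p (p + d) ⇔ 0 < ent c d p
  leg-cell p d = ≡.subst (λ x → Cell t p x (x + d) ⇔ 0 < ent c d p) (ℕ.+-identityʳ p) (cell-toArray-sorted ic p 0 d)

  diagonal-cell : ∀ p → Cell t p p p ⇔ p < length (newest c)
  diagonal-cell p = ⇔.trans (≡.subst (λ x → Cell t p p x ⇔ 0 < ent c 0 p) (ℕ.+-identityʳ p) (leg-cell p 0))
    (positive-nth (newest-positive ic) p)

  -- The square reaches p exactly when (p, p, p) is a cell, that is, when the newest strict
  -- partition has a part in position p.
  durfee≡ : durfee D ≡ length (newest c)
  durfee≡ = ≡.trans (count-map (λ i → i ≤ᵇ nth 0 D (pred i)) suc (upTo (length D))) (≡-from-< (λ p →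
    ⇔.trans (<-count (λ p → p <ᵇ nth 0 D p) (length D)
      (λ s q → ℕ.<⇒<ᵇ (arms-nth s s .from (down₁ (down₂ (down₃ (arms-nth (suc s) (suc s) .to (ℕ.<ᵇ⇒< (suc s) _ q)))))))
      (λ s q → in-range s (ℕ.<ᵇ⇒< s _ q)) p)
    (⇔.trans (mk⇔ (ℕ.<ᵇ⇒< p _) ℕ.<⇒<ᵇ) (⇔.trans (arms-nth p p) (diagonal-cell p)))))
    where
    in-range : ∀ s → s < nth 0 D s → s < length D
    in-range s p with ℕ.<-≤-connex s (length D)
    ... | inj₁ q = q
    ... | inj₂ q = ⊥-elim (ℕ.n≮0 (≡.subst (s <_) (nth-≥ 0 D q) p))

  initial+ : ∀ {p n x} (S : ℕ → Set) → (∀ i → i < n ⇔ S i) → (∀ i → i < p → S i) → (∀ s → S (p + s) ⇔ s < x) → n ≡ p + x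
  initial+ {p} {n} {x} S e small large = ≡-from-< (λ i → ⇔.trans (e i) (segment i (ℕ.<-≤-connex i p)))
    where
    segment : ∀ i → i < p ⊎ p ≤ i → S i ⇔ i < p + x
    segment i (inj₁ i<p) = mk⇔ (λ _ → ℕ.<-≤-trans i<p (ℕ.m≤m+n p x)) (λ _ → small i i<p)
    segment i (inj₂ p≤i) = ≡.subst (λ i → S i ⇔ i < p + x) (ℕ.m+[n∸m]≡n p≤i)
      (⇔.trans (large (i ∸ p)) (mk⇔ (ℕ.+-monoʳ-< p) (ℕ.+-cancelˡ-< p _ _)))

  -- The cells (i, i, p) with i < p lie below (p, p, p). For i = p + s, symmetry turns the cell into
  -- (p, p + s, p + s), which the newest partition of the chain decides.
  arm≡ : ∀ p → p < length (newest c) → nth 0 D p ≡ p + nth 0 (newest c) p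
  arm≡ p p< = initial+ (λ i → Cell t i i p) (arms-nth p)
    (λ i i<p → descend {P = λ i → Cell t i i p} (ℕ.<⇒≤ i<p) (λ _ _ q → down₁ (down₂ q)) (diagonal-cell p .from p<))
    (λ s → ⇔.trans (mk⇔ (swap₁₂ ∘ swap₂₃) (swap₂₃ ∘ swap₁₂))
      (≡.subst (λ x → Cell t p (p + s) x ⇔ s < ent c 0 p) (ℕ.+-identityʳ (p + s)) (cell-toArray-sorted ic p s 0)))

  -- The cells (p, p, j) with j < p lie below (p, p, p). For j = p + d, the cell says that part p
  -- was present d steps back, and the number of such d is its age.
  leg≡ : ∀ p → p < length (newest c) → nth 0 (conj D) p ≡ p + nth 0 (legs c) p
  leg≡ p p< = initial+ (Cell t p p) (legs-nth p)
    (λ j j<p → descend {P = Cell t p p} (ℕ.<⇒≤ j<p) (λ _ _ q → down₃ q) (diagonal-cell p .from p<))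
    (λ d → ⇔.trans (leg-cell p d)
      (⇔.trans (row-positive d p) (⇔.sym (nth-legs ic p d))))
    where
    row-positive : ∀ d p → 0 < ent c d p ⇔ p < length (nth [] c d)
    row-positive d p with ℕ.<-≤-connex d (length c)
    ... | inj₁ d< = positive-nth (nth-All (chain-positive ic) d<) p
    ... | inj₂ ≤d rewrite nth-≥ [] c ≤d = mk⇔ (λ ()) (λ ())

  p+x∸1+p : ∀ p x → (p + x) ∸ suc p ≡ pred x
  p+x∸1+p p x = ≡.trans (≡.sym (ℕ.pred[m∸n]≡m∸[1+n] (p + x) p)) (≡.cong pred (ℕ.m+n∸m≡n p x))

  frobA≡ : frobA D ≡ map pred (newest c)
  frobA≡ = ≡.trans (≡.cong (λ l → map (λ i → nth 0 D (pred i) ∸ i) (oneTo l)) durfee≡)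
    (≡.trans (≡.sym (map-∘ (upTo (length (newest c)))))
    (≡.trans (map-cong-< (length (newest c)) (λ p p< → ≡.trans (≡.cong (_∸ suc p) (arm≡ p p<)) (p+x∸1+p p _)))
      (map-nth-upTo 0 pred (newest c))))

  frobB≡ : frobB D ≡ map pred (legs c)
  frobB≡ = ≡.trans (≡.cong (λ l → map (λ i → nth 0 (conj D) (pred i) ∸ i) (oneTo l)) durfee≡)
    (≡.trans (≡.sym (map-∘ (upTo (length (newest c)))))
    (≡.trans (map-cong-< (length (newest c)) (λ p p< → ≡.trans (≡.cong (_∸ suc p) (leg≡ p p<)) (p+x∸1+p p _)))
    (≡.trans (≡.cong (λ l → map (λ i → pred (nth 0 (legs c) i)) (upTo l)) (≡.sym (length-legs ic)))
      (map-nth-upTo 0 pred (legs c)))))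

-- The expansion over totally symmetric plane partitions

module TSPPExpansion {c ℓ : Level} (R : CommutativeRing c ℓ) (u v : CommutativeRing.Carrier R) where
  open CommutativeRing R hiding (zero)
  open WithRing R
  open import Algebra.Definitions.RawSemiring (Semiring.rawSemiring semiring) using (_^_)
  open IntegerSolver R
  open Sums R
  open Determinants R
  open Multilinear R
  open Antisymmetrizer R
  open AntisymmetrizerToDeterminant R u v (1# - u - v)
  open Expansion R u v (1# - u - v)
  open ChainWeight R u v (1# - u - v)
  open Schur R
  open Relation.Binary.Reasoning.Setoid setoid

  module _ (m : ℕ) (x : Vec Carrier (suc m)) where

    term : Array → Carrier
    term t = omega (suc m) t u v * schur (suc m) (piT m t) x

    chainTerm : ∀ {c} → IsChain c × length c ≡ m →
      term (toArray m c) ≈ chainWeight c * schurPolynomial (suc m) (lookup x) (partition c)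
    chainTerm {c} (ic , ≡.refl) = *-cong
      (trans (reflexive (≡.cong₂ ω frobA≡ frobB≡)) (sym (chainWeight-frobenius ic)))
      (trans (reflexive (≡.cong (λ λs → schur (suc m) λs x) π≡))
        (schur-filter (suc m) (lookup x) (partition c) (partition-decreasing ic)))
      where
      open Frobenius ic using (D; frobA≡; frobB≡)
      ω : List ℕ → List ℕ → Carrier
      ω as bs = u ^ sum (map suc as) * (1# - u - v) ^ (sum bs ∸ sum as) * v ^ ((suc m C 2) ∸ sum (map suc bs))
      -- The Frobenius legs of the diagonal are the ages minus one, so adding one to them for π(T)
      -- gives back the ages, the legs of `partition c`.
      π≡ : piT m (toArray m c) ≡ filterᵇ (1 ℕ.≤ᵇ_) (partition c)
      π≡ = ≡.trans (≡.cong₂ (λ as bs → fromFrob as (map suc bs)) frobA≡ frobB≡)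
        (≡.trans (≡.cong (fromFrob (map pred (newest c))) (map-suc-pred (legs-positive c))) (fromFrob-partition ic))

    RHS-chains : RHS (suc m) u v x
      ≈ ∑ (chains m) (λ c → chainWeight c * schurPolynomial (suc m) (lookup x) (partition c))
    RHS-chains = trans (∑-↭ (TSPP-↭-chains m) term) (trans (∑-map (toArray m) (chains m) term)
      (∑-cong∈ (chains m) (λ c∈ → chainTerm (∈-chains⁻ m c∈))))

    chain-alternant : ∀ {c} → IsChain c × length c ≡ m →
      det (toList x) (map monomial (exponents c))
        ≈ ε (suc m) * (vandermonde x * schurPolynomial (suc m) (lookup x) (partition c))
    chain-alternant {c} (ic , ≡.refl) = trans
      (reflexive (≡.cong₂ (λ xs es → det xs (map monomial es)) (≡.sym (tabulate-lookup x)) (≡.sym (addStaircase-partition ic))))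
      (trans (bialternant (suc m) (lookup x) (partition c) (partition-decreasing ic) (length-partition ic))
        (reflexive (≡.cong (λ xs → ε (suc m) * (Vandermonde xs * schurPolynomial (suc m) (lookup x) (partition c))) (tabulate-lookup x))))

    ASymSummand-RHS : ASymSummand (suc m) u v x ≈ vandermonde x * RHS (suc m) u v x
    ASymSummand-RHS = begin
      ASymSummand (suc m) u v x
        ≈⟨ ASymSummand-asym (suc m) u v x ⟩
      asym (suc m) (toList x) (summand u v)
        ≈⟨ asym-Summand m (toList x) length-toList ⟩
      det (toList x) (hooks m m)
        ≈⟨ det-hooks (toList x) m ⟩
      ε (suc m) * ∑ (chains m) (λ c → chainWeight c * det (toList x) (map monomial (exponents c)))
        ≈⟨ *-congˡ (∑-cong∈ (chains m) (λ {c} c∈ → trans (*-congˡ (chain-alternant (∈-chains⁻ m c∈)))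
             (solve 4 (λ a e V s → a :* (e :* (V :* s)) := (e :* V) :* (a :* s)) refl _ _ _ _))) ⟩
      ε (suc m) * ∑ (chains m) (λ c → ε (suc m) * vandermonde x * (chainWeight c * schurPolynomial (suc m) (lookup x) (partition c)))
        ≈⟨ *-congˡ (trans (∑-*ˡ _ (chains m) _) (*-congˡ (sym RHS-chains))) ⟩
      ε (suc m) * (ε (suc m) * vandermonde x * RHS (suc m) u v x)
        ≈⟨ solve 3 (λ e V r → e :* (e :* V :* r) := (e :* e) :* (V :* r)) refl _ _ _ ⟩
      ε (suc m) * ε (suc m) * (vandermonde x * RHS (suc m) u v x)
        ≈⟨ trans (*-congʳ (ε² (suc m))) (*-identityˡ _) ⟩
      vandermonde x * RHS (suc m) u v x ∎
      where
      length-toList : length (toList x) ≡ suc m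
      length-toList = ≡.trans (≡.cong length (≡.sym (tabulate-lookup x))) (length-tabulate (lookup x))

theorem1p3 : ∀ {c ℓ : Level} (R : CommutativeRing c ℓ) (n : ℕ) → 1 ≤ n →
    (u v : CommutativeRing.Carrier R) (x : Vec (CommutativeRing.Carrier R) n) →
    CommutativeRing._≈_ R (WithRing.ASymSummand R n u v x)
    (CommutativeRing._*_ R (WithRing.vandermonde R x) (WithRing.RHS R n u v x))
theorem1p3 R (suc m) _ u v x = TSPPExpansion.ASymSummand-RHS R u v m x
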